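{- For every odd integer $n\ge3$, the oriented cycle $\vec{C}_n$ of order $n$ has average uniform mixing, that is, $\widehat{M}_{\vec{C}_n}=\frac1nJ_n$.
   Context: The oriented cycle $\vec{C}_n$ has vertex set $\mathbb{Z}/n\mathbb{Z}$ and Hermitian adjacency matrix $A$ with $A_{j,j+1}=-i$ and $A_{j+1,j}=i$ for all $j\in\mathbb{Z}/n\mathbb{Z}$, and all other entries $0$ (edges consistently directed around the cycle). For a graph $X$ of order $n$ with Hermitian adjacency matrix $A$, let $U_X(t)=e^{ -itA}$ and $M_X(t)=U_X(t)\circ\overline{U_X(t)}$ (entrywise product). The average mixing matrix is $\widehat{M}_X=\lim_{T\to\infty}\frac1T\int_0^TM_X(t)\,dt$. $X$ has average uniform mixing if $\widehat{M}_X=\frac1nJ_n$, where $J_n$ is the all-one matrix. -}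

module Defs where

open import Algebra.Bundles.Raw using (RawMonoid)
open import Data.Bool using (if_then_else_)
open import Data.Fin using (Fin; zero; suc; toℕ; fromℕ; inject₁)
import Data.Fin as Fin
open import Data.Fin.Properties using (nonZeroIndex)
import Data.Integer as ℤ
open import Data.Nat as ℕ using (ℕ; zero; suc)
open import Data.Nat.Base using (_!)
open import Data.Nat.DivMod using (_mod_)
import Data.Nat.Properties as ℕ
open import Data.Product using (Σ; ∃; ∃-syntax; _×_; _,_; proj₁; proj₂)
open import Data.Rational as ℚ using (ℚ; 0ℚ; 1ℚ; ½)
import Data.Rational.Properties as ℚ
open import Data.Rational.Solver using (module +-*-Solver)
open import Data.Sum using (inj₁; inj₂)
open import Level using (0ℓ)
open import Relation.Binary.PropositionalEquality
  using (_≡_; refl; sym; trans; cong; cong₂; subst)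
open import Relation.Nullary.Decidable using (does)
import Algebra.Definitions.RawMonoid as RawMonoidDefs

-- A real number is a Cauchy sequence of rationals; equality of reals is _≈_.

Cauchy : (ℕ → ℚ) → Set
Cauchy x = ∀ ε → 0ℚ ℚ.< ε →
  ∃[ N ] (∀ m n → N ℕ.≤ m → N ℕ.≤ n → ℚ.∣ x m ℚ.- x n ∣ ℚ.≤ ε)

record ℝ : Set where
  constructor mkℝ
  field
    seq      : ℕ → ℚ
    isCauchy : Cauchy seq

open ℝ public

Eventually : (ℕ → Set) → Set
Eventually P = ∃[ N ] (∀ n → N ℕ.≤ n → P n)

infix 4 _≈_ _≤_ _<_

_≈_ : ℝ → ℝ → Set
x ≈ y = ∀ ε → 0ℚ ℚ.< ε → Eventually λ n → ℚ.∣ seq x n ℚ.- seq y n ∣ ℚ.≤ ε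

_≤_ : ℝ → ℝ → Set
x ≤ y = ∀ ε → 0ℚ ℚ.< ε → Eventually λ n → seq x n ℚ.≤ seq y n ℚ.+ ε

_<_ : ℝ → ℝ → Set
x < y = ∃[ ε ] (0ℚ ℚ.< ε × Eventually λ n → seq x n ℚ.+ ε ℚ.≤ seq y n)

-- A sequence whose increments are eventually dominated by a multiple of
-- those of two Cauchy sequences is Cauchy.
dominated : ∀ (x y z : ℕ → ℚ) → Cauchy x → Cauchy y →
  ∀ K .{{_ : ℚ.Positive K}} N →
  (∀ m n → N ℕ.≤ m → N ℕ.≤ n → ℚ.∣ z m ℚ.- z n ∣ ℚ.≤
    K ℚ.* (ℚ.∣ x m ℚ.- x n ∣ ℚ.+ ℚ.∣ y m ℚ.- y n ∣)) →
  Cauchy z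
dominated x y z cx cy K N bound ε ε>0 =
    N ℕ.⊔ (proj₁ X ℕ.⊔ proj₁ Y) , λ m n M≤m M≤n →
      let N≤ = ℕ.m≤m⊔n N (proj₁ X ℕ.⊔ proj₁ Y)
          L≤ = ℕ.m≤n⊔m N (proj₁ X ℕ.⊔ proj₁ Y)
          X≤ = ℕ.≤-trans (ℕ.m≤m⊔n (proj₁ X) (proj₁ Y)) L≤
          Y≤ = ℕ.≤-trans (ℕ.m≤n⊔m (proj₁ X) (proj₁ Y)) L≤
          _⟫_ = λ {a b c} → ℕ.≤-trans {a} {b} {c}
      in begin
        ℚ.∣ z m ℚ.- z n ∣
          ≤⟨ bound m n (N≤ ⟫ M≤m) (N≤ ⟫ M≤n) ⟩
        K ℚ.* (ℚ.∣ x m ℚ.- x n ∣ ℚ.+ ℚ.∣ y m ℚ.- y n ∣)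
          ≤⟨ ℚ.*-monoˡ-≤-nonNeg K (ℚ.+-mono-≤
               (proj₂ X m n (X≤ ⟫ M≤m) (X≤ ⟫ M≤n))
               (proj₂ Y m n (Y≤ ⟫ M≤m) (Y≤ ⟫ M≤n))) ⟩
        K ℚ.* (δ ℚ.+ δ)
          ≡⟨ solve 4 (λ k e i h → k :* (h :* (e :* i) :+ h :* (e :* i))
               := (h :+ h) :* ((k :* i) :* e)) refl K ε 1/K ½ ⟩
        (½ ℚ.+ ½) ℚ.* ((K ℚ.* 1/K) ℚ.* ε)
          ≡⟨ trans (ℚ.*-identityˡ _) (trans
               (cong (ℚ._* ε) (ℚ.*-inverseʳ K {{ℚ.pos⇒nonZero K}}))
               (ℚ.*-identityˡ ε)) ⟩
        ε ∎
  where
  open ℚ.≤-Reasoning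
  open +-*-Solver
  1/K δ : ℚ
  1/K = (ℚ.1/ K) {{ℚ.pos⇒nonZero K}}
  δ = ½ ℚ.* (ε ℚ.* 1/K)
  instance
    K≥0 : ℚ.NonNegative K
    K≥0 = ℚ.pos⇒nonNeg K
  δ>0 : 0ℚ ℚ.< δ
  δ>0 = ℚ.positive⁻¹ δ {{ℚ.pos*pos⇒pos ½ (ε ℚ.* 1/K)
    {{ℚ.pos*pos⇒pos ε {{ℚ.positive ε>0}} 1/K {{ℚ.1/pos⇒pos K}}}}}}
  X = cx δ δ>0
  Y = cy δ δ>0

p≤p+∣q∣ : ∀ p q → p ℚ.≤ p ℚ.+ ℚ.∣ q ∣
p≤p+∣q∣ p q = subst (ℚ._≤ p ℚ.+ ℚ.∣ q ∣) (ℚ.+-identityʳ p)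
  (ℚ.+-monoʳ-≤ p (ℚ.0≤∣p∣ q))

nonexpansive : ∀ (x z : ℕ → ℚ) → Cauchy x →
  (∀ m n → ℚ.∣ z m ℚ.- z n ∣ ℚ.≤ ℚ.∣ x m ℚ.- x n ∣) → Cauchy z
nonexpansive x z cx bound = λ ε ε>0 → proj₁ (cx ε ε>0) , λ m n N≤m N≤n →
  ℚ.≤-trans (bound m n) (proj₂ (cx ε ε>0) m n N≤m N≤n)

bounded : ∀ x → Cauchy x →
  ∃[ B ] (0ℚ ℚ.< B × Eventually λ n → ℚ.∣ x n ∣ ℚ.≤ B)
bounded x cx = B , B>0 , N , λ n N≤n → begin
    ℚ.∣ x n ∣
      ≡⟨ cong ℚ.∣_∣ (solve 2 (λ a b → a := b :+ (a :- b)) refl (x n) (x N)) ⟩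
    ℚ.∣ x N ℚ.+ (x n ℚ.- x N) ∣
      ≤⟨ ℚ.∣p+q∣≤∣p∣+∣q∣ (x N) (x n ℚ.- x N) ⟩
    ℚ.∣ x N ∣ ℚ.+ ℚ.∣ x n ℚ.- x N ∣
      ≤⟨ ℚ.+-monoʳ-≤ ℚ.∣ x N ∣ (proj₂ C n N N≤n ℕ.≤-refl) ⟩
    B ∎
  where
  open ℚ.≤-Reasoning
  open +-*-Solver
  C = cx 1ℚ (ℚ.positive⁻¹ 1ℚ)
  N = proj₁ C
  B = ℚ.∣ x N ∣ ℚ.+ 1ℚ
  B>0 : 0ℚ ℚ.< B
  B>0 = ℚ.+-mono-≤-< (ℚ.0≤∣p∣ (x N)) (ℚ.positive⁻¹ 1ℚ)

fromℚ : ℚ → ℝ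
fromℚ q = mkℝ (λ _ → q) λ ε ε>0 → 0 , λ _ _ _ _ →
  subst (ℚ._≤ ε) (sym (cong ℚ.∣_∣ (ℚ.+-inverseʳ q))) (ℚ.<⇒≤ ε>0)

0ℝ 1ℝ : ℝ
0ℝ = fromℚ 0ℚ
1ℝ = fromℚ 1ℚ

infix  8 -_
infixl 7 _*_
infixl 6 _+_ _-_

_+_ : ℝ → ℝ → ℝ
x + y = mkℝ z
  (dominated (seq x) (seq y) z (isCauchy x) (isCauchy y) 1ℚ 0 λ m n _ _ →
    bound m n)
  where
  open ℚ.≤-Reasoning
  open +-*-Solver
  z : ℕ → ℚ
  z n = seq x n ℚ.+ seq y n
  bound : ∀ m n → _
  bound m n = let a = seq x m; b = seq x n; c = seq y m; d = seq y n in begin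
    ℚ.∣ (a ℚ.+ c) ℚ.- (b ℚ.+ d) ∣
      ≡⟨ cong ℚ.∣_∣ (solve 4 (λ a b c d →
           (a :+ c) :- (b :+ d) := (a :- b) :+ (c :- d)) refl a b c d) ⟩
    ℚ.∣ (a ℚ.- b) ℚ.+ (c ℚ.- d) ∣
      ≤⟨ ℚ.∣p+q∣≤∣p∣+∣q∣ (a ℚ.- b) (c ℚ.- d) ⟩
    ℚ.∣ a ℚ.- b ∣ ℚ.+ ℚ.∣ c ℚ.- d ∣
      ≡⟨ ℚ.*-identityˡ _ ⟨
    1ℚ ℚ.* (ℚ.∣ a ℚ.- b ∣ ℚ.+ ℚ.∣ c ℚ.- d ∣) ∎

-_ : ℝ → ℝ
- x = mkℝ z (nonexpansive (seq x) z (isCauchy x) λ m n → ℚ.≤-reflexive (trans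
    (cong ℚ.∣_∣ (sym (ℚ.neg-distrib-+ (seq x m) (ℚ.- seq x n))))
    (ℚ.∣-p∣≡∣p∣ (seq x m ℚ.- seq x n))))
  where
  z : ℕ → ℚ
  z n = ℚ.- seq x n

_-_ : ℝ → ℝ → ℝ
x - y = x + - y

_*_ : ℝ → ℝ → ℝ
x * y = mkℝ z
  (dominated (seq x) (seq y) z (isCauchy x) (isCauchy y) K {{K-pos}}
    (Nx ℕ.⊔ Ny) bound)
  where
  open ℚ.≤-Reasoning
  open +-*-Solver
  z : ℕ → ℚ
  z n = seq x n ℚ.* seq y n
  Bx = proj₁ (bounded (seq x) (isCauchy x))
  By = proj₁ (bounded (seq y) (isCauchy y))
  Bx>0 = proj₁ (proj₂ (bounded (seq x) (isCauchy x)))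
  By>0 = proj₁ (proj₂ (bounded (seq y) (isCauchy y)))
  Nx = proj₁ (proj₂ (proj₂ (bounded (seq x) (isCauchy x))))
  Ny = proj₁ (proj₂ (proj₂ (bounded (seq y) (isCauchy y))))
  x≤ : ∀ n → Nx ℕ.≤ n → ℚ.∣ seq x n ∣ ℚ.≤ Bx
  x≤ = proj₂ (proj₂ (proj₂ (bounded (seq x) (isCauchy x))))
  y≤ : ∀ n → Ny ℕ.≤ n → ℚ.∣ seq y n ∣ ℚ.≤ By
  y≤ = proj₂ (proj₂ (proj₂ (bounded (seq y) (isCauchy y))))
  K = Bx ℚ.+ By
  K-pos : ℚ.Positive K
  K-pos = ℚ.pos+pos⇒pos Bx {{ℚ.positive Bx>0}} By {{ℚ.positive By>0}}
  Bx≤K : Bx ℚ.≤ K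
  Bx≤K = subst (ℚ._≤ K) (ℚ.+-identityʳ Bx) (ℚ.+-monoʳ-≤ Bx (ℚ.<⇒≤ By>0))
  By≤K : By ℚ.≤ K
  By≤K = subst (ℚ._≤ K) (ℚ.+-identityˡ By) (ℚ.+-monoˡ-≤ By (ℚ.<⇒≤ Bx>0))

  bound : ∀ m n → Nx ℕ.⊔ Ny ℕ.≤ m → Nx ℕ.⊔ Ny ℕ.≤ n → _
  bound m n N≤m N≤n =
    let a = seq x m; b = seq x n; c = seq y m; d = seq y n in begin
    ℚ.∣ a ℚ.* c ℚ.- b ℚ.* d ∣
      ≡⟨ cong ℚ.∣_∣ (solve 4 (λ a b c d →
           a :* c :- b :* d := d :* (a :- b) :+ a :* (c :- d)) refl a b c d) ⟩
    ℚ.∣ d ℚ.* (a ℚ.- b) ℚ.+ a ℚ.* (c ℚ.- d) ∣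
      ≤⟨ ℚ.∣p+q∣≤∣p∣+∣q∣ (d ℚ.* (a ℚ.- b)) (a ℚ.* (c ℚ.- d)) ⟩
    ℚ.∣ d ℚ.* (a ℚ.- b) ∣ ℚ.+ ℚ.∣ a ℚ.* (c ℚ.- d) ∣
      ≡⟨ cong₂ ℚ._+_ (ℚ.∣p*q∣≡∣p∣*∣q∣ d (a ℚ.- b))
           (ℚ.∣p*q∣≡∣p∣*∣q∣ a (c ℚ.- d)) ⟩
    ℚ.∣ d ∣ ℚ.* ℚ.∣ a ℚ.- b ∣ ℚ.+ ℚ.∣ a ∣ ℚ.* ℚ.∣ c ℚ.- d ∣
      ≤⟨ ℚ.+-mono-≤
           (ℚ.*-monoʳ-≤-nonNeg ℚ.∣ a ℚ.- b ∣ {{ℚ.∣-∣-nonNeg (a ℚ.- b)}}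
             (ℚ.≤-trans (y≤ n (ℕ.≤-trans (ℕ.m≤n⊔m Nx Ny) N≤n)) By≤K))
           (ℚ.*-monoʳ-≤-nonNeg ℚ.∣ c ℚ.- d ∣ {{ℚ.∣-∣-nonNeg (c ℚ.- d)}}
             (ℚ.≤-trans (x≤ m (ℕ.≤-trans (ℕ.m≤m⊔n Nx Ny) N≤m)) Bx≤K)) ⟩
    K ℚ.* ℚ.∣ a ℚ.- b ∣ ℚ.+ K ℚ.* ℚ.∣ c ℚ.- d ∣
      ≡⟨ ℚ.*-distribˡ-+ K ℚ.∣ a ℚ.- b ∣ ℚ.∣ c ℚ.- d ∣ ⟨
    K ℚ.* (ℚ.∣ a ℚ.- b ∣ ℚ.+ ℚ.∣ c ℚ.- d ∣) ∎

p-q≤∣∣ : ∀ p q → ℚ.∣ p ∣ ℚ.- ℚ.∣ q ∣ ℚ.≤ ℚ.∣ p ℚ.- q ∣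
p-q≤∣∣ p q = begin
    ℚ.∣ p ∣ ℚ.- ℚ.∣ q ∣
      ≡⟨ cong (λ r → ℚ.∣ r ∣ ℚ.- ℚ.∣ q ∣)
           (solve 2 (λ p q → p := (p :- q) :+ q) refl p q) ⟩
    ℚ.∣ (p ℚ.- q) ℚ.+ q ∣ ℚ.- ℚ.∣ q ∣
      ≤⟨ ℚ.+-monoˡ-≤ (ℚ.- ℚ.∣ q ∣) (ℚ.∣p+q∣≤∣p∣+∣q∣ (p ℚ.- q) q) ⟩
    ℚ.∣ p ℚ.- q ∣ ℚ.+ ℚ.∣ q ∣ ℚ.- ℚ.∣ q ∣
      ≡⟨ solve 2 (λ a b → a :+ b :- b := a) refl ℚ.∣ p ℚ.- q ∣ ℚ.∣ q ∣ ⟩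
    ℚ.∣ p ℚ.- q ∣ ∎
  where
  open ℚ.≤-Reasoning
  open +-*-Solver

∣p-q∣≡∣q-p∣ : ∀ p q → ℚ.∣ p ℚ.- q ∣ ≡ ℚ.∣ q ℚ.- p ∣
∣p-q∣≡∣q-p∣ p q = trans (sym (ℚ.∣-p∣≡∣p∣ (p ℚ.- q)))
  (cong ℚ.∣_∣ (solve 2 (λ p q → :- (p :- q) := q :- p) refl p q))
  where open +-*-Solver

reverse-triangle : ∀ p q → ℚ.∣ ℚ.∣ p ∣ ℚ.- ℚ.∣ q ∣ ∣ ℚ.≤ ℚ.∣ p ℚ.- q ∣
reverse-triangle p q with ℚ.∣p∣≡p∨∣p∣≡-p (ℚ.∣ p ∣ ℚ.- ℚ.∣ q ∣)
... | inj₁ eq = subst (ℚ._≤ ℚ.∣ p ℚ.- q ∣) (sym eq) (p-q≤∣∣ p q)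
... | inj₂ eq = begin
    ℚ.∣ ℚ.∣ p ∣ ℚ.- ℚ.∣ q ∣ ∣   ≡⟨ eq ⟩
    ℚ.- (ℚ.∣ p ∣ ℚ.- ℚ.∣ q ∣)
      ≡⟨ solve 2 (λ p q → :- (p :- q) := q :- p) refl ℚ.∣ p ∣ ℚ.∣ q ∣ ⟩
    ℚ.∣ q ∣ ℚ.- ℚ.∣ p ∣         ≤⟨ p-q≤∣∣ q p ⟩
    ℚ.∣ q ℚ.- p ∣               ≡⟨ ∣p-q∣≡∣q-p∣ q p ⟩
    ℚ.∣ p ℚ.- q ∣               ∎
  where
  open ℚ.≤-Reasoning
  open +-*-Solver

∣_∣ : ℝ → ℝ
∣ x ∣ = mkℝ z (nonexpansive (seq x) z (isCauchy x) λ m n →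
  reverse-triangle (seq x m) (seq x n))
  where
  z : ℕ → ℚ
  z n = ℚ.∣ seq x n ∣

⊔-pos : ∀ q ε → 0ℚ ℚ.< ε → ℚ.Positive (q ℚ.⊔ ε)
⊔-pos q ε ε>0 = ℚ.positive (ℚ.<-≤-trans ε>0 (ℚ.p≤q⊔p q ε))

-- The rational lower bound ε of x carried by the proof of 0ℝ < x keeps the
-- sequence of reciprocals defined on the finitely many terms below ε.
inverse : ∀ x → 0ℝ < x → ℝ
inverse x (ε , ε>0 , N , ε≤x) =
  mkℝ r (dominated (seq x) (seq x) r (isCauchy x) (isCauchy x) K {{K-pos}} N
    bound)
  where
  open ℚ.≤-Reasoning
  open +-*-Solver
  instance
    ε-pos : ℚ.Positive ε
    ε-pos = ℚ.positive ε>0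
    ε≢0 : ℚ.NonZero ε
    ε≢0 = ℚ.pos⇒nonZero ε
    d-pos : ∀ {n} → ℚ.Positive (seq x n ℚ.⊔ ε)
    d-pos {n} = ⊔-pos (seq x n) ε ε>0
    d≢0 : ∀ {n} → ℚ.NonZero (seq x n ℚ.⊔ ε)
    d≢0 {n} = ℚ.pos⇒nonZero (seq x n ℚ.⊔ ε) {{d-pos {n}}}

  d r : ℕ → ℚ
  d n = seq x n ℚ.⊔ ε
  r n = (ℚ.1/ d n) {{d≢0 {n}}}

  e = ℚ.1/ ε
  instance
    e-pos : ℚ.Positive e
    e-pos = ℚ.1/pos⇒pos ε
    e≥0 : ℚ.NonNegative e
    e≥0 = ℚ.pos⇒nonNeg e
  r-pos : ∀ n → ℚ.Positive (r n)
  r-pos n = ℚ.1/pos⇒pos (d n) {{d-pos {n}}}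
  r-nonNeg : ∀ n → ℚ.NonNegative (r n)
  r-nonNeg n = ℚ.pos⇒nonNeg (r n) {{r-pos n}}
  ∣r∣ : ∀ n → ℚ.∣ r n ∣ ≡ r n
  ∣r∣ n = ℚ.0≤p⇒∣p∣≡p (ℚ.nonNegative⁻¹ (r n) {{r-nonNeg n}})

  K = e ℚ.* e
  K-pos : ℚ.Positive K
  K-pos = ℚ.pos*pos⇒pos e e
  instance
    K≥0 : ℚ.NonNegative K
    K≥0 = ℚ.pos⇒nonNeg K {{K-pos}}

  r≤e : ∀ n → r n ℚ.≤ e
  r≤e n = begin
    r n                 ≡⟨ ℚ.*-identityˡ (r n) ⟨
    1ℚ ℚ.* r n          ≡⟨ cong (ℚ._* r n) (ℚ.*-inverseˡ ε) ⟨
    e ℚ.* ε ℚ.* r n     ≤⟨ ℚ.*-monoʳ-≤-nonNeg (r n) {{r-nonNeg n}}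
                             (ℚ.*-monoˡ-≤-nonNeg e (ℚ.p≤q⊔p (seq x n) ε)) ⟩
    e ℚ.* d n ℚ.* r n   ≡⟨ ℚ.*-assoc e (d n) (r n) ⟩
    e ℚ.* (d n ℚ.* r n) ≡⟨ cong (e ℚ.*_) (ℚ.*-inverseʳ (d n) {{d≢0 {n}}}) ⟩
    e ℚ.* 1ℚ            ≡⟨ ℚ.*-identityʳ e ⟩
    e                   ∎

  d≡x : ∀ n → N ℕ.≤ n → d n ≡ seq x n
  d≡x n N≤n = ℚ.p≥q⇒p⊔q≡p
    (subst (ℚ._≤ seq x n) (ℚ.+-identityˡ ε) (ε≤x n N≤n))

  difference : ∀ m n → r m ℚ.- r n ≡ r m ℚ.* r n ℚ.* (d n ℚ.- d m)
  difference m n = begin-equality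
    r m ℚ.- r n
      ≡⟨ cong₂ ℚ._-_ (ℚ.*-identityʳ (r m)) (ℚ.*-identityʳ (r n)) ⟨
    r m ℚ.* 1ℚ ℚ.- r n ℚ.* 1ℚ
      ≡⟨ cong₂ (λ p q → r m ℚ.* p ℚ.- r n ℚ.* q)
           (ℚ.*-inverseˡ (d n) {{d≢0 {n}}}) (ℚ.*-inverseˡ (d m) {{d≢0 {m}}}) ⟨
    r m ℚ.* (r n ℚ.* d n) ℚ.- r n ℚ.* (r m ℚ.* d m)
      ≡⟨ solve 4 (λ a b c d → a :* (b :* d) :- b :* (a :* c)
           := a :* b :* (d :- c)) refl (r m) (r n) (d m) (d n) ⟩
    r m ℚ.* r n ℚ.* (d n ℚ.- d m) ∎

  bound : ∀ m n → N ℕ.≤ m → N ℕ.≤ n → _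
  bound m n N≤m N≤n = let Δ = ℚ.∣ seq x m ℚ.- seq x n ∣ in begin
    ℚ.∣ r m ℚ.- r n ∣
      ≡⟨ cong ℚ.∣_∣ (difference m n) ⟩
    ℚ.∣ r m ℚ.* r n ℚ.* (d n ℚ.- d m) ∣
      ≡⟨ ℚ.∣p*q∣≡∣p∣*∣q∣ (r m ℚ.* r n) (d n ℚ.- d m) ⟩
    ℚ.∣ r m ℚ.* r n ∣ ℚ.* ℚ.∣ d n ℚ.- d m ∣
      ≡⟨ cong₂ ℚ._*_
           (trans (ℚ.∣p*q∣≡∣p∣*∣q∣ (r m) (r n)) (cong₂ ℚ._*_ (∣r∣ m) (∣r∣ n)))
           (trans (cong₂ (λ p q → ℚ.∣ p ℚ.- q ∣) (d≡x n N≤n) (d≡x m N≤m))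
             (∣p-q∣≡∣q-p∣ (seq x n) (seq x m))) ⟩
    r m ℚ.* r n ℚ.* Δ
      ≤⟨ ℚ.*-monoʳ-≤-nonNeg Δ {{ℚ.∣-∣-nonNeg (seq x m ℚ.- seq x n)}} (ℚ.≤-trans
           (ℚ.*-monoʳ-≤-nonNeg (r n) {{r-nonNeg n}} (r≤e m))
           (ℚ.*-monoˡ-≤-nonNeg e (r≤e n))) ⟩
    K ℚ.* Δ
      ≤⟨ ℚ.*-monoˡ-≤-nonNeg K (p≤p+∣q∣ Δ (seq x m ℚ.- seq x n)) ⟩
    K ℚ.* (Δ ℚ.+ Δ) ∎

+-rawMonoid : RawMonoid 0ℓ 0ℓ
+-rawMonoid = record { Carrier = ℝ ; _≈_ = _≈_ ; _∙_ = _+_ ; ε = 0ℝ }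

open RawMonoidDefs +-rawMonoid public using (sum)

record ℂ : Set where
  constructor _+i_
  field
    re im : ℝ

open ℂ public

infix 4 _≈ᶜ_

_≈ᶜ_ : ℂ → ℂ → Set
z ≈ᶜ w = re z ≈ re w × im z ≈ im w

fromℝ : ℝ → ℂ
fromℝ x = x +i 0ℝ

0ᶜ 1ᶜ 𝐢 : ℂ
0ᶜ = fromℝ 0ℝ
1ᶜ = fromℝ 1ℝ
𝐢  = 0ℝ +i 1ℝ

infix  8 -ᶜ_
infixl 7 _*ᶜ_
infixl 6 _+ᶜ_

_+ᶜ_ _*ᶜ_ : ℂ → ℂ → ℂ
z +ᶜ w = (re z + re w) +i (im z + im w)
z *ᶜ w = (re z * re w - im z * im w) +i (re z * im w + im z * re w)

-ᶜ_ conj : ℂ → ℂ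
-ᶜ z   = (- re z) +i (- im z)
conj z = re z +i (- im z)

+ᶜ-rawMonoid : RawMonoid 0ℓ 0ℓ
+ᶜ-rawMonoid = record { Carrier = ℂ ; _≈_ = _≈ᶜ_ ; _∙_ = _+ᶜ_ ; ε = 0ᶜ }

open RawMonoidDefs +ᶜ-rawMonoid public using () renaming (sum to sumᶜ)

Matrix : ℕ → Set
Matrix n = Fin n → Fin n → ℂ

infixr 8 _^ᴹ_
infixl 7 _*ᴹ_ _•_ _⊙_

1ᴹ : ∀ {n} → Matrix n
1ᴹ j k = if does (j Fin.≟ k) then 1ᶜ else 0ᶜ

_*ᴹ_ : ∀ {n} → Matrix n → Matrix n → Matrix n
(X *ᴹ Y) j k = sumᶜ λ l → X j l *ᶜ Y l k

_^ᴹ_ : ∀ {n} → Matrix n → ℕ → Matrix n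
X ^ᴹ zero  = 1ᴹ
X ^ᴹ suc m = X *ᴹ X ^ᴹ m

_•_ : ∀ {n} → ℂ → Matrix n → Matrix n
(c • X) j k = c *ᶜ X j k

_⊙_ : ∀ {n} → Matrix n → Matrix n → Matrix n
(X ⊙ Y) j k = X j k *ᶜ Y j k

conjᴹ : ∀ {n} → Matrix n → Matrix n
conjᴹ X j k = conj (X j k)

-- Limits, the matrix exponential and the integral are given as relations
-- "L is the limit (exponential, integral)", which determine L up to _≈_.

_⟶_ : (ℕ → ℝ) → ℝ → Set
s ⟶ L = ∀ ε → 0ℝ < ε → ∃[ N ] (∀ n → N ℕ.≤ n → ∣ s n - L ∣ ≤ ε)

_⟶ᶜ_ : (ℕ → ℂ) → ℂ → Set
s ⟶ᶜ L = (λ n → re (s n)) ⟶ re L × (λ n → im (s n)) ⟶ im L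

1/_! : ℕ → ℝ
1/ m ! = fromℚ ((ℤ.+ 1 ℚ./ (m !)) {{ m ℕ.!≢0 }})

expPartialSum : ∀ {n} → Matrix n → ℕ → Matrix n
expPartialSum X N j k =
  sumᶜ {N} λ m → (fromℝ (1/ toℕ m !) • X ^ᴹ toℕ m) j k

IsExp : ∀ {n} → Matrix n → Matrix n → Set
IsExp X E = ∀ j k → (λ N → expPartialSum X N j k) ⟶ᶜ E j k

record TaggedPartition (a b : ℝ) : Set where
  field
    size   : ℕ
    point  : Fin (suc size) → ℝ
    tag    : Fin size → ℝ
    first  : point zero ≈ a
    last   : point (fromℕ size) ≈ b
    lower  : ∀ k → point (inject₁ k) ≤ tag k
    upper  : ∀ k → tag k ≤ point (suc k)

  width : Fin size → ℝ
  width k = point (suc k) - point (inject₁ k)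

riemannSum : (ℝ → ℝ) → ∀ {a b} → TaggedPartition a b → ℝ
riemannSum f P = sum λ k → f (tag k) * width k
  where open TaggedPartition P

-- Riemann integral, for a ≤ b.
IsIntegral : (ℝ → ℝ) → ℝ → ℝ → ℝ → Set
IsIntegral f a b I = ∀ ε → 0ℝ < ε → ∃[ δ ] (0ℝ < δ ×
  (∀ (P : TaggedPartition a b) → (∀ k → TaggedPartition.width P k ≤ δ) →
    ∣ riemannSum f P - I ∣ ≤ ε))

-- L = lim_{T→∞} (1/T) ∫₀ᵀ f(t) dt, including that all these integrals exist.
IsTimeAverage : (ℝ → ℝ) → ℝ → Set
IsTimeAverage f L =
  Σ (∀ T → 0ℝ < T → ℝ) λ F →
    (∀ T (T>0 : 0ℝ < T) → IsIntegral f 0ℝ T (F T T>0)) ×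
    (∀ ε → 0ℝ < ε → ∃[ T₀ ] (∀ T (T>0 : 0ℝ < T) → T₀ ≤ T →
      ∣ inverse T T>0 * F T T>0 - L ∣ ≤ ε))

IsTimeAverageᶜ : (ℝ → ℂ) → ℂ → Set
IsTimeAverageᶜ f L =
  IsTimeAverage (λ t → re (f t)) (re L) × IsTimeAverage (λ t → im (f t)) (im L)

-- A graph enters only through its Hermitian adjacency matrix A; U t = e^{-itA}.
IsTransition : ∀ {n} → Matrix n → (ℝ → Matrix n) → Set
IsTransition A U = ∀ t → IsExp ((-ᶜ (𝐢 *ᶜ fromℝ t)) • A) (U t)

mixing : ∀ {n} → (ℝ → Matrix n) → ℝ → Matrix n
mixing U t = U t ⊙ conjᴹ (U t)

IsAverageMixingMatrix : ∀ {n} → Matrix n → Matrix n → Set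
IsAverageMixingMatrix A M̂ = ∃[ U ] (IsTransition A U ×
  (∀ j k → IsTimeAverageᶜ (λ t → mixing U t j k) (M̂ j k)))

J : ∀ {n} → Matrix n
J _ _ = 1ᶜ

1/n•J : ∀ {n} → Matrix n
1/n•J {n} j k = (fromℝ (fromℚ ((ℤ.+ 1 ℚ./ n) {{nonZeroIndex j}})) • J) j k

AverageUniformMixing : ∀ {n} → Matrix n → Set
AverageUniformMixing A = IsAverageMixingMatrix A 1/n•J

-- j ↦ j + 1 on ℤ/nℤ
next : ∀ {n} → Fin n → Fin n
next {n} j = (suc (toℕ j) mod n) {{nonZeroIndex j}}

-- For n ≥ 3 at most one of the two conditions holds.
orientedCycle : ∀ n → Matrix n
orientedCycle n j k =
  if does (k Fin.≟ next j) then -ᶜ 𝐢 else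
  if does (j Fin.≟ next k) then 𝐢 else 0ᶜ

{-# OPTIONS --safe #-}
-- Column k of e^{-itA} is a real flow u with u_j′ = u_{j-1} - u_{j+1} and
-- Σ u_j² = 1.  No eigenvalues are needed: the products satisfy
--   (u_{a+i+1} u_{a-i})′ = c_i + c_{i+1},
--   c_i = u_{a+i} u_{a-i} - u_{a+i+1} u_{a-i+1},
-- and for n = 2h + 1 the last difference c_h is half the derivative of
-- u_{a-h}².  Descending from h to 0, c_0 = u_a² - u_{a+1}² is the derivative of
-- a quadratic form in u, which is bounded.  Summing around the cycle, u_b² - 1/n
-- has a bounded primitive, so its time average vanishes.
module Submission where

open import Defs using (AverageUniformMixing; orientedCycle)
import Defs as R
open R using (ℝ; mkℝ; seq; isCauchy; Eventually; fromℚ; 0ℝ; 1ℝ)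

open import Algebra.Bundles using (CommutativeMonoid; CommutativeRing)
import Algebra.Consequences.Setoid as Consequences
import Algebra.Properties.CommutativeMonoid.Sum as Sum
import Algebra.Properties.Semiring.Sum as SemiringSum
import Algebra.Solver.Ring as RingSolver
open import Algebra.Solver.Ring.AlmostCommutativeRing
  using (fromCommutativeRing; _-Raw-AlmostCommutative⟶_)
open import Algebra.Structures using (IsCommutativeRing)
open import Data.Bool using (true; false; if_then_else_)
open import Data.Fin using (Fin; zero; suc; fromℕ; inject₁; toℕ)
import Data.Fin as Fin
open import Data.Fin.Permutation using (permutation)
import Data.Fin.Properties as Fin
import Data.Integer as ℤ
import Data.Integer.Properties as ℤ
open import Data.Maybe using (Maybe; nothing; just)
open import Data.Nat as ℕ using (ℕ; zero; suc)
open import Data.Nat.Base using (_!)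
open import Data.Nat.DivMod using (_%_; _/_; _mod_; m%n%n≡m%n; [m+n]%n≡m%n;
  m%n<n; m<n⇒m%n≡m; %-distribˡ-+; m≡m%n+[m/n]*n)
open import Data.Nat.Divisibility using (_∣_; divides; ∣⇒≤; m%n≡0⇒n∣m)
open import Data.Nat.GeneralisedArithmetic using (fold; fold-+)
import Data.Nat.Properties as ℕ
open import Data.Product using (∃-syntax; _×_; _,_; proj₁; proj₂)
open import Data.Rational as ℚ using (ℚ; 0ℚ; 1ℚ; ½; mkℚ)
import Data.Rational.Properties as ℚ
open import Data.Rational.Solver using (module +-*-Solver)
import Data.Rational.Unnormalised as ℚᵘ
import Data.Rational.Unnormalised.Properties as ℚᵘ
open import Data.Sum using (inj₁; inj₂)
open import Data.Vec.Functional using (foldr)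
open import Function using (_∘_)
open import Level using (Level; 0ℓ)
open import Relation.Binary.Bundles using (Setoid; Preorder)
open import Relation.Binary.PropositionalEquality
  using (_≡_; refl; sym; trans; cong; cong-app; cong₂; subst; subst₂)
import Relation.Binary.Reasoning.Preorder as PreorderReasoning
open import Relation.Nullary using (¬_; does; yes; no; contradiction)
open import Relation.Nullary.Decidable using (dec-false)

-- The spectral proof rests on the eigenvalues 2 sin(2πr/n), which are pairwise distinct exactly
-- when n is odd. Here oddness acts through the indices: a+i+1 and a-i lie 2i+1 steps apart, so they
-- can meet only on a cycle of odd length, and the chain of differences ends where they meet.
--
-- The obstacle is constructive. Reals are Cauchy sequences, and the exponential, its derivative and
-- the integrals must all be produced by explicit estimates. The flow is therefore built diagonally:
-- the n-th approximation of u_j(t) is the partial sum with n terms at the n-th approximation of t.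
-- Estimates are made for rational polynomials, with constants independent of the number of terms,
-- and pass to the reals at the cost of an ε. One notion of derivative, with a quadratic error,
-- serves both the conservation of Σ u_j² and the integrals: it is stable under products, and
-- derivative 0 in this sense forces constancy by repeated bisection.

module RationalLemmas where
  open import Data.Rational using (_+_; _*_; _-_; -_; ∣_∣; _≤_; _<_)
  open +-*-Solver

  ∣p∣≤q : ∀ {p q} → p ≤ q → - p ≤ q → ∣ p ∣ ≤ q
  ∣p∣≤q {p} {q} p≤q -p≤q with ℚ.∣p∣≡p∨∣p∣≡-p p
  ... | inj₁ eq = subst (_≤ q) (sym eq) p≤q
  ... | inj₂ eq = subst (_≤ q) (sym eq) -p≤q

  p≤∣p∣ : ∀ p → p ≤ ∣ p ∣
  p≤∣p∣ p with ℚ.≤-total 0ℚ p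
  ... | inj₁ 0≤p = ℚ.≤-reflexive (sym (ℚ.0≤p⇒∣p∣≡p 0≤p))
  ... | inj₂ p≤0 = ℚ.≤-trans p≤0 (ℚ.0≤∣p∣ p)

  *-mono-≤ : ∀ {p q r s} → 0ℚ ≤ p → 0ℚ ≤ s → p ≤ q → r ≤ s → p * r ≤ q * s
  *-mono-≤ {p} {q} {r} {s} 0≤p 0≤s p≤q r≤s = ℚ.≤-trans
    (ℚ.*-monoˡ-≤-nonNeg p {{ℚ.nonNegative 0≤p}} r≤s)
    (ℚ.*-monoʳ-≤-nonNeg s {{ℚ.nonNegative 0≤s}} p≤q)

  *-nonNeg : ∀ {p q} → 0ℚ ≤ p → 0ℚ ≤ q → 0ℚ ≤ p * q
  *-nonNeg {p} {q} 0≤p 0≤q = ℚ.nonNegative⁻¹ _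
    {{ℚ.nonNeg*nonNeg⇒nonNeg p {{ℚ.nonNegative 0≤p}} q {{ℚ.nonNegative 0≤q}}}}

  p*p-nonNeg : ∀ p → 0ℚ ≤ p * p
  p*p-nonNeg p with ℚ.≤-total 0ℚ p
  ... | inj₁ h = *-nonNeg {p} {p} h h
  ... | inj₂ h = ℚ.nonNegative⁻¹ (p * p)
    {{ℚ.nonPos*nonPos⇒nonPos p {{ℚ.nonPositive h}} p {{ℚ.nonPositive h}}}}

  0≤1 : 0ℚ ≤ 1ℚ
  0≤1 = ℚ.nonNegative⁻¹ 1ℚ

  ∣p-q∣≤r⇒p≤q+r : ∀ {p q r} → ∣ p - q ∣ ≤ r → p ≤ q + r
  ∣p-q∣≤r⇒p≤q+r {p} {q} {r} h = begin
    p            ≡⟨ solve 2 (λ p q → p := q :+ (p :- q)) refl p q ⟩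
    q + (p - q)  ≤⟨ ℚ.+-monoʳ-≤ q (ℚ.≤-trans (p≤∣p∣ _) h) ⟩
    q + r        ∎
    where open ℚ.≤-Reasoning

  p≤q+r⇒p-q≤r : ∀ {p q r} → p ≤ q + r → p - q ≤ r
  p≤q+r⇒p-q≤r {p} {q} {r} h = begin
    p - q        ≤⟨ ℚ.+-monoˡ-≤ (- q) h ⟩
    q + r - q    ≡⟨ solve 2 (λ q r → q :+ r :- q := r) refl q r ⟩
    r            ∎
    where open ℚ.≤-Reasoning

  ∣p-q∣≡∣-p--q∣ : ∀ p q → ∣ p - q ∣ ≡ ∣ - p - - q ∣
  ∣p-q∣≡∣-p--q∣ p q = trans (R.∣p-q∣≡∣q-p∣ p q)
    (cong ∣_∣ (solve 2 (λ p q → q :- p := :- p :- :- q) refl p q))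

  -- Dividing by `∣ K ∣ + 1` instead of `K` covers zero and negative `K` as well.
  shrink : ∀ K {ε} → 0ℚ < ε → ∃[ δ ] (0ℚ < δ × K * δ ≤ ε)
  shrink K {ε} ε>0 = δ , δ>0 , (begin
    K * δ             ≤⟨ ℚ.*-monoʳ-≤-nonNeg δ {{ℚ.nonNegative (ℚ.<⇒≤ δ>0)}} K≤K′ ⟩
    K′ * δ            ≡⟨ solve 3 (λ k e i → k :* (e :* i) := k :* i :* e) refl K′ ε 1/K′ ⟩
    K′ * 1/K′ * ε     ≡⟨ cong (_* ε) (ℚ.*-inverseʳ K′ {{ℚ.pos⇒nonZero K′}}) ⟩
    1ℚ * ε            ≡⟨ ℚ.*-identityˡ ε ⟩
    ε                 ∎)
    where
    open ℚ.≤-Reasoning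
    K′ = ∣ K ∣ + 1ℚ
    instance
      K′-pos : ℚ.Positive K′
      K′-pos = ℚ.nonNeg+pos⇒pos ∣ K ∣ {{ℚ.∣-∣-nonNeg K}} 1ℚ
    1/K′ = (ℚ.1/ K′) {{ℚ.pos⇒nonZero K′}}
    δ = ε * 1/K′
    δ>0 : 0ℚ < δ
    δ>0 = ℚ.positive⁻¹ δ {{ℚ.pos*pos⇒pos ε {{ℚ.positive ε>0}} 1/K′ {{ℚ.1/pos⇒pos K′}}}}
    K≤K′ : K ≤ K′
    K≤K′ = ℚ.≤-trans (p≤∣p∣ K) (subst (_≤ K′) (ℚ.+-identityʳ ∣ K ∣) (ℚ.+-monoʳ-≤ ∣ K ∣ 0≤1))

  halve : ∀ {ε} → 0ℚ < ε → ∃[ δ ] (0ℚ < δ × δ + δ ≤ ε)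
  halve {ε} ε>0 = let δ , δ>0 , h = shrink (1ℚ + 1ℚ) ε>0 in
    δ , δ>0 , subst (_≤ ε) (solve 1 (λ d → (con 1ℚ :+ con 1ℚ) :* d := d :+ d) refl δ) h

open RationalLemmas

-- Naturals among the rationals, the Archimedean property, powers of ½

module NaturalRationals where
  open import Data.Rational using (_+_; _*_; _≤_; _<_)
  open +-*-Solver

  ι : ℕ → ℚ
  ι n = ℤ.+ n ℚ./ 1

  toℚᵘ-/ : ∀ n d .{{_ : ℕ.NonZero d}} → ℚ.toℚᵘ (ℤ.+ n ℚ./ d) ℚᵘ.≃ ℤ.+ n ℚᵘ./ d
  toℚᵘ-/ n (suc d) = ℚ.toℚᵘ-fromℚᵘ (ℚᵘ.mkℚᵘ (ℤ.+ n) d)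

  ι-suc : ∀ n → ι (suc n) ≡ 1ℚ + ι n
  ι-suc n = ℚ.toℚᵘ-injective (begin
    ℚ.toℚᵘ (ι (suc n))           ≈⟨ toℚᵘ-/ (suc n) 1 ⟩
    ℤ.+ suc n ℚᵘ./ 1             ≈⟨ ℚᵘ.*≡*
      (cong (ℤ._* ℤ.+ 1) (cong (λ i → ℤ.+ 1 ℤ.+ i) (sym (ℤ.*-identityʳ (ℤ.+ n))))) ⟩
    ℚᵘ.1ℚᵘ ℚᵘ.+ (ℤ.+ n ℚᵘ./ 1)   ≈⟨ ℚᵘ.+-congʳ ℚᵘ.1ℚᵘ (toℚᵘ-/ n 1) ⟨
    ℚᵘ.1ℚᵘ ℚᵘ.+ ℚ.toℚᵘ (ι n)     ≈⟨ ℚ.toℚᵘ-homo-+ 1ℚ (ι n) ⟨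
    ℚ.toℚᵘ (1ℚ + ι n)            ∎)
    where open ℚᵘ.≃-Reasoning

  -- With `suc m` and `m !` this is the cancellation (m+1)/(m+1)! = 1/m! behind `e-suc`.
  ι-*-/ : ∀ m n .{{_ : ℕ.NonZero n}} .{{_ : ℕ.NonZero (m ℕ.* n)}} →
    ι m * (ℤ.+ 1 ℚ./ (m ℕ.* n)) ≡ ℤ.+ 1 ℚ./ n
  ι-*-/ m@(suc _) n@(suc _) = ℚ.toℚᵘ-injective (begin
    ℚ.toℚᵘ (ι m * (ℤ.+ 1 ℚ./ (m ℕ.* n)))            ≈⟨ ℚ.toℚᵘ-homo-* (ι m) (ℤ.+ 1 ℚ./ (m ℕ.* n)) ⟩
    ℚ.toℚᵘ (ι m) ℚᵘ.* ℚ.toℚᵘ (ℤ.+ 1 ℚ./ (m ℕ.* n))  ≈⟨ ℚᵘ.*-cong (toℚᵘ-/ m 1) (toℚᵘ-/ 1 (m ℕ.* n))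
      ⟩
    (ℤ.+ m ℚᵘ./ 1) ℚᵘ.* (ℤ.+ 1 ℚᵘ./ (m ℕ.* n))      ≈⟨ ℚᵘ.*≡* (cong ℤ.+_ (nat m n)) ⟩
    ℤ.+ 1 ℚᵘ./ n                                    ≈⟨ toℚᵘ-/ 1 n ⟨
    ℚ.toℚᵘ (ℤ.+ 1 ℚ./ n)                            ∎)
    where
    open ℚᵘ.≃-Reasoning
    nat : ∀ m n → m ℕ.* 1 ℕ.* n ≡ 1 ℕ.* (1 ℕ.* (m ℕ.* n))
    nat m n = trans (cong (ℕ._* n) (ℕ.*-identityʳ m))
      (sym (trans (ℕ.*-identityˡ _) (ℕ.*-identityˡ _)))

  1/-*-ι : ∀ n .{{_ : ℕ.NonZero n}} → (ℤ.+ 1 ℚ./ n) * ι n ≡ 1ℚ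
  1/-*-ι n@(suc _) = trans (ℚ.*-comm (ℤ.+ 1 ℚ./ n) (ι n)) (trans (cong (ι n *_)
    (ℚ./-cong {ℤ.+ 1} {n} {ℤ.+ 1} {n ℕ.* 1} refl (sym (ℕ.*-identityʳ n)))) (ι-*-/ n 1))

  ι-nonNeg : ∀ n → 0ℚ ≤ ι n
  ι-nonNeg zero    = ℚ.≤-refl
  ι-nonNeg (suc n) = subst (0ℚ ≤_) (sym (ι-suc n))
    (ℚ.nonNegative⁻¹ _ {{ℚ.nonNeg+nonNeg⇒nonNeg 1ℚ (ι n) {{ℚ.nonNegative (ι-nonNeg n)}}}})

  ι-step : ∀ n → ι n ≤ ι (suc n)
  ι-step n = subst (ι n ≤_) (sym (ι-suc n))
    (subst (_≤ 1ℚ + ι n) (ℚ.+-identityˡ (ι n)) (ℚ.+-monoˡ-≤ (ι n) 0≤1))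

  ι-mono : ∀ {m n} → m ℕ.≤ n → ι m ≤ ι n
  ι-mono {m} {n} m≤n with ℕ.≤⇒≤′ m≤n
  ... | h = go h
    where
    go : ∀ {n} → m ℕ.≤′ n → ι m ≤ ι n
    go ℕ.≤′-refl       = ℚ.≤-refl
    go (ℕ.≤′-step {n} h) = ℚ.≤-trans (go h) (ι-step n)

  ι-suc-pos : ∀ n → 0ℚ < ι (suc n)
  ι-suc-pos n = subst (0ℚ <_) (sym (ι-suc n))
    (ℚ.<-≤-trans (ℚ.positive⁻¹ 1ℚ) (subst (_≤ 1ℚ + ι n) (ℚ.+-identityʳ 1ℚ)
      (ℚ.+-monoʳ-≤ 1ℚ (ι-nonNeg n))))

  -- The absolute value of the numerator is a bound, the denominator being at least 1.
  above : ∀ q → ∃[ N ] (q ≤ ι N)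
  above q@(mkℚ i d c) = ℤ.∣ i ∣ , ℚ.toℚᵘ-cancel-≤ (ℚᵘ.≤-respʳ-≃ (ℚᵘ.≃-sym (toℚᵘ-/ ℤ.∣ i ∣ 1))
    (ℚᵘ.*≤* (ℤ.≤-trans (ℤ.≤-reflexive (ℤ.*-identityʳ i))
      (ℤ.≤-trans (i≤∣i∣ i) (ℤ.≤-trans (ℤ.+≤+ (ℕ.m≤m*n ℤ.∣ i ∣ (suc d)))
        (ℤ.≤-reflexive (ℤ.pos-* ℤ.∣ i ∣ (suc d))))))))
    where
    i≤∣i∣ : ∀ i → i ℤ.≤ ℤ.+ ℤ.∣ i ∣
    i≤∣i∣ (ℤ.+ n)      = ℤ.≤-refl
    i≤∣i∣ (ℤ.-[1+ n ]) = ℤ.-≤+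

  archimedean : ∀ C {ε} → 0ℚ < ε → ∃[ N ] (C ≤ ι N * ε)
  archimedean C {ε} ε>0 = let N , h = above (C * 1/ε) in N , (begin
    C               ≡⟨ ℚ.*-identityʳ C ⟨
    C * 1ℚ          ≡⟨ cong (C *_) (ℚ.*-inverseˡ ε {{ℚ.pos⇒nonZero ε}}) ⟨
    C * (1/ε * ε)   ≡⟨ ℚ.*-assoc C 1/ε ε ⟨
    C * 1/ε * ε     ≤⟨ ℚ.*-monoʳ-≤-nonNeg ε {{ℚ.pos⇒nonNeg ε}} h ⟩
    ι N * ε         ∎)
    where
    open ℚ.≤-Reasoning
    instance
      ε-pos : ℚ.Positive ε
      ε-pos = ℚ.positive ε>0
    1/ε = (ℚ.1/ ε) {{ℚ.pos⇒nonZero ε}}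

  infixr 8 _^_
  _^_ : ℚ → ℕ → ℚ
  q ^ zero  = 1ℚ
  q ^ suc n = q * q ^ n

  ^-nonNeg : ∀ {q} n → 0ℚ ≤ q → 0ℚ ≤ q ^ n
  ^-nonNeg zero    _ = 0≤1
  ^-nonNeg (suc n) h = *-nonNeg h (^-nonNeg n h)

  -- The two bounds are carried together because (n+1)/2^(n+1) is half of 1/2^n + n/2^n.
  ι*½^≤1 : ∀ n → ι n * ½ ^ n ≤ 1ℚ × ½ ^ n ≤ 1ℚ
  ι*½^≤1 zero    = ℚ.≤-trans (ℚ.≤-reflexive (ℚ.*-identityʳ 0ℚ)) 0≤1 , ℚ.≤-refl
  ι*½^≤1 (suc n) = let h , k = ι*½^≤1 n in (begin
    ι (suc n) * (½ * ½ ^ n)           ≡⟨ cong (_* (½ * ½ ^ n)) (ι-suc n) ⟩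
    (1ℚ + ι n) * (½ * ½ ^ n)          ≡⟨ solve 3
        (λ i h p → (con 1ℚ :+ i) :* (h :* p) := h :* (p :+ i :* p)) refl (ι n) ½ (½ ^ n) ⟩
    ½ * (½ ^ n + ι n * ½ ^ n)         ≤⟨ ℚ.*-monoˡ-≤-nonNeg ½ (ℚ.+-mono-≤ k h) ⟩
    ½ * (1ℚ + 1ℚ)                     ≡⟨⟩
    1ℚ                                ∎) , (begin
    ½ * ½ ^ n                         ≤⟨ ℚ.*-monoˡ-≤-nonNeg ½ k ⟩
    ½ * 1ℚ                            ≤⟨ ℚ.<⇒≤ (ℚ.*<* (ℤ.+<+ ℕ.≤-refl)) ⟩
    1ℚ                                ∎)
    where open ℚ.≤-Reasoning

  -- The Archimedean property gives C ≤ nε, and n/2^n ≤ 1 absorbs the factor n.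
  geometric-small : ∀ {C ε} → 0ℚ < ε → ∃[ n ] (½ ^ n * C ≤ ε)
  geometric-small {C} {ε} ε>0 = let n , h = archimedean C ε>0 in n , (begin
    ½ ^ n * C             ≤⟨ ℚ.*-monoˡ-≤-nonNeg (½ ^ n)
      {{ℚ.nonNegative (^-nonNeg n (ℚ.nonNegative⁻¹ ½))}} h ⟩
    ½ ^ n * (ι n * ε)     ≡⟨ solve 3 (λ p i e → p :* (i :* e) := (i :* p) :* e) refl (½ ^ n) (ι n)
        ε ⟩
    (ι n * ½ ^ n) * ε     ≤⟨ ℚ.*-monoʳ-≤-nonNeg ε {{ℚ.nonNegative (ℚ.<⇒≤ ε>0)}} (proj₁ (ι*½^≤1 n))
      ⟩
    1ℚ * ε                ≡⟨ ℚ.*-identityˡ ε ⟩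
    ε                     ∎)
    where open ℚ.≤-Reasoning

open NaturalRationals

-- The exponential series over the rationals: tails and Taylor remainders

module ExponentialSeries where
  open import Data.Rational using (_+_; _*_; _-_; -_; ∣_∣; _≤_; _<_)
  open +-*-Solver using (solve; _:+_; _:*_; _:-_; :-_; _:=_; con)
  open ℚ.≤-Reasoning

  ∣p+q∣≤ : ∀ {p q a b} → ∣ p ∣ ≤ a → ∣ q ∣ ≤ b → ∣ p + q ∣ ≤ a + b
  ∣p+q∣≤ {p} {q} {a} {b} h k = ℚ.≤-trans (ℚ.∣p+q∣≤∣p∣+∣q∣ p q) (ℚ.+-mono-≤ h k)

  ∣p*q∣≤ : ∀ {p q a b} → ∣ p ∣ ≤ a → ∣ q ∣ ≤ b → ∣ p * q ∣ ≤ a * b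
  ∣p*q∣≤ {p} {q} {a} {b} h k = subst (_≤ a * b) (sym (ℚ.∣p*q∣≡∣p∣*∣q∣ p q))
    (*-mono-≤ (ℚ.0≤∣p∣ p) (ℚ.≤-trans (ℚ.0≤∣p∣ q) k) h k)

  ∣p-q∣≤ : ∀ {p q a b} → ∣ p ∣ ≤ a → ∣ q ∣ ≤ b → ∣ p - q ∣ ≤ a + b
  ∣p-q∣≤ {p} {q} {a} {b} h k = ℚ.≤-trans (ℚ.∣p-q∣≤∣p∣+∣q∣ p q) (ℚ.+-mono-≤ h k)

  p≤q+p : ∀ {p q} → 0ℚ ≤ q → p ≤ q + p
  p≤q+p {p} {q} h = subst (_≤ q + p) (ℚ.+-identityˡ p) (ℚ.+-monoˡ-≤ p h)

  p≤p+q : ∀ {p q} → 0ℚ ≤ q → p ≤ p + q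
  p≤p+q {p} {q} h = subst (_≤ p + q) (ℚ.+-identityʳ p) (ℚ.+-monoʳ-≤ p h)

  ∣^∣≤ : ∀ {q b} m → ∣ q ∣ ≤ b → ∣ q ^ m ∣ ≤ b ^ m
  ∣^∣≤ zero    h = ℚ.≤-refl
  ∣^∣≤ {q} {b} (suc m) h = ∣p*q∣≤ {q} {q ^ m} {b} {b ^ m} h (∣^∣≤ m h)

  ^-distrib-* : ∀ p q m → (p * q) ^ m ≡ p ^ m * q ^ m
  ^-distrib-* p q zero    = refl
  ^-distrib-* p q (suc m) = trans (cong (p * q *_) (^-distrib-* p q m))
    (solve 4 (λ p q a b → p :* q :* (a :* b) := p :* a :* (q :* b)) refl p q (p ^ m) (q ^ m))

  1/_! : ℕ → ℚ
  1/ m ! = (ℤ.+ 1 ℚ./ (m !)) {{m ℕ.!≢0}}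

  1/!-nonNeg : ∀ m → 0ℚ ≤ 1/ m !
  1/!-nonNeg m = ℚ.nonNegative⁻¹ (1/ m !) {{ℚ.normalize-nonNeg 1 (m !) {{m ℕ.!≢0}}}}

  opaque
    -- Opaque, so that the fraction 1/m! stays folded; the estimates argue from the recursion
    -- `e-suc`.
    e : ℕ → ℚ → ℚ
    e m q = 1/ m ! * q ^ m

    e-def : ∀ m q → e m q ≡ 1/ m ! * q ^ m
    e-def m q = refl

    e-zero : ∀ q → e 0 q ≡ 1ℚ
    e-zero q = refl

    e-suc : ∀ m q → ι (suc m) * e (suc m) q ≡ q * e m q
    e-suc m q = begin-equality
      ι (suc m) * (1/ suc m ! * (q * q ^ m))
        ≡⟨ ℚ.*-assoc (ι (suc m)) (1/ suc m !) (q * q ^ m) ⟨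
      ι (suc m) * 1/ suc m ! * (q * q ^ m)
        ≡⟨ cong (_* (q * q ^ m)) (ι-*-/ (suc m) (m !) {{m ℕ.!≢0}} {{suc m ℕ.!≢0}}) ⟩
      1/ m ! * (q * q ^ m)
        ≡⟨ solve 3 (λ f q p → f :* (q :* p) := q :* (f :* p)) refl (1/ m !) q (q ^ m) ⟩
      q * (1/ m ! * q ^ m) ∎

    e-nonNeg : ∀ m {q} → 0ℚ ≤ q → 0ℚ ≤ e m q
    e-nonNeg m {q} h = *-nonNeg {1/ m !} {q ^ m} (1/!-nonNeg m) (^-nonNeg m h)

    ∣e∣≤ : ∀ m {q b} → ∣ q ∣ ≤ b → ∣ e m q ∣ ≤ e m b
    ∣e∣≤ m {q} {b} h = ∣p*q∣≤ {1/ m !} {q ^ m} {1/ m !} {b ^ m}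
      (ℚ.≤-reflexive (ℚ.0≤p⇒∣p∣≡p (1/!-nonNeg m))) (∣^∣≤ m h)

    e-scale : ∀ c m q → c ^ m * e m q ≡ e m (c * q)
    e-scale c m q = trans
      (solve 3 (λ a f b → a :* (f :* b) := f :* (a :* b)) refl (c ^ m) (1/ m !) (q ^ m))
      (cong (1/ m ! *_) (sym (^-distrib-* c q m)))

  S : ℚ → ℕ → ℚ
  S c zero    = 0ℚ
  S c (suc N) = S c N + e N c

  module Bounds (c : ℚ) (0≤c : 0ℚ ≤ c) where

    0≤e : ∀ m → 0ℚ ≤ e m c
    0≤e m = e-nonNeg m 0≤c

    S-mono : ∀ k N → S c N ≤ S c (k ℕ.+ N)
    S-mono zero    N = ℚ.≤-refl
    S-mono (suc k) N = ℚ.≤-trans (S-mono k N) (p≤p+q {S c (k ℕ.+ N)} (0≤e (k ℕ.+ N)))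

    -- From this index on, the ratio c/(m+1) of consecutive terms is at most ½.
    N₀ : ℕ
    N₀ = proj₁ (above (c + c))

    e-halves : ∀ m → N₀ ℕ.≤ m → e (suc m) c + e (suc m) c ≤ e m c
    e-halves m N₀≤m = ℚ.*-cancelˡ-≤-pos (ι (suc m)) {{ℚ.positive (ι-suc-pos m)}} (begin
      ι (suc m) * (e (suc m) c + e (suc m) c)
        ≡⟨ ℚ.*-distribˡ-+ (ι (suc m)) (e (suc m) c) (e (suc m) c) ⟩
      ι (suc m) * e (suc m) c + ι (suc m) * e (suc m) c
        ≡⟨ cong₂ _+_ (e-suc m c) (e-suc m c) ⟩
      c * e m c + c * e m c
        ≡⟨ ℚ.*-distribʳ-+ (e m c) c c ⟨
      (c + c) * e m c
        ≤⟨ ℚ.*-monoʳ-≤-nonNeg (e m c) {{ℚ.nonNegative (0≤e m)}}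
             (ℚ.≤-trans (proj₂ (above (c + c))) (ι-mono (ℕ.m≤n⇒m≤1+n N₀≤m))) ⟩
      ι (suc m) * e m c ∎)

    -- The terms eventually halve, so S N + 2 e N decreases and bounds the tail.
    majorant : ℕ → ℚ
    majorant N = S c N + (e N c + e N c)

    majorant-antitone : ∀ k m → N₀ ℕ.≤ m → majorant (k ℕ.+ m) ≤ majorant m
    majorant-antitone zero    m N₀≤m = ℚ.≤-refl
    majorant-antitone (suc k) m N₀≤m = ℚ.≤-trans (begin
      S c n + e n c + (e (suc n) c + e (suc n) c)
        ≤⟨ ℚ.+-monoʳ-≤ (S c n + e n c) (e-halves n (ℕ.≤-trans N₀≤m (ℕ.m≤n+m m k))) ⟩
      S c n + e n c + e n c
        ≡⟨ ℚ.+-assoc (S c n) (e n c) (e n c) ⟩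
      S c n + (e n c + e n c) ∎) (majorant-antitone k m N₀≤m)
      where n = k ℕ.+ m

    S≤majorant : ∀ N → S c N ≤ majorant N
    S≤majorant N = p≤p+q {S c N} (ℚ.≤-trans (0≤e N) (p≤p+q (0≤e N)))

    M : ℚ
    M = majorant N₀

    S≤M : ∀ N → S c N ≤ M
    -- Enlarging `N` to `N ℕ.+ N₀` first covers the indices below `N₀`, where `majorant` is not
    -- known to decrease.
    S≤M N = ℚ.≤-trans (subst (λ k → S c N ≤ S c k) (ℕ.+-comm N₀ N) (S-mono N₀ N))
      (ℚ.≤-trans (S≤majorant (N ℕ.+ N₀)) (majorant-antitone N N₀ ℕ.≤-refl))

    0≤M : 0ℚ ≤ M
    0≤M = S≤M 0

    e≤M : ∀ m → e m c ≤ M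
    e≤M m = ℚ.≤-trans (p≤q+p {e m c} {S c m}
        (subst (λ k → 0ℚ ≤ S c k) (ℕ.+-identityʳ m) (S-mono m 0))) (S≤M (suc m))

    -- One step of the recursion gains the factor c/(m+1) over the uniform bound `M`.
    e-small : ∀ {ε} → 0ℚ < ε → ∃[ N ] (∀ m → N ℕ.≤ m → e m c ≤ ε)
    e-small {ε} ε>0 = suc N , small
      where
      N = proj₁ (archimedean (c * M) ε>0)
      small : ∀ m → suc N ℕ.≤ m → e m c ≤ ε
      small (suc m) (ℕ.s≤s N≤m) = ℚ.*-cancelˡ-≤-pos (ι (suc m)) {{ℚ.positive (ι-suc-pos m)}}
          (begin
        ι (suc m) * e (suc m) c   ≡⟨ e-suc m c ⟩
        c * e m c                 ≤⟨ ℚ.*-monoˡ-≤-nonNeg c {{ℚ.nonNegative 0≤c}} (e≤M m) ⟩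
        c * M                     ≤⟨ proj₂ (archimedean (c * M) ε>0) ⟩
        ι N * ε                   ≤⟨ ℚ.*-monoʳ-≤-nonNeg ε {{ℚ.nonNegative (ℚ.<⇒≤ ε>0)}}
          (ι-mono (ℕ.m≤n⇒m≤1+n N≤m)) ⟩
        ι (suc m) * ε             ∎)

    S-tail : ∀ {ε} → 0ℚ < ε → ∃[ N ] (∀ k m → N ℕ.≤ m → S c (k ℕ.+ m) - S c m ≤ ε)
    S-tail {ε} ε>0 = N₀ ℕ.⊔ N , λ k m h → p≤q+r⇒p-q≤r {S c (k ℕ.+ m)} (begin
      S c (k ℕ.+ m)             ≤⟨ S≤majorant (k ℕ.+ m) ⟩
      majorant (k ℕ.+ m)        ≤⟨ majorant-antitone k m (ℕ.≤-trans (ℕ.m≤m⊔n N₀ N) h) ⟩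
      S c m + (e m c + e m c)   ≤⟨ ℚ.+-monoʳ-≤ (S c m) (ℚ.+-mono-≤ (small m h) (small m h)) ⟩
      S c m + (δ + δ)           ≤⟨ ℚ.+-monoʳ-≤ (S c m) δ+δ≤ε ⟩
      S c m + ε                 ∎)
      where
      δ = proj₁ (halve ε>0)
      δ+δ≤ε = proj₂ (proj₂ (halve ε>0))
      N = proj₁ (e-small (proj₁ (proj₂ (halve ε>0))))
      small : ∀ m → N₀ ℕ.⊔ N ℕ.≤ m → e m c ≤ δ
      small m h = proj₂ (e-small (proj₁ (proj₂ (halve ε>0)))) m (ℕ.≤-trans (ℕ.m≤n⊔m N₀ N) h)

  -- The derivative of `e m`, hence the second derivative of `e (suc m)`, which is what a
  -- first-order remainder is measured by.
  ẽ : ℕ → ℚ → ℚ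
  ẽ zero    q = 0ℚ
  ẽ (suc m) q = e m q

  *-ẽ : ∀ m q → q * ẽ m q ≡ ι m * e m q
  *-ẽ zero    q = trans (ℚ.*-zeroʳ q) (sym (ℚ.*-zeroˡ (e 0 q)))
  *-ẽ (suc m) q = sym (e-suc m q)

  -- As `e m` is the derivative of `e (suc m)`, this is the error at `q` of the tangent at `r`.
  remainder : ℕ → ℚ → ℚ → ℚ
  remainder m q r = e (suc m) q - e (suc m) r - (q - r) * e m r

  remainder-zero : ∀ q r → remainder 0 q r ≡ 0ℚ
  remainder-zero q r = trans
    (cong₂ (λ a b → a - b - (q - r) * e 0 r) (e-one q) (e-one r))
    (trans (cong (λ a → q - r - (q - r) * a) (e-zero r))
      (solve 2 (λ q r → q :- r :- (q :- r) :* con 1ℚ := con 0ℚ) refl q r))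
    where
    e-one : ∀ q → e 1 q ≡ q
    e-one q = trans (sym (ℚ.*-identityˡ (e 1 q))) (trans (e-suc 0 q)
      (trans (cong (q *_) (e-zero q)) (ℚ.*-identityʳ q)))

  -- The factor m+2 clears the factorials through `e-suc`; `ι-e` splits the tangent term (m+2)
  -- e_{m+1}(r) as e_{m+1}(r) + r e_m(r).
  remainder-suc : ∀ m q r → ι (suc (suc m)) * remainder (suc m) q r ≡
    q * remainder m q r + (q - r) * (q - r) * e m r
  remainder-suc m q r = begin-equality
    ι (suc (suc m)) * (e (suc (suc m)) q - e (suc (suc m)) r - (q - r) * e (suc m) r)
      ≡⟨ solve 5 (λ i a b d c → i :* (a :- b :- d :* c) := i :* a :- i :* b :- d :* (i :* c)) refl
           (ι (suc (suc m))) (e (suc (suc m)) q) (e (suc (suc m)) r) (q - r) (e (suc m) r) ⟩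
    ι (suc (suc m)) * e (suc (suc m)) q - ι (suc (suc m)) * e (suc (suc m)) r - (q - r) *
      (ι (suc (suc m)) * e (suc m) r)
      ≡⟨ cong₂ (λ a b → a - b - (q - r) * (ι (suc (suc m)) * e (suc m) r)) (e-suc (suc m) q)
        (e-suc (suc m) r) ⟩
    q * e (suc m) q - r * e (suc m) r - (q - r) * (ι (suc (suc m)) * e (suc m) r)
      ≡⟨ cong (λ a → q * e (suc m) q - r * e (suc m) r - (q - r) * a) ι-e ⟩
    q * e (suc m) q - r * e (suc m) r - (q - r) * (e (suc m) r + r * e m r)
      ≡⟨ solve 5 (λ q r a b c → q :* a :- r :* b :- (q :- r) :* (b :+ r :* c)
           := q :* (a :- b :- (q :- r) :* c) :+ (q :- r) :* (q :- r) :* c) refl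
           q r (e (suc m) q) (e (suc m) r) (e m r) ⟩
    q * (e (suc m) q - e (suc m) r - (q - r) * e m r) + (q - r) * (q - r) * e m r ∎
    where
    ι-e : ι (suc (suc m)) * e (suc m) r ≡ e (suc m) r + r * e m r
    ι-e = trans (cong (_* e (suc m) r) (ι-suc (suc m)))
      (trans (ℚ.*-distribʳ-+ (e (suc m) r) 1ℚ (ι (suc m)))
        (cong₂ _+_ (ℚ.*-identityˡ (e (suc m) r)) (e-suc m r)))

  -- In the induction `remainder-suc` leaves (m+1) (q-r)² e_m(b) on the right against the factor m+2
  -- on the left, so the bound reproduces itself with constant 1.
  ∣remainder∣≤ : ∀ m {q r b} → 0ℚ ≤ b → ∣ q ∣ ≤ b → ∣ r ∣ ≤ b →
    ∣ remainder m q r ∣ ≤ (q - r) * (q - r) * ẽ m b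
  ∣remainder∣≤ zero {q} {r} _ _ _ = ℚ.≤-reflexive (trans (cong ∣_∣ (remainder-zero q r))
    (sym (ℚ.*-zeroʳ ((q - r) * (q - r)))))
  ∣remainder∣≤ (suc m) {q} {r} {b} 0≤b hq hr =
    ℚ.*-cancelˡ-≤-pos (ι (suc (suc m))) {{ℚ.positive (ι-suc-pos (suc m))}} (begin
      ι (suc (suc m)) * ∣ remainder (suc m) q r ∣
        ≡⟨ cong (_* ∣ remainder (suc m) q r ∣) (ℚ.0≤p⇒∣p∣≡p (ι-nonNeg (suc (suc m)))) ⟨
      ∣ ι (suc (suc m)) ∣ * ∣ remainder (suc m) q r ∣
        ≡⟨ ℚ.∣p*q∣≡∣p∣*∣q∣ (ι (suc (suc m))) (remainder (suc m) q r) ⟨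
      ∣ ι (suc (suc m)) * remainder (suc m) q r ∣
        ≡⟨ cong ∣_∣ (remainder-suc m q r) ⟩
      ∣ q * remainder m q r + d² * e m r ∣
        ≤⟨ ∣p+q∣≤ {q * remainder m q r} {d² * e m r}
             (∣p*q∣≤ {q} {remainder m q r} hq (∣remainder∣≤ m 0≤b hq hr))
             (∣p*q∣≤ {d²} {e m r} (ℚ.≤-reflexive (ℚ.0≤p⇒∣p∣≡p 0≤d²)) (∣e∣≤ m hr)) ⟩
      b * (d² * ẽ m b) + d² * e m b
        ≡⟨ solve 4 (λ b d t u → b :* (d :* t) :+ d :* u := d :* (b :* t :+ u)) refl b d² (ẽ m b)
            (e m b) ⟩
      d² * (b * ẽ m b + e m b)
        ≡⟨ cong (λ a → d² * (a + e m b)) (*-ẽ m b) ⟩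
      d² * (ι m * e m b + e m b)
        ≡⟨ solve 3 (λ d i u → d :* (i :* u :+ u) := (con 1ℚ :+ i) :* (d :* u)) refl d² (ι m)
            (e m b) ⟩
      (1ℚ + ι m) * (d² * e m b)
        ≡⟨ cong (_* (d² * e m b)) (ι-suc m) ⟨
      ι (suc m) * (d² * e m b)
        ≤⟨ ℚ.*-monoʳ-≤-nonNeg (d² * e m b) {{ℚ.nonNegative (*-nonNeg {d²} 0≤d² (e-nonNeg m 0≤b))}}
             (ι-step (suc m)) ⟩
      ι (suc (suc m)) * (d² * e m b) ∎)
    where
    d² = (q - r) * (q - r)
    0≤d² = p*p-nonNeg (q - r)

  S̃ : ℚ → ℕ → ℚ
  S̃ c zero    = 0ℚ
  S̃ c (suc N) = S̃ c N + ẽ N c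

  S̃-suc : ∀ c N → S̃ c (suc N) ≡ S c N
  S̃-suc c zero    = refl
  S̃-suc c (suc N) = cong (_+ e N c) (S̃-suc c N)

  2ℚ 4ℚ : ℚ
  2ℚ = 1ℚ + 1ℚ
  4ℚ = 2ℚ * 2ℚ

  0≤2 : 0ℚ ≤ 2ℚ
  0≤2 = ℚ.nonNegative⁻¹ 2ℚ

  0≤4 : 0ℚ ≤ 4ℚ
  0≤4 = ℚ.nonNegative⁻¹ 4ℚ

  -- Lets the bound 2^(m+1) on the coefficients be absorbed by moving from `b` to `2ℚ * b`. Two
  -- factors 2 are left over because `ẽ m` has degree m-1.
  2^*ẽ : ∀ m b → 2ℚ ^ suc m * ẽ m b ≡ 4ℚ * ẽ m (2ℚ * b)
  2^*ẽ zero b    = trans (ℚ.*-zeroʳ (2ℚ ^ 1)) (sym (ℚ.*-zeroʳ 4ℚ))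
  2^*ẽ (suc m) b = trans
    (solve 3 (λ t p x → t :* (t :* p) :* x := t :* t :* (p :* x)) refl 2ℚ (2ℚ ^ m) (e m b))
    (cong (4ℚ *_) (e-scale 2ℚ m b))

open ExponentialSeries

-- Partial sums of the flow at rational times, with bounds uniform in the number of terms

module PartialSums {I : Set} (next prev : I → I) (a₀ : I → ℚ) (∣a₀∣≤1 : ∀ j → ℚ.∣ a₀ j ∣ ℚ.≤ 1ℚ)
  where
  open import Data.Rational using (_+_; _*_; _-_; -_; ∣_∣; _≤_; _<_)
  open +-*-Solver using (solve; _:+_; _:*_; _:-_; :-_; _:=_; con)
  open ℚ.≤-Reasoning

  -- The vector B^m a₀ for the generator (B a)_j = a_{j-1} - a_{j+1}, so that `P N j q` is the
  -- partial sum with `N` terms of e^{qB} a₀ at `j`.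
  coeff : ℕ → I → ℚ
  coeff zero    j = a₀ j
  coeff (suc m) j = coeff m (prev j) - coeff m (next j)

  ∣coeff∣≤ : ∀ m j → ∣ coeff m j ∣ ≤ 2ℚ ^ m
  ∣coeff∣≤ zero    j = ∣a₀∣≤1 j
  ∣coeff∣≤ (suc m) j = ℚ.≤-trans
    (∣p-q∣≤ {coeff m (prev j)} {coeff m (next j)} (∣coeff∣≤ m (prev j)) (∣coeff∣≤ m (next j)))
    (ℚ.≤-reflexive (solve 1 (λ p → p :+ p := (con 1ℚ :+ con 1ℚ) :* p) refl (2ℚ ^ m)))

  P : ℕ → I → ℚ → ℚ
  P zero    j q = 0ℚ
  P (suc N) j q = P N j q + coeff N j * e N q

  module OnInterval (b : ℚ) (0≤b : 0ℚ ≤ b) where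

    -- Since `coeff m` is at most 2^m in modulus, the scalar series at 2b dominates every partial
    -- sum on [-b, b].
    c : ℚ
    c = 2ℚ * b

    0≤c : 0ℚ ≤ c
    0≤c = *-nonNeg {2ℚ} {b} 0≤2 0≤b

    open Bounds c 0≤c public using (M; S≤M; 0≤M; S-tail)

    ∣term∣≤ : ∀ m j {q} → ∣ q ∣ ≤ b → ∣ coeff m j * e m q ∣ ≤ e m c
    ∣term∣≤ m j {q} h = subst (∣ coeff m j * e m q ∣ ≤_) (e-scale 2ℚ m b)
      (∣p*q∣≤ {coeff m j} {e m q} (∣coeff∣≤ m j) (∣e∣≤ m h))

    P-tail : ∀ k N j {q} → ∣ q ∣ ≤ b → ∣ P (k ℕ.+ N) j q - P N j q ∣ ≤ S c (k ℕ.+ N) - S c N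
    P-tail zero    N j {q} h = ℚ.≤-reflexive (trans (cong ∣_∣ (ℚ.+-inverseʳ (P N j q)))
      (sym (ℚ.+-inverseʳ (S c N))))
    P-tail (suc k) N j {q} h = begin
      ∣ P n j q + coeff n j * e n q - P N j q ∣
        ≡⟨ cong ∣_∣ (solve 3 (λ a t b → a :+ t :- b := a :- b :+ t) refl (P n j q)
            (coeff n j * e n q) (P N j q)) ⟩
      ∣ P n j q - P N j q + coeff n j * e n q ∣
        ≤⟨ ∣p+q∣≤ {P n j q - P N j q} {coeff n j * e n q} (P-tail k N j h) (∣term∣≤ n j h) ⟩
      S c n - S c N + e n c
        ≡⟨ solve 3 (λ a t b → a :- b :+ t := a :+ t :- b) refl (S c n) (e n c) (S c N) ⟩
      S c n + e n c - S c N ∎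
      where n = k ℕ.+ N

    ∣P∣≤M : ∀ N j {q} → ∣ q ∣ ≤ b → ∣ P N j q ∣ ≤ M
    ∣P∣≤M N j {q} h = ℚ.≤-trans (go N) (S≤M N)
      where
      go : ∀ N → ∣ P N j q ∣ ≤ S c N
      go zero    = ℚ.≤-refl
      go (suc N) = ∣p+q∣≤ {P N j q} {coeff N j * e N q} (go N) (∣term∣≤ N j h)

    P-cauchy : ∀ {ε} → 0ℚ < ε → ∃[ N ] (∀ m n → N ℕ.≤ m → N ℕ.≤ n → ∀ j {q} → ∣ q ∣ ≤ b →
      ∣ P m j q - P n j q ∣ ≤ ε)
    P-cauchy {ε} ε>0 = N , close
      where
      N = proj₁ (S-tail ε>0)
      ordered : ∀ m n → m ℕ.≤ n → N ℕ.≤ m → ∀ j {q} → ∣ q ∣ ≤ b → ∣ P n j q - P m j q ∣ ≤ ε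
      ordered m n m≤n N≤m j {q} h = subst (λ k → ∣ P k j q - P m j q ∣ ≤ ε) (ℕ.m∸n+n≡m m≤n)
        (ℚ.≤-trans (P-tail (n ℕ.∸ m) m j h) (proj₂ (S-tail ε>0) (n ℕ.∸ m) m N≤m))
      close : ∀ m n → N ℕ.≤ m → N ℕ.≤ n → ∀ j {q} → ∣ q ∣ ≤ b → ∣ P m j q - P n j q ∣ ≤ ε
      close m n N≤m N≤n j {q} h with ℕ.≤-total m n
      ... | inj₁ m≤n = subst (_≤ ε) (R.∣p-q∣≡∣q-p∣ (P n j q) (P m j q)) (ordered m n m≤n N≤m j h)
      ... | inj₂ n≤m = ordered n m n≤m N≤n j h

    -- Differentiation lowers the degree, so `P (suc N)` is paired with `P N`. With this pairing the
    -- error is exactly the sum of `coeff (suc m) j * remainder m q r` over m < N.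
    taylor-error : ℕ → I → ℚ → ℚ → ℚ
    taylor-error N j q r = P (suc N) j q - P (suc N) j r - (q - r) *
        (P N (prev j) r - P N (next j) r)

    taylor-error-suc : ∀ N j q r →
      taylor-error (suc N) j q r ≡ taylor-error N j q r + coeff (suc N) j * remainder N q r
    taylor-error-suc N j q r = solve 11 (λ A A′ a b x x′ y q r B C →
        (A :+ (a :- b) :* x) :- (A′ :+ (a :- b) :* x′) :- (q :- r) :*
            ((B :+ a :* y) :- (C :+ b :* y))
        := A :- A′ :- (q :- r) :* (B :- C) :+ (a :- b) :* (x :- x′ :- (q :- r) :* y)) refl
      (P (suc N) j q) (P (suc N) j r) (coeff N (prev j)) (coeff N (next j))
      (e (suc N) q) (e (suc N) r) (e N r) q r (P N (prev j) r) (P N (next j) r)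

    taylor-error-zero : ∀ j q r → taylor-error 0 j q r ≡ 0ℚ
    taylor-error-zero j q r = trans
      (cong₂ (λ x y → (0ℚ + a₀ j * x) - (0ℚ + a₀ j * y) - (q - r) * (0ℚ - 0ℚ)) (e-zero q)
        (e-zero r))
      (solve 3 (λ a q r → (con 0ℚ :+ a :* con 1ℚ) :- (con 0ℚ :+ a :* con 1ℚ) :- (q :- r) :*
        (con 0ℚ :- con 0ℚ)
        := con 0ℚ) refl (a₀ j) q r)

    -- The summed remainders are dominated by 4 times a partial sum of the series at `c`, and these
    -- never exceed `M`; hence the constant is independent of `N`.
    ∣taylor-error∣≤ : ∀ N j {q r} → ∣ q ∣ ≤ b → ∣ r ∣ ≤ b →
      ∣ taylor-error N j q r ∣ ≤ 4ℚ * M * ((q - r) * (q - r))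
    ∣taylor-error∣≤ N j {q} {r} hq hr = begin
      ∣ taylor-error N j q r ∣ ≤⟨ go N ⟩
      d² * (4ℚ * S̃ c N)        ≤⟨ ℚ.*-monoˡ-≤-nonNeg d² {{ℚ.nonNegative 0≤d²}}
                                    (ℚ.*-monoˡ-≤-nonNeg 4ℚ S̃≤M) ⟩
      d² * (4ℚ * M)            ≡⟨ ℚ.*-comm d² (4ℚ * M) ⟩
      4ℚ * M * d²              ∎
      where
      d² = (q - r) * (q - r)
      0≤d² : 0ℚ ≤ d²
      0≤d² = p*p-nonNeg (q - r)
      S̃≤M : S̃ c N ≤ M
      S̃≤M = ℚ.≤-trans (p≤p+q {S̃ c N} (ẽ-nonNeg N)) (subst (_≤ M) (sym (S̃-suc c N)) (S≤M N))
        where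
        ẽ-nonNeg : ∀ m → 0ℚ ≤ ẽ m c
        ẽ-nonNeg zero    = ℚ.≤-refl
        ẽ-nonNeg (suc m) = e-nonNeg m 0≤c
      go : ∀ N → ∣ taylor-error N j q r ∣ ≤ d² * (4ℚ * S̃ c N)
      go zero = ℚ.≤-reflexive (trans (cong ∣_∣ (taylor-error-zero j q r))
        (sym (trans (cong (d² *_) (ℚ.*-zeroʳ 4ℚ)) (ℚ.*-zeroʳ d²))))
      go (suc N) = begin
        ∣ taylor-error (suc N) j q r ∣
          ≡⟨ cong ∣_∣ (taylor-error-suc N j q r) ⟩
        ∣ taylor-error N j q r + coeff (suc N) j * remainder N q r ∣
          ≤⟨ ∣p+q∣≤ {taylor-error N j q r} {coeff (suc N) j * remainder N q r} (go N)
               (∣p*q∣≤ {coeff (suc N) j} {remainder N q r} (∣coeff∣≤ (suc N) j)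
                 (∣remainder∣≤ N 0≤b hq hr)) ⟩
        d² * (4ℚ * S̃ c N) + 2ℚ ^ suc N * (d² * ẽ N b)
          ≡⟨ solve 4 (λ d s p x → d :* s :+ p :* (d :* x) := d :* (s :+ p :* x)) refl
               d² (4ℚ * S̃ c N) (2ℚ ^ suc N) (ẽ N b) ⟩
        d² * (4ℚ * S̃ c N + 2ℚ ^ suc N * ẽ N b)
          ≡⟨ cong (λ x → d² * (4ℚ * S̃ c N + x)) (2^*ẽ N b) ⟩
        d² * (4ℚ * S̃ c N + 4ℚ * ẽ N c)
          ≡⟨ cong (d² *_) (ℚ.*-distribˡ-+ 4ℚ (S̃ c N) (ẽ N c)) ⟨
        d² * (4ℚ * (S̃ c N + ẽ N c)) ∎

    -- The first summand comes from the quadratic error, with one factor |q - r| bounded by 2b; the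
    -- second bounds the derivative.
    L : ℚ
    L = 4ℚ * M * (b + b) + (M + M)

    0≤L : 0ℚ ≤ L
    0≤L = ℚ.+-mono-≤ (*-nonNeg {4ℚ * M} (*-nonNeg {4ℚ} 0≤4 0≤M) (ℚ.+-mono-≤ 0≤b 0≤b))
        (ℚ.+-mono-≤ 0≤M 0≤M)

    P-lipschitz : ∀ N j {q r} → ∣ q ∣ ≤ b → ∣ r ∣ ≤ b → ∣ P N j q - P N j r ∣ ≤ L * ∣ q - r ∣
    P-lipschitz zero    j {q} {r} hq hr = *-nonNeg {L} 0≤L (ℚ.0≤∣p∣ (q - r))
    P-lipschitz (suc N) j {q} {r} hq hr = begin
      ∣ P (suc N) j q - P (suc N) j r ∣
        ≡⟨ cong ∣_∣ (solve 3 (λ a b x → a :- b := a :- b :- x :+ x) refl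
             (P (suc N) j q) (P (suc N) j r) (d * (P N (prev j) r - P N (next j) r))) ⟩
      ∣ taylor-error N j q r + d * (P N (prev j) r - P N (next j) r) ∣
        ≤⟨ ∣p+q∣≤ {taylor-error N j q r} {d * (P N (prev j) r - P N (next j) r)}
          (∣taylor-error∣≤ N j hq hr)
             (∣p*q∣≤ {d} {P N (prev j) r - P N (next j) r} ℚ.≤-refl
               (∣p-q∣≤ {P N (prev j) r} {P N (next j) r} (∣P∣≤M N (prev j) hr)
                 (∣P∣≤M N (next j) hr))) ⟩
      4ℚ * M * (d * d) + ∣ d ∣ * (M + M)
        ≤⟨ ℚ.+-monoˡ-≤ (∣ d ∣ * (M + M)) (ℚ.*-monoˡ-≤-nonNeg (4ℚ * M)
             {{ℚ.nonNegative (*-nonNeg {4ℚ} 0≤4 0≤M)}} d²≤) ⟩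
      4ℚ * M * ((b + b) * ∣ d ∣) + ∣ d ∣ * (M + M)
        ≡⟨ solve 4 (λ k b a m → k :* (b :* a) :+ a :* m := (k :* b :+ m) :* a) refl
             (4ℚ * M) (b + b) ∣ d ∣ (M + M) ⟩
      L * ∣ d ∣ ∎
      where
      d = q - r
      d²≤ : d * d ≤ (b + b) * ∣ d ∣
      d²≤ = ℚ.≤-trans (p≤∣p∣ (d * d)) (∣p*q∣≤ {d} {d} (∣p-q∣≤ {q} {r} hq hr) ℚ.≤-refl)

-- The commutative ring of Cauchy reals

module RealLemmas where
  open R using (_≈_; _≤_)
  private module S = +-*-Solver

  map₁ : ∀ {P Q : ℕ → Set} → (∀ n → P n → Q n) → Eventually P → Eventually Q
  map₁ f (N , p) = N , λ n N≤n → f n (p n N≤n)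

  map₂ : ∀ {P Q S : ℕ → Set} → (∀ n → P n → Q n → S n) →
    Eventually P → Eventually Q → Eventually S
  map₂ f (M , p) (N , q) = M ℕ.⊔ N , λ n h → f n
    (p n (ℕ.≤-trans (ℕ.m≤m⊔n M N) h)) (q n (ℕ.≤-trans (ℕ.m≤n⊔m M N) h))

  infix 4 _≃_ _≼_
  infix  8 -_
  infixl 7 _*_
  infixl 6 _+_ _-_

  -- _≈_ and _≤_ unfold to statements about sequences, from which the two
  -- real numbers cannot be inferred; the records keep them visible.
  record _≃_ (x y : ℝ) : Set where
    constructor wrap
    field unwrap : x ≈ y

  record _≼_ (x y : ℝ) : Set where
    constructor wrap
    field unwrap : x ≤ y

  open _≃_ public renaming (unwrap to ≃⇒≈)
  open _≼_ public renaming (unwrap to ≼⇒≤)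

  -- Opaque, so that unification never descends into the Cauchy proofs carried
  -- by sums and products.
  opaque
    _+_ _*_ : ℝ → ℝ → ℝ
    _+_ = R._+_
    _*_ = R._*_

    -_ ∣_∣ : ℝ → ℝ
    -_ = R.-_
    ∣_∣ = R.∣_∣

  _-_ : ℝ → ℝ → ℝ
  x - y = x + - y

  opaque
    unfolding _+_

    +≡ : _+_ ≡ R._+_
    +≡ = refl

    *≡ : _*_ ≡ R._*_
    *≡ = refl

    -≡ : -_ ≡ R.-_
    -≡ = refl

    ∣∣≡ : ∣_∣ ≡ R.∣_∣
    ∣∣≡ = refl

  -- Carries a result about the opaque operations back to the original ones, in which the theorem is
  -- stated. The subtraction follows from the sum and the negation.
  unseal : ∀ {ℓ} (P : (_+_ _*_ _-_ : ℝ → ℝ → ℝ) (-_ ∣_∣ : ℝ → ℝ) → Set ℓ) →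
    P _+_ _*_ _-_ -_ ∣_∣ → P R._+_ R._*_ R._-_ R.-_ R.∣_∣
  unseal P = replace {R._+_} {R._*_} {R.-_} {R.∣_∣} +≡ *≡ -≡ ∣∣≡
    where
    replace : ∀ {a m n v} → _+_ ≡ a → _*_ ≡ m → -_ ≡ n → ∣_∣ ≡ v →
      P _+_ _*_ _-_ -_ ∣_∣ → P a m (λ x y → a x (n y)) n v
    replace refl refl refl refl p = p

  -≡- : ∀ x y → x - y ≡ x R.- y
  -≡- x y = trans (cong (x +_) (cong-app -≡ y)) (cong-app (cong-app +≡ x) (R.- y))

  pointwise : ∀ {x y} → (∀ n → seq x n ≡ seq y n) → x ≃ y
  pointwise {x} {y} eq = wrap λ ε ε>0 → 0 , λ n _ → subst (ℚ._≤ ε)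
    (sym (trans (cong (λ z → ℚ.∣ z ℚ.- seq y n ∣) (eq n)) (cong ℚ.∣_∣ (ℚ.+-inverseʳ (seq y n)))))
    (ℚ.<⇒≤ ε>0)

  pointwise-≼ : ∀ {x y} → (∀ n → seq x n ℚ.≤ seq y n) → x ≼ y
  pointwise-≼ {x} {y} le = wrap λ ε ε>0 → 0 , λ n _ → ℚ.≤-trans (le n)
    (subst (ℚ._≤ seq y n ℚ.+ ε) (ℚ.+-identityʳ (seq y n)) (ℚ.+-monoʳ-≤ (seq y n) (ℚ.<⇒≤ ε>0)))

  ≃-refl : ∀ {x} → x ≃ x
  ≃-refl = pointwise λ _ → refl

  ≃-sym : ∀ {x y} → x ≃ y → y ≃ x
  ≃-sym {x} {y} (wrap h) = wrap λ ε ε>0 → map₁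
    (λ n → subst (ℚ._≤ ε) (R.∣p-q∣≡∣q-p∣ (seq x n) (seq y n))) (h ε ε>0)

  ≼-trans : ∀ {x y z} → x ≼ y → y ≼ z → x ≼ z
  ≼-trans {x} {y} {z} (wrap h) (wrap k) = wrap λ ε ε>0 → let δ , δ>0 , δ+δ≤ε = halve ε>0 in
    map₂ (λ n p q → let open ℚ.≤-Reasoning in begin
      seq x n                    ≤⟨ p ⟩
      seq y n ℚ.+ δ              ≤⟨ ℚ.+-monoˡ-≤ δ q ⟩
      seq z n ℚ.+ δ ℚ.+ δ        ≡⟨ ℚ.+-assoc (seq z n) δ δ ⟩
      seq z n ℚ.+ (δ ℚ.+ δ)      ≤⟨ ℚ.+-monoʳ-≤ (seq z n) δ+δ≤ε ⟩
      seq z n ℚ.+ ε              ∎) (h δ δ>0) (k δ δ>0)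

  ≃⇒≼ : ∀ {x y} → x ≃ y → x ≼ y
  ≃⇒≼ (wrap h) = wrap λ ε ε>0 → map₁ (λ _ → ∣p-q∣≤r⇒p≤q+r) (h ε ε>0)

  ≼-antisym : ∀ {x y} → x ≼ y → y ≼ x → x ≃ y
  ≼-antisym {x} {y} (wrap h) (wrap k) = wrap λ ε ε>0 → map₂ (λ n p q → ∣p∣≤q (p≤q+r⇒p-q≤r p)
    (subst (ℚ._≤ ε) (S.solve 2 (λ x y → y S.:- x S.:= S.:- (x S.:- y)) refl (seq x n) (seq y n))
      (p≤q+r⇒p-q≤r q))) (h ε ε>0) (k ε ε>0)

  ≃-trans : ∀ {x y z} → x ≃ y → y ≃ z → x ≃ z
  ≃-trans p q = ≼-antisym (≼-trans (≃⇒≼ p) (≃⇒≼ q)) (≼-trans (≃⇒≼ (≃-sym q)) (≃⇒≼ (≃-sym p)))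

  opaque
    unfolding _+_

    +-mono : ∀ {x y z w} → x ≼ y → z ≼ w → x + z ≼ y + w
    +-mono {x} {y} {z} {w} (wrap h) (wrap k) = wrap λ ε ε>0 → let δ , δ>0 , δ+δ≤ε = halve ε>0 in
      map₂ (λ n p q → let open ℚ.≤-Reasoning in begin
        seq x n ℚ.+ seq z n                   ≤⟨ ℚ.+-mono-≤ p q ⟩
        (seq y n ℚ.+ δ) ℚ.+ (seq w n ℚ.+ δ)   ≡⟨ S.solve 3 (λ y w d → (y S.:+ d) S.:+ (w S.:+ d)
                                                   S.:= y S.:+ w S.:+ (d S.:+ d)) refl (seq y n)
                                                     (seq w n) δ ⟩
        seq y n ℚ.+ seq w n ℚ.+ (δ ℚ.+ δ)     ≤⟨ ℚ.+-monoʳ-≤ (seq y n ℚ.+ seq w n) δ+δ≤ε ⟩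
        seq y n ℚ.+ seq w n ℚ.+ ε             ∎) (h δ δ>0) (k δ δ>0)

    -‿cong : ∀ {x y} → x ≃ y → - x ≃ - y
    -‿cong {x} {y} (wrap h) = wrap λ ε ε>0 → map₁ (λ n →
      subst (ℚ._≤ ε) (∣p-q∣≡∣-p--q∣ (seq x n) (seq y n))) (h ε ε>0)

    ∣∣-cong : ∀ {x y} → x ≃ y → ∣ x ∣ ≃ ∣ y ∣
    ∣∣-cong {x} {y} (wrap h) = wrap λ ε ε>0 → map₁ (λ n →
      ℚ.≤-trans (R.reverse-triangle (seq x n) (seq y n))) (h ε ε>0)

    *-congˡ : ∀ x {y z} → y ≃ z → x * y ≃ x * z
    *-congˡ x {y} {z} (wrap h) = wrap λ ε ε>0 →
      let B , B>0 , b = R.bounded (seq x) (isCauchy x)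
          δ , δ>0 , Bδ≤ε = shrink B ε>0
      in map₂ (λ n p q → let open ℚ.≤-Reasoning in begin
        ℚ.∣ seq x n ℚ.* seq y n ℚ.- seq x n ℚ.* seq z n ∣
          ≡⟨ cong ℚ.∣_∣ (S.solve 3 (λ x y z → x S.:* y S.:- x S.:* z S.:= x S.:* (y S.:- z))
               refl (seq x n) (seq y n) (seq z n)) ⟩
        ℚ.∣ seq x n ℚ.* (seq y n ℚ.- seq z n) ∣
          ≡⟨ ℚ.∣p*q∣≡∣p∣*∣q∣ (seq x n) (seq y n ℚ.- seq z n) ⟩
        ℚ.∣ seq x n ∣ ℚ.* ℚ.∣ seq y n ℚ.- seq z n ∣
          ≤⟨ *-mono-≤ (ℚ.0≤∣p∣ (seq x n)) (ℚ.<⇒≤ δ>0) p q ⟩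
        B ℚ.* δ  ≤⟨ Bδ≤ε ⟩
        ε        ∎) b (h δ δ>0)

    +-assoc : ∀ x y z → (x + y) + z ≃ x + (y + z)
    +-assoc x y z = pointwise λ n → ℚ.+-assoc (seq x n) (seq y n) (seq z n)

    +-comm : ∀ x y → x + y ≃ y + x
    +-comm x y = pointwise λ n → ℚ.+-comm (seq x n) (seq y n)

    +-identityˡ : ∀ x → 0ℝ + x ≃ x
    +-identityˡ x = pointwise λ n → ℚ.+-identityˡ (seq x n)

    +-inverseˡ : ∀ x → - x + x ≃ 0ℝ
    +-inverseˡ x = pointwise λ n → ℚ.+-inverseˡ (seq x n)

    *-assoc : ∀ x y z → (x * y) * z ≃ x * (y * z)
    *-assoc x y z = pointwise λ n → ℚ.*-assoc (seq x n) (seq y n) (seq z n)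

    *-comm : ∀ x y → x * y ≃ y * x
    *-comm x y = pointwise λ n → ℚ.*-comm (seq x n) (seq y n)

    *-identityˡ : ∀ x → 1ℝ * x ≃ x
    *-identityˡ x = pointwise λ n → ℚ.*-identityˡ (seq x n)

    *-distribˡ-+ : ∀ x y z → x * (y + z) ≃ x * y + x * z
    *-distribˡ-+ x y z = pointwise λ n → ℚ.*-distribˡ-+ (seq x n) (seq y n) (seq z n)

    fromℚ-+ : ∀ p q → fromℚ (p ℚ.+ q) ≃ fromℚ p + fromℚ q
    fromℚ-+ p q = pointwise λ _ → refl

    fromℚ-* : ∀ p q → fromℚ (p ℚ.* q) ≃ fromℚ p * fromℚ q
    fromℚ-* p q = pointwise λ _ → refl

    fromℚ-neg : ∀ p → fromℚ (ℚ.- p) ≃ - fromℚ p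
    fromℚ-neg p = pointwise λ _ → refl

  +-cong : ∀ {x y z w} → x ≃ y → z ≃ w → x + z ≃ y + w
  +-cong p q = ≼-antisym (+-mono (≃⇒≼ p) (≃⇒≼ q)) (+-mono (≃⇒≼ (≃-sym p)) (≃⇒≼ (≃-sym q)))

  *-cong : ∀ {x y z w} → x ≃ y → z ≃ w → x * z ≃ y * w
  *-cong {x} {y} {z} {w} p q = ≃-trans (*-congˡ x q)
    (≃-trans (*-comm x w) (≃-trans (*-congˡ w p) (*-comm w y)))

  ≃-setoid : Setoid 0ℓ 0ℓ
  ≃-setoid = record { Carrier = ℝ ; _≈_ = _≃_ ; isEquivalence = record
      { refl = ≃-refl ; sym = ≃-sym ; trans = ≃-trans } }

  +-*-isCommutativeRing : IsCommutativeRing _≃_ _+_ _*_ -_ 0ℝ 1ℝ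
  +-*-isCommutativeRing = record
    { isRing = record
      { +-isAbelianGroup = record
        { isGroup = record
          { isMonoid = record
            { isSemigroup = record
              { isMagma = record
                { isEquivalence = record { refl = ≃-refl ; sym = ≃-sym ; trans = ≃-trans }
                ; ∙-cong = +-cong }
              ; assoc = +-assoc }
            ; identity = comm∧idˡ⇒id +-comm +-identityˡ }
          ; inverse = comm∧invˡ⇒inv +-comm +-inverseˡ
          ; ⁻¹-cong = -‿cong }
        ; comm = +-comm }
      ; *-cong = *-cong
      ; *-assoc = *-assoc
      ; *-identity = comm∧idˡ⇒id *-comm *-identityˡ
      ; distrib = comm∧distrˡ⇒distr +-cong *-comm *-distribˡ-+ }
    ; *-comm = *-comm }
    where open Consequences ≃-setoid

  +-*-commutativeRing : CommutativeRing 0ℓ 0ℓ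
  +-*-commutativeRing = record { isCommutativeRing = +-*-isCommutativeRing }

  -- Gives the ring solver rational coefficients, so that its identities may contain ½.
  fromℚ-morphism : CommutativeRing.rawRing ℚ.+-*-commutativeRing
    -Raw-AlmostCommutative⟶ fromCommutativeRing +-*-commutativeRing
  fromℚ-morphism = record
    { ⟦_⟧ = fromℚ ; +-homo = fromℚ-+ ; *-homo = fromℚ-* ; -‿homo = fromℚ-neg
    ; 0-homo = ≃-refl ; 1-homo = ≃-refl }

  fromℚ-≃? : ∀ p q → Maybe (fromℚ p ≃ fromℚ q)
  fromℚ-≃? p q with p ℚ.≟ q
  ... | yes refl = just ≃-refl
  ... | no  _    = nothing

  module Solver = RingSolver _ _ fromℚ-morphism fromℚ-≃?

open RealLemmas

-- Order and absolute value of the reals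

module RealOrder where
  open Solver

  ≼-refl : ∀ {x} → x ≼ x
  ≼-refl = ≃⇒≼ ≃-refl

  ≼-preorder : Preorder 0ℓ 0ℓ 0ℓ
  ≼-preorder = record { Carrier = ℝ ; _≈_ = _≃_ ; _≲_ = _≼_ ; isPreorder = record
    { isEquivalence = Setoid.isEquivalence ≃-setoid ; reflexive = ≃⇒≼ ; trans = ≼-trans } }

  module ≼-Reasoning = PreorderReasoning ≼-preorder

  ≼-resp : ∀ {x y z w} → x ≃ y → z ≃ w → x ≼ z → y ≼ w
  ≼-resp p q h = ≼-trans (≃⇒≼ (≃-sym p)) (≼-trans h (≃⇒≼ q))

  opaque
    unfolding _+_

    x≼∣x∣ : ∀ x → x ≼ ∣ x ∣
    x≼∣x∣ x = pointwise-≼ λ n → p≤∣p∣ (seq x n)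

    0≼∣x∣ : ∀ x → 0ℝ ≼ ∣ x ∣
    0≼∣x∣ x = pointwise-≼ λ n → ℚ.0≤∣p∣ (seq x n)

    ∣x∣≼y : ∀ {x y} → x ≼ y → - x ≼ y → ∣ x ∣ ≼ y
    ∣x∣≼y (wrap h) (wrap k) = wrap λ ε ε>0 → map₂ (λ n → ∣p∣≤q) (h ε ε>0) (k ε ε>0)

    ∣x+y∣≼∣x∣+∣y∣ : ∀ x y → ∣ x + y ∣ ≼ ∣ x ∣ + ∣ y ∣
    ∣x+y∣≼∣x∣+∣y∣ x y = pointwise-≼ λ n → ℚ.∣p+q∣≤∣p∣+∣q∣ (seq x n) (seq y n)

    ∣x*y∣≃∣x∣*∣y∣ : ∀ x y → ∣ x * y ∣ ≃ ∣ x ∣ * ∣ y ∣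
    ∣x*y∣≃∣x∣*∣y∣ x y = pointwise λ n → ℚ.∣p*q∣≡∣p∣*∣q∣ (seq x n) (seq y n)

    ∣-x∣≃∣x∣ : ∀ x → ∣ - x ∣ ≃ ∣ x ∣
    ∣-x∣≃∣x∣ x = pointwise λ n → ℚ.∣-p∣≡∣p∣ (seq x n)

    ∣x∣≼rational : ∀ x → ∃[ q ] (0ℚ ℚ.< q × ∣ x ∣ ≼ fromℚ q)
    ∣x∣≼rational x = let q , q>0 , N , h = R.bounded (seq x) (isCauchy x) in
      q , q>0 , wrap λ ε ε>0 → N , λ n N≤n → ℚ.≤-trans (h n N≤n)
        (subst (ℚ._≤ q ℚ.+ ε) (ℚ.+-identityʳ q) (ℚ.+-monoʳ-≤ q (ℚ.<⇒≤ ε>0)))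

    small⇒0 : ∀ {x} → (∀ ε → 0ℚ ℚ.< ε → ∣ x ∣ ≼ fromℚ ε) → x ≃ 0ℝ
    small⇒0 {x} h = wrap λ ε ε>0 → let δ , δ>0 , δ+δ≤ε = halve ε>0 in
      map₁ (λ n p → ℚ.≤-trans (ℚ.≤-reflexive (cong ℚ.∣_∣ (ℚ.+-identityʳ (seq x n))))
        (ℚ.≤-trans p δ+δ≤ε)) (≼⇒≤ (h δ δ>0) δ δ>0)

  fromℚ-mono : ∀ {p q} → p ℚ.≤ q → fromℚ p ≼ fromℚ q
  fromℚ-mono p≤q = pointwise-≼ λ _ → p≤q

  neg-mono : ∀ {x y} → x ≼ y → - y ≼ - x
  neg-mono {x} {y} h = ≼-resp
    (solve 2 (λ x y → x :+ (:- x :- y) := :- y) ≃-refl x y)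
    (solve 2 (λ x y → y :+ (:- x :- y) := :- x) ≃-refl x y)
    (+-mono h ≼-refl)

  x≼y⇒0≼y-x : ∀ {x y} → x ≼ y → 0ℝ ≼ y - x
  x≼y⇒0≼y-x {x} h = ≼-resp (solve 1 (λ x → x :- x := con 0ℚ) ≃-refl x) ≃-refl (+-mono h ≼-refl)

  0≼y-x⇒x≼y : ∀ {x y} → 0ℝ ≼ y - x → x ≼ y
  0≼y-x⇒x≼y {x} {y} h = ≼-resp (+-identityˡ x) (solve 2 (λ x y → y :- x :+ x := y) ≃-refl x y)
    (+-mono h ≼-refl)

  ∣x∣≃x : ∀ {x} → 0ℝ ≼ x → ∣ x ∣ ≃ x
  ∣x∣≃x {x} 0≼x = ≼-antisym (∣x∣≼y ≼-refl (≼-trans (≼-resp ≃-refl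
    (solve 0 (:- con 0ℚ := con 0ℚ) ≃-refl) (neg-mono 0≼x)) 0≼x)) (x≼∣x∣ x)

  +-nonNeg : ∀ {x y} → 0ℝ ≼ x → 0ℝ ≼ y → 0ℝ ≼ x + y
  +-nonNeg p q = ≼-resp (+-identityˡ 0ℝ) ≃-refl (+-mono p q)

  -- The terms of a nonnegative real may be negative, so a termwise argument fails; instead the
  -- product is identified with its own absolute value.
  *-nonNeg′ : ∀ {x y} → 0ℝ ≼ x → 0ℝ ≼ y → 0ℝ ≼ x * y
  *-nonNeg′ {x} {y} p q = ≼-resp ≃-refl
    (≃-trans (∣x*y∣≃∣x∣*∣y∣ x y) (*-cong (∣x∣≃x p) (∣x∣≃x q))) (0≼∣x∣ (x * y))

  opaque
    unfolding _+_

    x*x-nonNeg : ∀ x → 0ℝ ≼ x * x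
    x*x-nonNeg x = pointwise-≼ λ n → p*p-nonNeg (seq x n)

  *-monoˡ-≼ : ∀ {x y z} → 0ℝ ≼ z → x ≼ y → z * x ≼ z * y
  *-monoˡ-≼ {x} {y} {z} 0≼z h = 0≼y-x⇒x≼y (≼-resp ≃-refl
    (solve 3 (λ x y z → z :* (y :- x) := z :* y :- z :* x) ≃-refl x y z)
    (*-nonNeg′ 0≼z (x≼y⇒0≼y-x h)))

  *-monoʳ-≼ : ∀ {x y z} → 0ℝ ≼ z → x ≼ y → x * z ≼ y * z
  *-monoʳ-≼ {x} {y} {z} 0≼z h = ≼-resp (*-comm z x) (*-comm z y) (*-monoˡ-≼ 0≼z h)

  *-mono-≼ : ∀ {x y z w} → 0ℝ ≼ x → 0ℝ ≼ w → x ≼ y → z ≼ w → x * z ≼ y * w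
  *-mono-≼ 0≼x 0≼w h k = ≼-trans (*-monoˡ-≼ 0≼x k) (*-monoʳ-≼ 0≼w h)

  ∣+∣≼ : ∀ {x y a b} → ∣ x ∣ ≼ a → ∣ y ∣ ≼ b → ∣ x + y ∣ ≼ a + b
  ∣+∣≼ {x} {y} p q = ≼-trans (∣x+y∣≼∣x∣+∣y∣ x y) (+-mono p q)

  ∣-∣≼ : ∀ {x y a b} → ∣ x ∣ ≼ a → ∣ y ∣ ≼ b → ∣ x - y ∣ ≼ a + b
  ∣-∣≼ {y = y} p q = ∣+∣≼ p (≼-trans (≃⇒≼ (∣-x∣≃∣x∣ y)) q)

  ∣*∣≼ : ∀ {x y a b} → ∣ x ∣ ≼ a → ∣ y ∣ ≼ b → ∣ x * y ∣ ≼ a * b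
  ∣*∣≼ {x} {y} p q = ≼-trans (≃⇒≼ (∣x*y∣≃∣x∣*∣y∣ x y))
    (*-mono-≼ (0≼∣x∣ x) (≼-trans (0≼∣x∣ y) q) p q)

  ∣∣-resp : ∀ {x y a b} → x ≃ y → a ≃ b → ∣ x ∣ ≼ a → ∣ y ∣ ≼ b
  ∣∣-resp p q = ≼-resp (∣∣-cong p) q

open RealOrder

-- Derivatives with quadratic error

module Calculus where
  open Solver

  LocallyBounded : (ℝ → ℝ) → Set
  LocallyBounded F = ∀ B → ∃[ M ] (∀ t → ∣ t ∣ ≼ B → ∣ F t ∣ ≼ M)

  -- G′ = g with a quadratic error, uniformly on bounded sets: enough for the
  -- fundamental theorem, without continuity of g.
  record Deriv (G g : ℝ → ℝ) : Set where
    constructor deriv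
    field
      quadratic-error : ∀ B → ∃[ K ] (∀ s t → ∣ s ∣ ≼ B → ∣ t ∣ ≼ B →
        ∣ G t - G s - (t - s) * g s ∣ ≼ K * ((t - s) * (t - s)))

  open Deriv public

  Deriv-resp : ∀ {G g h} → (∀ t → g t ≃ h t) → Deriv G g → Deriv G h
  Deriv-resp g≃h (deriv D) = deriv λ B → let K , bound = D B in K , λ s t p q →
    ∣∣-resp (+-cong ≃-refl (-‿cong (*-cong ≃-refl (g≃h s)))) ≃-refl (bound s t p q)

  Deriv-0 : Deriv (λ _ → 0ℝ) (λ _ → 0ℝ)
  Deriv-0 = deriv λ _ → 0ℝ , λ s t _ _ → ≼-trans (≃⇒≼ (≃-trans
    (∣∣-cong (solve 1 (λ d → con 0ℚ :- con 0ℚ :- d :* con 0ℚ := con 0ℚ) ≃-refl (t - s)))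
    (∣x∣≃x ≼-refl)))
    (≃⇒≼ (solve 1 (λ d → con 0ℚ := con 0ℚ :* (d :* d)) ≃-refl (t - s)))

  Deriv-id : ∀ L → Deriv (λ t → t * L) (λ _ → L)
  Deriv-id L = deriv λ _ → 0ℝ , λ s t _ _ → ≼-trans (≃⇒≼ (≃-trans
    (∣∣-cong (solve 3 (λ s t l → t :* l :- s :* l :- (t :- s) :* l := con 0ℚ) ≃-refl s t L))
    (∣x∣≃x ≼-refl)))
    (≃⇒≼ (solve 1 (λ d → con 0ℚ := con 0ℚ :* (d :* d)) ≃-refl (t - s)))

  Deriv-+ : ∀ {F f G g} → Deriv F f → Deriv G g → Deriv (λ t → F t + G t) (λ t → f t + g t)
  Deriv-+ {F} {f} {G} {g} (deriv DF) (deriv DG) = deriv λ B → let K , p = DF B ; L , q = DG B in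
    K + L , λ s t hs ht → ∣∣-resp
      (solve 7 (λ F′ F G′ G d f g → (F′ :- F :- d :* f) :+ (G′ :- G :- d :* g)
        := F′ :+ G′ :- (F :+ G) :- d :* (f :+ g)) ≃-refl (F t) (F s) (G t) (G s) (t - s) (f s)
          (g s))
      (solve 3 (λ k l d → k :* (d :* d) :+ l :* (d :* d) := (k :+ l) :* (d :* d)) ≃-refl K L
          (t - s))
      (∣+∣≼ (p s t hs ht) (q s t hs ht))

  Deriv-scale : ∀ {G g} c → Deriv G g → Deriv (λ t → c * G t) (λ t → c * g t)
  Deriv-scale {G} {g} c (deriv D) = deriv λ B → let K , p = D B in
    ∣ c ∣ * K , λ s t hs ht → ∣∣-resp
      (solve 5 (λ c G′ G d g → c :* (G′ :- G :- d :* g)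
        := c :* G′ :- c :* G :- d :* (c :* g)) ≃-refl c (G t) (G s) (t - s) (g s))
      (≃-sym (*-assoc ∣ c ∣ K ((t - s) * (t - s))))
      (∣*∣≼ ≼-refl (p s t hs ht))

  -- The cross term (F t - F s)(t - s) g(s) is expanded by the error of `F`. Its last piece is cubic
  -- in t - s, and one factor of it is bounded by `B + B`.
  Deriv-* : ∀ {F f G g} → LocallyBounded F → LocallyBounded f → LocallyBounded G →
      LocallyBounded g →
    Deriv F f → Deriv G g → Deriv (λ t → F t * G t) (λ t → f t * G t + F t * g t)
  Deriv-* {F} {f} {G} {g} bF bf bG bg (deriv DF) (deriv DG) = deriv λ B →
    let MF , F≼ = bF B ; Mf , f≼ = bf B ; MG , G≼ = bG B ; Mg , g≼ = bg B
        KF , RF = DF B ; KG , RG = DG B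
    in MF * KG + MG * KF + Mf * Mg + KF * ((B + B) * Mg) , λ s t hs ht → ∣∣-resp
      (solve 7 (λ F′ F f G′ G g d →
        F′ :* (G′ :- G :- d :* g) :+ G :* (F′ :- F :- d :* f) :+ d :* d :* (f :* g)
          :+ (F′ :- F :- d :* f) :* (d :* g)
        := F′ :* G′ :- F :* G :- d :* (f :* G :+ F :* g)) ≃-refl
        (F t) (F s) (f s) (G t) (G s) (g s) (t - s))
      (solve 8 (λ MF KG MG KF Mf Mg B d → MF :* (KG :* (d :* d)) :+ MG :* (KF :* (d :* d))
          :+ d :* d :* (Mf :* Mg) :+ KF :* (d :* d) :* ((B :+ B) :* Mg)
        := (MF :* KG :+ MG :* KF :+ Mf :* Mg :+ KF :* ((B :+ B) :* Mg)) :* (d :* d)) ≃-refl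
        MF KG MG KF Mf Mg B (t - s))
      (∣+∣≼ (∣+∣≼ (∣+∣≼ (∣*∣≼ (F≼ t ht) (RG s t hs ht)) (∣*∣≼ (G≼ s hs) (RF s t hs ht)))
        (∣*∣≼ (≃⇒≼ (∣x∣≃x (x*x-nonNeg (t - s)))) (∣*∣≼ (f≼ s hs) (g≼ s hs))))
        (∣*∣≼ (RF s t hs ht) (∣*∣≼ (∣-∣≼ ht hs) (g≼ s hs))))

open Calculus

open Sum (CommutativeRing.+-commutativeMonoid +-*-commutativeRing) using (sum; sum-cong-≋)

-- Constancy and the fundamental theorem

module Integration where
  open R.TaggedPartition
  open Solver
  open ≼-Reasoning

  -- A function on Cauchy sequences need not respect `_≃_`. The quadratic error forces it, since
  -- `y - x` and its square vanish.
  Deriv-cong : ∀ {G g x y} → Deriv G g → x ≃ y → G x ≃ G y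
  Deriv-cong {G} {g} {x} {y} D x≃y = let K , bound = quadratic-error D (∣ x ∣ + ∣ y ∣) in
    ≃-trans (solve 2 (λ a b → b := a :- (a :- b)) ≃-refl (G y) (G x))
      (≃-trans (+-cong ≃-refl (-‿cong (zero-difference (bound x y
        (≼-resp (solve 1 (λ a → a :+ con 0ℚ := a) ≃-refl ∣ x ∣) ≃-refl (+-mono ≼-refl (0≼∣x∣ y)))
        (≼-resp (+-identityˡ ∣ y ∣) ≃-refl (+-mono (0≼∣x∣ x) ≼-refl))))))
        (solve 1 (λ a → a :- con 0ℚ := a) ≃-refl (G y)))
    where
    d≃0 : y - x ≃ 0ℝ
    d≃0 = ≃-trans (+-cong ≃-refl (-‿cong x≃y)) (solve 1 (λ y → y :- y := con 0ℚ) ≃-refl y)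
    zero-difference : ∀ {K} → ∣ G y - G x - (y - x) * g x ∣ ≼ K * ((y - x) * (y - x)) →
        G y - G x ≃ 0ℝ
    zero-difference {K} h = small⇒0 λ ε ε>0 → begin
      ∣ G y - G x ∣ ≈⟨ ∣∣-cong (≃-trans
          (solve 2 (λ a b → a := a :- con 0ℚ :* b) ≃-refl (G y - G x) (g x))
          (+-cong ≃-refl (-‿cong (*-cong (≃-sym d≃0) ≃-refl)))) ⟩
      ∣ G y - G x - (y - x) * g x ∣ ≲⟨ h ⟩
      K * ((y - x) * (y - x)) ≈⟨ *-cong ≃-refl (*-cong d≃0 d≃0) ⟩
      K * (0ℝ * 0ℝ) ≈⟨ solve 1 (λ k → k :* (con 0ℚ :* con 0ℚ) := con 0ℚ) ≃-refl K ⟩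
      0ℝ ≲⟨ fromℚ-mono (ℚ.<⇒≤ ε>0) ⟩
      fromℚ ε ∎

  -- Passing through the midpoint halves the constant of a quadratic bound.
  quadratic-bound-halves : ∀ (E : ℝ → ℝ) {B K} m → 0ℝ ≼ K →
    (∀ s t → ∣ s ∣ ≼ B → ∣ t ∣ ≼ B → ∣ E t - E s ∣ ≼ K * ((t - s) * (t - s))) →
    ∀ s t → ∣ s ∣ ≼ B → ∣ t ∣ ≼ B → ∣ E t - E s ∣ ≼ fromℚ (½ ^ m) * K * ((t - s) * (t - s))
  quadratic-bound-halves E {B} {K} zero _ bound s t hs ht =
    ≼-resp ≃-refl (*-cong (≃-sym (*-identityˡ K)) ≃-refl) (bound s t hs ht)
  quadratic-bound-halves E {B} {K} (suc m) 0≼K bound s t hs ht = ∣∣-resp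
    (solve 3 (λ a b c → (a :- b) :+ (b :- c) := a :- c) ≃-refl (E t) (E c) (E s))
    (≃-trans (solve 4 (λ s t p k →
      p :* k :* ((t :- con ½ :* (s :+ t)) :* (t :- con ½ :* (s :+ t)))
        :+ p :* k :* ((con ½ :* (s :+ t) :- s) :* (con ½ :* (s :+ t) :- s))
        := con ½ :* p :* k :* ((t :- s) :* (t :- s))) ≃-refl s t (fromℚ (½ ^ m)) K)
      (*-cong (*-cong (≃-sym (fromℚ-* ½ (½ ^ m))) ≃-refl) ≃-refl))
    (∣+∣≼ (quadratic-bound-halves E m 0≼K bound c t hc ht)
          (quadratic-bound-halves E m 0≼K bound s c hs hc))
    where
    c = fromℚ ½ * (s + t)
    hc : ∣ c ∣ ≼ B
    hc = ∣∣-resp ≃-refl (solve 1 (λ b → con ½ :* (b :+ b) := b) ≃-refl B)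
      (∣*∣≼ (≃⇒≼ (∣x∣≃x (fromℚ-mono (ℚ.nonNegative⁻¹ ½)))) (∣+∣≼ hs ht))

  -- Iterated halving bounds |E t - E s| by K (t-s)²/2^m for every m; this stands in for the mean
  -- value theorem.
  Deriv-0⇒constant : ∀ {E} → Deriv E (λ _ → 0ℝ) → ∀ s t → E t ≃ E s
  Deriv-0⇒constant {E} D s t = ≃-trans (solve 2 (λ a b → a := b :+ (a :- b)) ≃-refl (E t) (E s))
    (≃-trans (+-cong ≃-refl difference≃0) (solve 1 (λ a → a :+ con 0ℚ := a) ≃-refl (E s)))
    where
    B = ∣ s ∣ + ∣ t ∣
    K = ∣ proj₁ (quadratic-error D B) ∣
    d² = (t - s) * (t - s)
    bound : ∀ s t → ∣ s ∣ ≼ B → ∣ t ∣ ≼ B → ∣ E t - E s ∣ ≼ K * ((t - s) * (t - s))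
    bound s t hs ht = ≼-trans (∣∣-resp
      (solve 3 (λ a b d → a :- b :- d :* con 0ℚ := a :- b) ≃-refl (E t) (E s) (t - s)) ≃-refl
      (proj₂ (quadratic-error D B) s t hs ht)) (*-monoʳ-≼ (x*x-nonNeg (t - s)) (x≼∣x∣ _))
    difference≃0 : E t - E s ≃ 0ℝ
    difference≃0 = small⇒0 λ ε ε>0 →
      let C , _ , h = ∣x∣≼rational (K * d²)
          m , ½^m*C≤ε = geometric-small {C} ε>0
      in begin
        ∣ E t - E s ∣ ≲⟨ quadratic-bound-halves E m (0≼∣x∣ _) bound s t
            (≼-resp (solve 1 (λ a → a :+ con 0ℚ := a) ≃-refl ∣ s ∣) ≃-refl
                (+-mono ≼-refl (0≼∣x∣ t)))
            (≼-resp (+-identityˡ ∣ t ∣) ≃-refl (+-mono (0≼∣x∣ s) ≼-refl)) ⟩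
        fromℚ (½ ^ m) * K * d² ≈⟨ *-assoc (fromℚ (½ ^ m)) K d² ⟩
        fromℚ (½ ^ m) * (K * d²) ≲⟨ *-monoˡ-≼ (fromℚ-mono (^-nonNeg m (ℚ.nonNegative⁻¹ ½)))
            (≼-trans (x≼∣x∣ _) h) ⟩
        fromℚ (½ ^ m) * fromℚ C ≈⟨ fromℚ-* (½ ^ m) C ⟨
        fromℚ (½ ^ m ℚ.* C) ≲⟨ fromℚ-mono ½^m*C≤ε ⟩
        fromℚ ε ∎

  monotone-range : ∀ n (x : Fin (suc n) → ℝ) → (∀ k → x (inject₁ k) ≼ x (suc k)) →
    ∀ k → x zero ≼ x k × x k ≼ x (fromℕ n)
  monotone-range zero    x mono zero = ≼-refl , ≼-refl
  monotone-range (suc n) x mono zero = ≼-refl ,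
    ≼-trans (mono zero) (proj₂ (monotone-range n (x ∘ suc) (mono ∘ suc) zero))
  monotone-range (suc n) x mono (suc k) = let l , u = monotone-range n (x ∘ suc) (mono ∘ suc) k in
    ≼-trans (mono zero) l , u

  -- An error proportional to the length of each cell adds up to the same multiple of the total
  -- length.
  telescope : ∀ n (x : Fin (suc n) → ℝ) (y : Fin n → ℝ) (Φ : ℝ → ℝ) C →
    (∀ k → ∣ y k - (Φ (x (suc k)) - Φ (x (inject₁ k))) ∣ ≼ C * (x (suc k) - x (inject₁ k))) →
    ∣ sum y - (Φ (x (fromℕ n)) - Φ (x zero)) ∣ ≼ C * (x (fromℕ n) - x zero)
  telescope zero x y Φ C h = begin
    ∣ 0ℝ - (Φ (x zero) - Φ (x zero)) ∣  ≈⟨ ∣∣-cong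
        (solve 1 (λ a → con 0ℚ :- (a :- a) := con 0ℚ) ≃-refl (Φ (x zero))) ⟩
    ∣ 0ℝ ∣                              ≈⟨ ∣x∣≃x ≼-refl ⟩
    0ℝ                                  ≈⟨ solve 2 (λ c a → con 0ℚ := c :* (a :- a)) ≃-refl C
        (x zero) ⟩
    C * (x zero - x zero)               ∎
  telescope (suc n) x y Φ C h = ∣∣-resp
    (solve 5 (λ a s p q r → (a :- (q :- p)) :+ (s :- (r :- q)) := a :+ s :- (r :- p)) ≃-refl
      (y zero) (sum (y ∘ suc)) (Φ (x zero)) (Φ (x (suc zero))) (Φ (x (suc (fromℕ n)))))
    (solve 4 (λ c p q r → c :* (q :- p) :+ c :* (r :- q) := c :* (r :- p)) ≃-refl
      C (x zero) (x (suc zero)) (x (suc (fromℕ n))))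
    (∣+∣≼ (h zero) (telescope n (x ∘ suc) (y ∘ suc) Φ C (h ∘ suc)))

  -- Both ends are expanded around the tag. As τ lies between them, (l-τ)² + (r-τ)² is (r-l)² minus
  -- the nonnegative 2(τ-l)(r-τ).
  cell : ∀ {Φ f : ℝ → ℝ} {B K δ} → 0ℝ ≼ K →
    (∀ s t → ∣ s ∣ ≼ B → ∣ t ∣ ≼ B → ∣ Φ t - Φ s - (t - s) * f s ∣ ≼ K * ((t - s) * (t - s))) →
    ∀ {l r} τ → ∣ l ∣ ≼ B → ∣ τ ∣ ≼ B → ∣ r ∣ ≼ B → l ≼ τ → τ ≼ r → r - l ≼ δ →
    ∣ f τ * (r - l) - (Φ r - Φ l) ∣ ≼ K * δ * (r - l)
  cell {Φ} {f} {B} {K} {δ} 0≼K bound {l} {r} τ hl hτ hr l≼τ τ≼r r-l≼δ = begin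
    ∣ f τ * (r - l) - (Φ r - Φ l) ∣
      ≈⟨ ∣∣-cong (solve 7 (λ l r τ p q z f → f :* (r :- l) :- (q :- p)
           := (p :- z :- (l :- τ) :* f) :- (q :- z :- (r :- τ) :* f)) ≃-refl
           l r τ (Φ l) (Φ r) (Φ τ) (f τ)) ⟩
    ∣ (Φ l - Φ τ - (l - τ) * f τ) - (Φ r - Φ τ - (r - τ) * f τ) ∣
      ≲⟨ ∣-∣≼ (bound τ l hτ hl) (bound τ r hτ hr) ⟩
    K * ((l - τ) * (l - τ)) + K * ((r - τ) * (r - τ))
      ≈⟨ solve 4 (λ k l r τ → k :* ((l :- τ) :* (l :- τ)) :+ k :* ((r :- τ) :* (r :- τ))
           := k :* ((r :- l) :* (r :- l)) :- k :* ((con 1ℚ :+ con 1ℚ) :* ((τ :- l) :* (r :- τ))))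
             ≃-refl K l r τ ⟩
    K * ((r - l) * (r - l)) - K * ((1ℝ + 1ℝ) * ((τ - l) * (r - τ)))
      ≲⟨ +-mono ≼-refl (neg-mono (*-nonNeg′ 0≼K (*-nonNeg′ (+-nonNeg 0≼1ℝ 0≼1ℝ)
           (*-nonNeg′ (x≼y⇒0≼y-x l≼τ) (x≼y⇒0≼y-x τ≼r))))) ⟩
    K * ((r - l) * (r - l)) - 0ℝ
      ≈⟨ solve 2 (λ k w → k :* (w :* w) :- con 0ℚ := k :* w :* w) ≃-refl K (r - l) ⟩
    K * (r - l) * (r - l)
      ≲⟨ *-monoʳ-≼ (x≼y⇒0≼y-x (≼-trans l≼τ τ≼r)) (*-monoˡ-≼ 0≼K r-l≼δ) ⟩
    K * δ * (r - l) ∎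
    where
    0≼1ℝ : 0ℝ ≼ 1ℝ
    0≼1ℝ = fromℚ-mono 0≤1

  fundamental-theorem : ∀ {Φ f T ε} → Deriv Φ f → 0ℚ ℚ.< ε →
    ∃[ δ ] (0ℚ ℚ.< δ × (∀ (P : R.TaggedPartition 0ℝ T) →
      (∀ k → point P (suc k) - point P (inject₁ k) ≼ fromℚ δ) →
      ∣ sum (λ k → f (tag P k) * (point P (suc k) - point P (inject₁ k))) - (Φ T - Φ 0ℝ) ∣
        ≼ fromℚ ε))
  fundamental-theorem {Φ} {f} {T} {ε} D ε>0 = δ , δ>0 , λ P fine →
    let mono : ∀ k → point P (inject₁ k) ≼ point P (suc k)
        mono k = ≼-trans {y = tag P k} (wrap (lower P k)) (wrap (upper P k))
        0≼point : ∀ k → 0ℝ ≼ point P k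
        0≼point k = ≼-trans (≃⇒≼ (≃-sym (wrap (first P))))
            (proj₁ (monotone-range (size P) (point P) mono k))
        point≼T : ∀ k → point P k ≼ T
        point≼T k = ≼-trans (proj₂ (monotone-range (size P) (point P) mono k))
            (≃⇒≼ (wrap (last P)))
        ∣point∣≼T : ∀ k → ∣ point P k ∣ ≼ T
        ∣point∣≼T k = ≼-trans (≃⇒≼ (∣x∣≃x (0≼point k))) (point≼T k)
        ∣tag∣≼T : ∀ k → ∣ tag P k ∣ ≼ T
        ∣tag∣≼T k = ≼-trans (≃⇒≼ (∣x∣≃x (≼-trans (0≼point (inject₁ k)) (wrap (lower P k)))))
          (≼-trans (wrap (upper P k)) (point≼T (suc k)))
    in begin
      ∣ sum (λ k → f (tag P k) * (point P (suc k) - point P (inject₁ k))) - (Φ T - Φ 0ℝ) ∣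
        -- The end points of `P` are 0 and `T` only up to `_≃_`.
        ≈⟨ ∣∣-cong (+-cong ≃-refl (-‿cong (+-cong (Deriv-cong D (wrap (last P)))
          (-‿cong (Deriv-cong D (wrap (first P))))))) ⟨
      ∣ sum (λ k → f (tag P k) * (point P (suc k) - point P (inject₁ k))) -
        (Φ (point P (fromℕ (size P))) - Φ (point P zero)) ∣
        ≲⟨ telescope (size P) (point P) _ Φ (K * fromℚ δ)
          (λ k → cell {Φ} {f} (0≼∣x∣ _) bound (tag P k)
             (∣point∣≼T (inject₁ k)) (∣tag∣≼T k) (∣point∣≼T (suc k)) (wrap (lower P k))
               (wrap (upper P k)) (fine k)) ⟩
      K * fromℚ δ * (point P (fromℕ (size P)) - point P zero)
        ≈⟨ *-cong ≃-refl (+-cong (wrap (last P)) (-‿cong (wrap (first P)))) ⟩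
      K * fromℚ δ * (T - 0ℝ)
        ≈⟨ solve 3 (λ k d t → k :* d :* (t :- con 0ℚ) := k :* t :* d) ≃-refl K (fromℚ δ) T ⟩
      K * T * fromℚ δ
        ≲⟨ *-monoʳ-≼ (fromℚ-mono (ℚ.<⇒≤ δ>0)) (≼-trans (x≼∣x∣ _) (proj₂ (proj₂ C))) ⟩
      fromℚ (proj₁ C) * fromℚ δ
        ≈⟨ fromℚ-* (proj₁ C) δ ⟨
      fromℚ (proj₁ C ℚ.* δ)
        ≲⟨ fromℚ-mono Cδ≤ε ⟩
      fromℚ ε ∎
    where
    K = ∣ proj₁ (quadratic-error D T) ∣
    bound : ∀ s t → ∣ s ∣ ≼ T → ∣ t ∣ ≼ T →
        ∣ Φ t - Φ s - (t - s) * f s ∣ ≼ K * ((t - s) * (t - s))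
    bound s t hs ht = ≼-trans (proj₂ (quadratic-error D T) s t hs ht)
        (*-monoʳ-≼ (x*x-nonNeg (t - s)) (x≼∣x∣ _))
    -- The total error is at most K T δ; a rational bound of `K * T` is taken because δ is to be
    -- rational.
    C = ∣x∣≼rational (K * T)
    shrunk = shrink (proj₁ C) ε>0
    δ = proj₁ shrunk
    δ>0 = proj₁ (proj₂ shrunk)
    Cδ≤ε = proj₂ (proj₂ shrunk)

open Integration

-- Bounded primitives and time averages

module TimeAverages where
  open R.TaggedPartition
  open Solver
  open ≼-Reasoning

  Bounded : (ℝ → ℝ) → Set
  Bounded G = ∃[ C ] (∀ t → ∣ G t ∣ ≼ C)

  -- Functions with a bounded primitive form a linear space, so the argument about the cycle becomes
  -- algebra modulo that space; integrals appear only in `BP⇒timeAverage`.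
  record BoundedPrimitive (g : ℝ → ℝ) : Set where
    constructor boundedPrimitive
    field
      function : ℝ → ℝ
      isBounded : Bounded function
      isPrimitive : Deriv function g

  BP-resp : ∀ {g h} → (∀ t → g t ≃ h t) → BoundedPrimitive g → BoundedPrimitive h
  BP-resp g≃h (boundedPrimitive G b D) = boundedPrimitive G b (Deriv-resp g≃h D)

  BP-0 : BoundedPrimitive (λ _ → 0ℝ)
  BP-0 = boundedPrimitive (λ _ → 0ℝ) (0ℝ , λ _ → ≃⇒≼ (∣x∣≃x ≼-refl)) Deriv-0

  BP-+ : ∀ {f g} → BoundedPrimitive f → BoundedPrimitive g → BoundedPrimitive (λ t → f t + g t)
  BP-+ (boundedPrimitive F (A , F≼A) DF) (boundedPrimitive G (B , G≼B) DG) =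
    boundedPrimitive (λ t → F t + G t) (A + B , λ t → ∣+∣≼ (F≼A t) (G≼B t)) (Deriv-+ DF DG)

  BP-scale : ∀ {g} c → BoundedPrimitive g → BoundedPrimitive (λ t → c * g t)
  BP-scale c (boundedPrimitive G (B , G≼B) D) =
    boundedPrimitive (λ t → c * G t) (∣ c ∣ * B , λ t → ∣*∣≼ ≼-refl (G≼B t)) (Deriv-scale c D)

  BP-neg : ∀ {g} → BoundedPrimitive g → BoundedPrimitive (λ t → - g t)
  BP-neg {g} p = BP-resp (λ t → solve 1 (λ a → con (ℚ.- 1ℚ) :* a := :- a) ≃-refl (g t))
    (BP-scale (fromℚ (ℚ.- 1ℚ)) p)

  BP-sum : ∀ {n} {g : Fin n → ℝ → ℝ} → (∀ k → BoundedPrimitive (g k)) →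
    BoundedPrimitive (λ t → sum (λ k → g k t))
  BP-sum {zero}  p = BP-0
  BP-sum {suc n} p = BP-+ (p zero) (BP-sum (p ∘ suc))

  positive-below : ∀ {x} → 0ℝ R.< x → ∃[ q ] (0ℚ ℚ.< q × fromℚ q ≼ x)
  positive-below {x} (q , q>0 , N , h) = q , q>0 , wrap λ ε ε>0 → N , λ n N≤n → ℚ.≤-trans
    (subst (ℚ._≤ seq x n) (ℚ.+-identityˡ q) (h n N≤n))
    (subst (ℚ._≤ seq x n ℚ.+ ε) (ℚ.+-identityʳ (seq x n)) (ℚ.+-monoʳ-≤ (seq x n) (ℚ.<⇒≤ ε>0)))

  fromℚ-positive : ∀ {q} → 0ℚ ℚ.< q → 0ℝ R.< fromℚ q
  fromℚ-positive {q} q>0 = q , q>0 , 0 , λ _ _ → ℚ.≤-reflexive (ℚ.+-identityˡ q)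

  sum≡ : ∀ {n} (f : Fin n → ℝ) → sum f ≡ R.sum f
  sum≡ f = replace {R._+_} +≡
    where
    replace : ∀ {add} → _+_ ≡ add → sum f ≡ foldr add 0ℝ f
    replace refl = refl

  -- With `p` and `q` as variables the equation can be matched, instead of rewriting below the
  -- instance that `ℚ.1/` carries.
  1/-*-cancel : ∀ {p q} .{{_ : ℚ.NonZero p}} → p ≡ q → (ℚ.1/ p) ℚ.* q ≡ 1ℚ
  1/-*-cancel {p} {{p≢0}} refl = ℚ.*-inverseˡ p {{p≢0}}

  seq-inverse : ∀ x (x>0 : 0ℝ R.< x) n → let e , e>0 , _ = x>0 in seq (R.inverse x x>0) n
    ≡ (ℚ.1/ (seq x n ℚ.⊔ e)) {{ℚ.pos⇒nonZero (seq x n ℚ.⊔ e) {{R.⊔-pos (seq x n) e e>0}}}}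
  seq-inverse x x>0 n = refl

  seq-inverse-*ˡ : ∀ x (x>0 : 0ℝ R.< x) → let _ , _ , N , _ = x>0 in ∀ n → N ℕ.≤ n →
    seq (R.inverse x x>0) n ℚ.* seq x n ≡ 1ℚ
  seq-inverse-*ˡ x x>0@(e , e>0 , N , h) n N≤n = trans
    (cong (ℚ._* seq x n) (seq-inverse x x>0 n))
    (1/-*-cancel {{ℚ.pos⇒nonZero (seq x n ℚ.⊔ e) {{R.⊔-pos (seq x n) e e>0}}}}
      (ℚ.p≥q⇒p⊔q≡p (subst (ℚ._≤ seq x n) (ℚ.+-identityˡ e) (h n N≤n))))

  opaque
    unfolding _+_

    inverse-*ˡ : ∀ x (x>0 : 0ℝ R.< x) → R.inverse x x>0 * x ≃ 1ℝ
    inverse-*ˡ x x>0@(_ , _ , N , _) = wrap λ ε ε>0 → N , λ n N≤n →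
      subst (λ q → ℚ.∣ q ℚ.- 1ℚ ∣ ℚ.≤ ε) (sym (seq-inverse-*ˡ x x>0 n N≤n)) (ℚ.<⇒≤ ε>0)

  inverse-nonNeg : ∀ x (x>0 : 0ℝ R.< x) → 0ℝ ≼ R.inverse x x>0
  inverse-nonNeg x x>0@(e , e>0 , _) = pointwise-≼ λ n →
    subst (0ℚ ℚ.≤_) {1/d n} {seq (R.inverse x x>0) n} (sym (seq-inverse x x>0 n))
      (ℚ.<⇒≤ (ℚ.positive⁻¹ (1/d n) {{ℚ.1/pos⇒pos (seq x n ℚ.⊔ e) {{R.⊔-pos (seq x n) e e>0}}}}))
    where
    1/d : ℕ → ℚ
    1/d n = (ℚ.1/ (seq x n ℚ.⊔ e)) {{ℚ.pos⇒nonZero (seq x n ℚ.⊔ e) {{R.⊔-pos (seq x n) e e>0}}}}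

  -- The part `t * L` contributes exactly `L` to the mean, so only (G T - G 0)/T remains, at most
  -- 2C/T. The hypothesis says 2C/T ≤ ε free of division.
  mean-value-bound : ∀ {G : ℝ → ℝ} {C L ε} → (∀ t → ∣ G t ∣ ≼ C) → ∀ T (T>0 : 0ℝ R.< T) →
    C + C ≼ T * ε →
    ∣ R.inverse T T>0 * ((T * L + G T) - (0ℝ * L + G 0ℝ)) - L ∣ ≼ ε
  mean-value-bound {G} {C} {L} {ε} G≼C T T>0 h = begin
    ∣ i * ((T * L + G T) - (0ℝ * L + G 0ℝ)) - L ∣
      ≈⟨ ∣∣-cong (solve 5 (λ i t l a b → i :* ((t :* l :+ a) :- (con 0ℚ :* l :+ b)) :- l
           := (i :* t) :* l :- l :+ i :* (a :- b)) ≃-refl i T L (G T) (G 0ℝ)) ⟩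
    ∣ i * T * L - L + i * (G T - G 0ℝ) ∣
      ≈⟨ ∣∣-cong (+-cong (+-cong (*-cong (inverse-*ˡ T T>0) ≃-refl) ≃-refl) ≃-refl) ⟩
    ∣ 1ℝ * L - L + i * (G T - G 0ℝ) ∣
      ≈⟨ ∣∣-cong (solve 2 (λ l a → con 1ℚ :* l :- l :+ a := a) ≃-refl L (i * (G T - G 0ℝ))) ⟩
    ∣ i * (G T - G 0ℝ) ∣
      ≲⟨ ∣*∣≼ (≃⇒≼ (∣x∣≃x (inverse-nonNeg T T>0))) (∣-∣≼ (G≼C T) (G≼C 0ℝ)) ⟩
    i * (C + C)   ≲⟨ *-monoˡ-≼ (inverse-nonNeg T T>0) h ⟩
    i * (T * ε)   ≈⟨ *-assoc i T ε ⟨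
    i * T * ε     ≈⟨ *-cong (inverse-*ˡ T T>0) ≃-refl ⟩
    1ℝ * ε        ≈⟨ *-identityˡ ε ⟩
    ε             ∎
    where i = R.inverse T T>0

  width≡ : ∀ {a b} (P : R.TaggedPartition a b) →
    width P ≡ λ k → point P (suc k) R.- point P (inject₁ k)
  width≡ P = refl

  width≃ : ∀ {a b} (P : R.TaggedPartition a b) k →
      width P k ≃ point P (suc k) - point P (inject₁ k)
  width≃ P k = subst (width P k ≃_)
    (trans (cong-app (width≡ P) k) (sym (-≡- (point P (suc k)) (point P (inject₁ k))))) ≃-refl

  riemannSum≡ : ∀ f {a b} (P : R.TaggedPartition a b) →
    R.sum (λ k → f (tag P k) R.* width P k) ≡ R.riemannSum f P
  riemannSum≡ f P = refl

  Deriv⇒integral : ∀ {Φ f} → Deriv Φ f → ∀ T → R.IsIntegral f 0ℝ T (Φ T R.- Φ 0ℝ)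
  Deriv⇒integral {Φ} {f} D T ε ε>0 =
    let e , e>0 , e≼ε = positive-below ε>0
        δ , δ>0 , h = fundamental-theorem {Φ} {f} {T} {e} D e>0
    in fromℚ δ , fromℚ-positive δ>0 , λ P fine →
      ≼⇒≤ {R.∣ R.riemannSum f P R.- (Φ T R.- Φ 0ℝ) ∣} {ε}
      (subst (λ s → R.∣ s R.- (Φ T R.- Φ 0ℝ) ∣ ≼ ε)
        {R.sum (λ k → f (tag P k) R.* width P k)} {R.riemannSum f P} (riemannSum≡ f P)
        (unseal (λ _ _*_ _-_ _ ∣_∣ → ∣ R.sum (λ k → f (tag P k) * width P k) - (Φ T - Φ 0ℝ) ∣ ≼ ε)
          (subst (λ s → ∣ s - (Φ T - Φ 0ℝ) ∣ ≼ ε) (sum≡ (λ k → f (tag P k) * width P k))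
            (≼-trans (∣∣-resp (+-cong (sum-cong-≋ λ k → *-cong ≃-refl (≃-sym (width≃ P k)))
              ≃-refl) ≃-refl
              (h P (λ k → ≼-resp (width≃ P k) ≃-refl (wrap (fine k))))) e≼ε))))

  -- Adding `t * L` to the bounded primitive of f - L gives a primitive of f itself, which supplies
  -- every integral.
  BP⇒timeAverage : ∀ {f L} → BoundedPrimitive (λ t → f t - L) → R.IsTimeAverage f L
  BP⇒timeAverage {f} {L} (boundedPrimitive G (C , G≼C) D) =
    (λ T _ → Φ T R.- Φ 0ℝ) , (λ T _ → Deriv⇒integral DΦ T) ,
    λ ε ε>0 → let e , e>0 , e≼ε = positive-below ε>0
                  q , _ , 2C≼q = ∣x∣≼rational (C + C)
                  N , q≤Ne = archimedean q e>0
      -- As C + C ≤ q ≤ N e, every T ≥ N satisfies C + C ≤ T e.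
      in fromℚ (ι N) , λ T T>0 T₀≤T →
        ≼⇒≤ {R.∣ R.inverse T T>0 R.* (Φ T R.- Φ 0ℝ) R.- L ∣} {ε}
        (unseal (λ _ _*_ _-_ _ ∣_∣ → ∣ (R.inverse T T>0 * (Φ T - Φ 0ℝ)) - L ∣ ≼ ε) (≼-trans
          (mean-value-bound {G} {C} {L} G≼C T T>0 (≼-trans (≼-trans (x≼∣x∣ (C + C)) 2C≼q)
            (≼-trans (fromℚ-mono q≤Ne) (≼-trans (≃⇒≼ (fromℚ-* (ι N) e))
              (*-monoʳ-≼ (fromℚ-mono (ℚ.<⇒≤ e>0)) (wrap T₀≤T))))))
          e≼ε))
    where
    Φ : ℝ → ℝ
    Φ t = t * L + G t
    DΦ : Deriv Φ f
    DΦ = Deriv-resp (λ t → solve 2 (λ l x → l :+ (x :- l) := x) ≃-refl L (f t))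
      (Deriv-+ (Deriv-id L) D)

open TimeAverages

-- Reading real inequalities off rational approximations

module Approximations where

  opaque
    unfolding _+_

    seq-+ : ∀ x y n → seq (x + y) n ≡ seq x n ℚ.+ seq y n
    seq-+ x y n = refl

    seq-* : ∀ x y n → seq (x * y) n ≡ seq x n ℚ.* seq y n
    seq-* x y n = refl

    seq-neg : ∀ x n → seq (- x) n ≡ ℚ.- seq x n
    seq-neg x n = refl

    seq-∣∣ : ∀ x n → seq ∣ x ∣ n ≡ ℚ.∣ seq x n ∣
    seq-∣∣ x n = refl

  seq-- : ∀ x y n → seq (x - y) n ≡ seq x n ℚ.- seq y n
  seq-- x y n = trans (seq-+ x (- y) n) (cong (seq x n ℚ.+_) (seq-neg y n))

  eventually-below : ∀ {t q} → ∣ t ∣ ≼ fromℚ q → Eventually λ n → ℚ.∣ seq t n ∣ ℚ.≤ q ℚ.+ 1ℚ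
  eventually-below {t} {q} (wrap h) = map₁ (λ n → subst (ℚ._≤ q ℚ.+ 1ℚ) (seq-∣∣ t n))
    (h 1ℚ (ℚ.positive⁻¹ 1ℚ))

  -- The added 1 absorbs the ε with which ∣ t ∣ ≼ B holds termwise.
  radius : ℝ → ℚ
  radius B = proj₁ (∣x∣≼rational B) ℚ.+ 1ℚ

  radius-nonNeg : ∀ B → 0ℚ ℚ.≤ radius B
  radius-nonNeg B = ℚ.+-mono-≤ (ℚ.<⇒≤ (proj₁ (proj₂ (∣x∣≼rational B)))) 0≤1

  within-radius : ∀ {B t} → ∣ t ∣ ≼ B → Eventually λ n → ℚ.∣ seq t n ∣ ℚ.≤ radius B
  within-radius {B} {t} h = eventually-below {t}
      (≼-trans h (≼-trans (x≼∣x∣ B) (proj₂ (proj₂ (∣x∣≼rational B)))))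

  eventually-≼ : ∀ {x y} → Eventually (λ n → seq x n ℚ.≤ seq y n) → x ≼ y
  eventually-≼ {x} {y} (N , h) = wrap λ ε ε>0 → N , λ n N≤n → ℚ.≤-trans (h n N≤n)
    (p≤p+q (ℚ.<⇒≤ ε>0))

  zero-limit : (x : ℕ → ℝ) → (∀ N i → seq (x N) i ≡ 0ℚ) → x R.⟶ 0ℝ
  zero-limit x x≡0 ε ε>0 = 0 , λ N _ → let e , e>0 , e≼ε = positive-below ε>0 in
    ≼⇒≤ {R.∣ x N R.- 0ℝ ∣} {ε} (unseal (λ _ _ _-_ _ ∣_∣ → ∣ x N - 0ℝ ∣ ≼ ε)
      (≼-trans (≃⇒≼ (≃-trans (∣∣-cong (≃-trans (+-cong (pointwise {x N} {0ℝ} (x≡0 N)) ≃-refl)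
        (Solver.solve 0 (Solver.con 0ℚ Solver.:- Solver.con 0ℚ Solver.:= Solver.con 0ℚ) ≃-refl)))
        (∣x∣≃x ≼-refl))) (≼-trans (fromℚ-mono (ℚ.<⇒≤ e>0)) e≼ε)))

open Approximations

-- The flow at real times

module Flow {I : Set} (next prev : I → I) (a₀ : I → ℚ) (∣a₀∣≤1 : ∀ j → ℚ.∣ a₀ j ∣ ℚ.≤ 1ℚ) where
  open PartialSums next prev a₀ ∣a₀∣≤1
  private module S = +-*-Solver
  open ℚ.≤-Reasoning

  module _ (t : ℝ) where
    private
      b = proj₁ (R.bounded (seq t) (isCauchy t))
      0≤b : 0ℚ ℚ.≤ b
      0≤b = ℚ.<⇒≤ (proj₁ (proj₂ (R.bounded (seq t) (isCauchy t))))
      N₁ = proj₁ (proj₂ (proj₂ (R.bounded (seq t) (isCauchy t))))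
      ∣t∣≤b : ∀ n → N₁ ℕ.≤ n → ℚ.∣ seq t n ∣ ℚ.≤ b
      ∣t∣≤b = proj₂ (proj₂ (proj₂ (R.bounded (seq t) (isCauchy t))))
    open OnInterval b 0≤b

    -- Number of terms and argument vary together. The argument is changed first, at a Lipschitz
    -- cost independent of the number of terms, and then the number of terms at a fixed argument.
    diagonal-cauchy : ∀ j → R.Cauchy (λ n → P n j (seq t n))
    diagonal-cauchy j ε ε>0 = N₁ ℕ.⊔ (N₂ ℕ.⊔ N₃) , λ m n hm hn →
      let x = seq t m ; y = seq t n
          m≥N₁ = ℕ.≤-trans (ℕ.m≤m⊔n N₁ _) hm ; n≥N₁ = ℕ.≤-trans (ℕ.m≤m⊔n N₁ _) hn
          m≥ = ℕ.≤-trans (ℕ.m≤n⊔m N₁ _) hm ; n≥ = ℕ.≤-trans (ℕ.m≤n⊔m N₁ _) hn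
      in begin
        ℚ.∣ P m j x ℚ.- P n j y ∣
          ≡⟨ cong ℚ.∣_∣ (S.solve 3 (λ a b c → a S.:- c S.:= (a S.:- b) S.:+ (b S.:- c)) refl
               (P m j x) (P m j y) (P n j y)) ⟩
        ℚ.∣ (P m j x ℚ.- P m j y) ℚ.+ (P m j y ℚ.- P n j y) ∣
          ≤⟨ ∣p+q∣≤ {P m j x ℚ.- P m j y} {P m j y ℚ.- P n j y}
               (P-lipschitz m j (∣t∣≤b m m≥N₁) (∣t∣≤b n n≥N₁))
               (P-close m n (ℕ.≤-trans (ℕ.m≤m⊔n N₂ N₃) m≥) (ℕ.≤-trans (ℕ.m≤m⊔n N₂ N₃) n≥) j
                 (∣t∣≤b n n≥N₁)) ⟩
        L ℚ.* ℚ.∣ x ℚ.- y ∣ ℚ.+ δ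
          ≤⟨ ℚ.+-monoˡ-≤ δ (ℚ.≤-trans (ℚ.*-monoˡ-≤-nonNeg L {{ℚ.nonNegative 0≤L}}
               (t-close m n (ℕ.≤-trans (ℕ.m≤n⊔m N₂ N₃) m≥) (ℕ.≤-trans (ℕ.m≤n⊔m N₂ N₃) n≥))) Lη≤δ)
                 ⟩
        δ ℚ.+ δ ≤⟨ proj₂ (proj₂ (halve ε>0)) ⟩
        ε ∎
      where
      δ = proj₁ (halve ε>0)
      δ>0 = proj₁ (proj₂ (halve ε>0))
      η = proj₁ (shrink L δ>0)
      η>0 = proj₁ (proj₂ (shrink L δ>0))
      Lη≤δ = proj₂ (proj₂ (shrink L δ>0))
      N₂ = proj₁ (P-cauchy δ>0)
      P-close = proj₂ (P-cauchy δ>0)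
      N₃ = proj₁ (isCauchy t η η>0)
      t-close = proj₂ (isCauchy t η η>0)

  opaque
    -- The coordinate j of e^{tB} a₀, taken along the diagonal so that each of its approximations is
    -- the value of a rational polynomial.
    u : I → ℝ → ℝ
    u j t = mkℝ (λ n → P n j (seq t n)) (diagonal-cauchy t j)

    seq-u : ∀ j t n → seq (u j t) n ≡ P n j (seq t n)
    seq-u j t n = refl

  u-locallyBounded : ∀ j → LocallyBounded (u j)
  u-locallyBounded j B = fromℚ M , λ t ht → eventually-≼ {∣ u j t ∣} {fromℚ M} (map₁ (λ n h →
      subst (ℚ._≤ M) (sym (trans (seq-∣∣ (u j t) n) (cong ℚ.∣_∣ (seq-u j t n)))) (∣P∣≤M n j h))
      (within-radius {B} {t} ht))
    where open OnInterval (radius B) (radius-nonNeg B)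

  velocity : I → ℝ → ℝ
  velocity j t = u (prev j) t - u (next j) t

  velocity-locallyBounded : ∀ j → LocallyBounded (velocity j)
  velocity-locallyBounded j B =
    let M , h = u-locallyBounded (prev j) B ; M′ , h′ = u-locallyBounded (next j) B in
    M + M′ , λ t ht → ∣-∣≼ (h t ht) (h′ t ht)

  u-deriv : ∀ j → Deriv (u j) (velocity j)
  u-deriv j = deriv λ B → let open OnInterval (radius B) (radius-nonNeg B) in
    fromℚ (4ℚ ℚ.* M) , λ s t hs ht → wrap λ ε ε>0 →
        let δ , δ>0 , δ+δ≤ε = halve ε>0 ; N , close = P-cauchy δ>0 in
      map₂ (λ { n (p , q) N≤n → subst₂ (λ x y → x ℚ.≤ y ℚ.+ ε) (sym (seq-error s t n))
        (sym (seq-bound (4ℚ ℚ.* M) s t n))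
        (ℚ.≤-trans (perturbed-taylor B n q p
          (close n (suc n) N≤n (ℕ.m≤n⇒m≤1+n N≤n) j q) (close n (suc n) N≤n (ℕ.m≤n⇒m≤1+n N≤n) j p))
          (ℚ.+-monoʳ-≤ (4ℚ ℚ.* M ℚ.* ((seq t n ℚ.- seq s n) ℚ.* (seq t n ℚ.- seq s n))) δ+δ≤ε)) })
        (map₂ (λ n → _,_) (within-radius {B} {s} hs) (within-radius {B} {t} ht))
          (N , λ _ N≤n → N≤n)
    where
    seq-error : ∀ s t n → seq ∣ u j t - u j s - (t - s) * velocity j s ∣ n ≡
      ℚ.∣ P n j (seq t n) ℚ.- P n j (seq s n) ℚ.-
          (seq t n ℚ.- seq s n) ℚ.* (P n (prev j) (seq s n) ℚ.- P n (next j) (seq s n)) ∣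
    seq-error s t n = trans (seq-∣∣ (u j t - u j s - (t - s) * velocity j s) n) (cong ℚ.∣_∣
      (trans (seq-- (u j t - u j s) ((t - s) * velocity j s) n) (cong₂ ℚ._-_
        (trans (seq-- (u j t) (u j s) n) (cong₂ ℚ._-_ (seq-u j t n) (seq-u j s n)))
        (trans (seq-* (t - s) (velocity j s) n) (cong₂ ℚ._*_ (seq-- t s n)
          (trans (seq-- (u (prev j) s) (u (next j) s) n)
            (cong₂ ℚ._-_ (seq-u (prev j) s n) (seq-u (next j) s n))))))))

    seq-bound : ∀ k s t n → seq (fromℚ k * ((t - s) * (t - s))) n ≡
      k ℚ.* ((seq t n ℚ.- seq s n) ℚ.* (seq t n ℚ.- seq s n))
    seq-bound k s t n = trans (seq-* (fromℚ k) ((t - s) * (t - s)) n) (cong (k ℚ.*_)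
      (trans (seq-* (t - s) (t - s) n) (cong₂ ℚ._*_ (seq-- t s n) (seq-- t s n))))

    -- On the diagonal values and derivative carry the same index n, whereas `taylor-error n` takes
    -- the values from `P (suc n)`. Exchanging the two values costs δ each.
    perturbed-taylor : ∀ B n {q r δ} → let open OnInterval (radius B) (radius-nonNeg B) in
      ℚ.∣ q ∣ ℚ.≤ radius B → ℚ.∣ r ∣ ℚ.≤ radius B →
      ℚ.∣ P n j q ℚ.- P (suc n) j q ∣ ℚ.≤ δ → ℚ.∣ P n j r ℚ.- P (suc n) j r ∣ ℚ.≤ δ →
      ℚ.∣ P n j q ℚ.- P n j r ℚ.- (q ℚ.- r) ℚ.* (P n (prev j) r ℚ.- P n (next j) r) ∣
        ℚ.≤ 4ℚ ℚ.* M ℚ.* ((q ℚ.- r) ℚ.* (q ℚ.- r)) ℚ.+ (δ ℚ.+ δ)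
    perturbed-taylor B n {q} {r} {δ} hq hr p p′ =
        let open OnInterval (radius B) (radius-nonNeg B) in begin
      ℚ.∣ P n j q ℚ.- P n j r ℚ.- v ∣
        ≡⟨ cong ℚ.∣_∣ (S.solve 5 (λ a b a′ b′ v → a S.:- b S.:- v
             S.:= (a′ S.:- b′ S.:- v) S.:+ ((a S.:- a′) S.:- (b S.:- b′))) refl
             (P n j q) (P n j r) (P (suc n) j q) (P (suc n) j r) v) ⟩
      ℚ.∣ taylor-error n j q r ℚ.+ ((P n j q ℚ.- P (suc n) j q) ℚ.- (P n j r ℚ.- P (suc n) j r)) ∣
        ≤⟨ ∣p+q∣≤ {taylor-error n j q r} {(P n j q ℚ.- P (suc n) j q) ℚ.-
          (P n j r ℚ.- P (suc n) j r)}
             (∣taylor-error∣≤ n j hq hr)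
             (∣p-q∣≤ {P n j q ℚ.- P (suc n) j q} {P n j r ℚ.- P (suc n) j r} p p′) ⟩
      4ℚ ℚ.* M ℚ.* ((q ℚ.- r) ℚ.* (q ℚ.- r)) ℚ.+ (δ ℚ.+ δ) ∎
      where v = (q ℚ.- r) ℚ.* (P n (prev j) r ℚ.- P n (next j) r)

  u-initial : ∀ j → u j 0ℝ ≃ fromℚ (a₀ j)
  -- Index 0 is left out, where the partial sum is empty and equal to 0.
  u-initial j = wrap λ ε ε>0 → 1 , λ { (suc n) _ →
    subst (ℚ._≤ ε) (sym (trans (cong (λ x → ℚ.∣ x ℚ.- a₀ j ∣)
      (trans (seq-u j 0ℝ (suc n)) (P-0 n)))
      (cong ℚ.∣_∣ (ℚ.+-inverseʳ (a₀ j))))) (ℚ.<⇒≤ ε>0) }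
    where
    e-0 : ∀ m → e (suc m) 0ℚ ≡ 0ℚ
    e-0 m = trans (e-def (suc m) 0ℚ) (trans (cong (1/ suc m ! ℚ.*_) (ℚ.*-zeroˡ (0ℚ ^ m)))
        (ℚ.*-zeroʳ (1/ suc m !)))
    P-0 : ∀ n → P (suc n) j 0ℚ ≡ a₀ j
    P-0 zero = trans (ℚ.+-identityˡ (a₀ j ℚ.* e 0 0ℚ))
        (trans (cong (a₀ j ℚ.*_) (e-zero 0ℚ)) (ℚ.*-identityʳ (a₀ j)))
    P-0 (suc n) = trans (cong₂ ℚ._+_ (P-0 n)
        (trans (cong (coeff (suc n) j ℚ.*_) (e-0 n)) (ℚ.*-zeroʳ (coeff (suc n) j))))
      (ℚ.+-identityʳ (a₀ j))

  -- In the n-th approximation the m-th partial sum and `u j t` are `P m j` and `P n j` at one and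
  -- the same rational, so `P-cauchy` applies, uniformly over the bounded range of `t`.
  partialSums-converge : ∀ j t {L} → L ≡ u j t → (X : ℕ → ℝ) →
    (∀ N n → seq (X N) n ≡ P N j (seq t n)) → X R.⟶ L
  partialSums-converge j t refl X seq-X ε ε>0 =
    let e , e>0 , e≼ε = positive-below ε>0
        b , b>0 , N₁ , ∣t∣≤b = R.bounded (seq t) (isCauchy t)
        open OnInterval b (ℚ.<⇒≤ b>0)
        N , close = P-cauchy e>0
    in N , λ m N≤m → ≼⇒≤ {R.∣ X m R.- u j t ∣} {ε}
      (unseal (λ _ _ _-_ _ ∣_∣ → ∣ X m - u j t ∣ ≼ ε) (≼-trans
        (eventually-≼ {∣ X m - u j t ∣} {fromℚ e} (N ℕ.⊔ N₁ , λ n h → subst (ℚ._≤ e)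
          (sym (trans (seq-∣∣ (X m - u j t) n) (cong ℚ.∣_∣ (trans (seq-- (X m) (u j t) n)
            (cong₂ ℚ._-_ (seq-X m n) (seq-u j t n))))))
          (close m n N≤m (ℕ.≤-trans (ℕ.m≤m⊔n N N₁) h) j (∣t∣≤b n (ℕ.≤-trans (ℕ.m≤n⊔m N N₁) h)))))
        e≼ε))

-- Indices modulo n and finite sums

odd⇒1+h+h : ∀ n → ¬ (2 ∣ n) → ∃[ h ] n ≡ suc (h ℕ.+ h)
odd⇒1+h+h n 2∤n with n % 2 in eq | m≡m%n+[m/n]*n n 2 | m%n<n n 2
... | 0           | _  | _ = contradiction (m%n≡0⇒n∣m n 2 eq) 2∤n
... | 1           | n≡ | _ = n / 2 , trans n≡ (cong suc (trans (ℕ.*-comm (n / 2) 2)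
  (cong (n / 2 ℕ.+_) (ℕ.+-identityʳ (n / 2)))))
... | suc (suc _) | _  | ℕ.s≤s (ℕ.s≤s ())

toℕ-mod : ∀ k n .{{_ : ℕ.NonZero n}} → toℕ (k mod n) ≡ k % n
toℕ-mod k n = Fin.toℕ-fromℕ< (m%n<n k n)

module CyclicIndices (n : ℕ) .{{_ : ℕ.NonZero n}} where

  next : Fin n → Fin n
  next = R.next

  next^ : ℕ → Fin n → Fin n
  next^ i j = fold j next i

  -- As a power of `next` it commutes with `next`, and both inverse laws follow from `next^-n`.
  prev : Fin n → Fin n
  prev = next^ (ℕ.pred n)

  next^-+ : ∀ i k j → next^ (i ℕ.+ k) j ≡ next^ i (next^ k j)
  next^-+ i k j = fold-+ j next i

  next^-comm : ∀ i k j → next^ i (next^ k j) ≡ next^ k (next^ i j)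
  next^-comm i k j = trans (sym (next^-+ i k j))
      (trans (cong (λ l → next^ l j) (ℕ.+-comm i k)) (next^-+ k i j))

  suc-% : ∀ k → suc (k % n) % n ≡ suc k % n
  suc-% k = trans (%-distribˡ-+ 1 (k % n) n)
    (trans (cong (λ l → (1 % n ℕ.+ l) % n) (m%n%n≡m%n k n)) (sym (%-distribˡ-+ 1 k n)))

  toℕ-next^ : ∀ i j → toℕ (next^ i j) ≡ (i ℕ.+ toℕ j) % n
  toℕ-next^ zero    j = sym (m<n⇒m%n≡m (Fin.toℕ<n j))
  toℕ-next^ (suc i) j = trans (toℕ-mod (suc (toℕ (next^ i j))) n {{Fin.nonZeroIndex (next^ i j)}})
    (trans (cong (λ l → suc l % n) (toℕ-next^ i j)) (suc-% (i ℕ.+ toℕ j)))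

  next^-n : ∀ j → next^ n j ≡ j
  next^-n j = Fin.toℕ-injective (trans (toℕ-next^ n j)
    (trans (cong (_% n) (ℕ.+-comm n (toℕ j)))
      (trans ([m+n]%n≡m%n (toℕ j) n) (m<n⇒m%n≡m (Fin.toℕ<n j)))))

  next-prev : ∀ j → next (prev j) ≡ j
  next-prev j = trans (cong (λ i → next^ i j) (ℕ.suc-pred n)) (next^-n j)

  prev-next : ∀ j → prev (next j) ≡ j
  prev-next j = trans (next^-comm (ℕ.pred n) 1 j) (next-prev j)

  prev^ : ℕ → Fin n → Fin n
  prev^ i j = fold j prev i

  prev^-next^ : ∀ i j → prev^ i (next^ i j) ≡ j
  prev^-next^ zero    j = refl
  prev^-next^ (suc i) j = trans (prev^-comm i (next (next^ i j)))
    (trans (cong (prev^ i) (prev-next (next^ i j))) (prev^-next^ i j))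
    where
    prev^-comm : ∀ i j → prev (prev^ i j) ≡ prev^ i (prev j)
    prev^-comm zero    j = refl
    prev^-comm (suc i) j = cong prev (prev^-comm i j)

  -- The two positions are 2h+1 = n steps apart: here the odd length enters.
  opposite : ∀ {h} → n ≡ suc (h ℕ.+ h) → ∀ j → next^ (suc h) j ≡ prev^ h j
  opposite {h} n≡ j = trans (sym (prev^-next^ h (next^ (suc h) j))) (cong (prev^ h)
    (trans (sym (next^-+ h (suc h) j)) (trans
      (cong (λ i → next^ i j) (trans (ℕ.+-suc h h) (sym n≡))) (next^-n j))))

  -- From `b` the index `a` is reached in a + (n - b) steps, a count in which no subtraction is
  -- truncated.
  cyclic-induction : ∀ {ℓ} (P : Fin n → Set ℓ) b → P b → (∀ a → P a → P (next a)) → ∀ a → P a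
  cyclic-induction P b Pb step a = subst P (Fin.toℕ-injective reached)
      (go (toℕ a ℕ.+ (n ℕ.∸ toℕ b)))
    where
    go : ∀ i → P (next^ i b)
    go zero    = Pb
    go (suc i) = step (next^ i b) (go i)
    reached : toℕ (next^ (toℕ a ℕ.+ (n ℕ.∸ toℕ b)) b) ≡ toℕ a
    reached = trans (toℕ-next^ (toℕ a ℕ.+ (n ℕ.∸ toℕ b)) b)
      (trans (cong (_% n) (trans (ℕ.+-assoc (toℕ a) (n ℕ.∸ toℕ b) (toℕ b))
        (cong (toℕ a ℕ.+_) (ℕ.m∸n+n≡m (ℕ.<⇒≤ (Fin.toℕ<n b))))))
      (trans ([m+n]%n≡m%n (toℕ a) n) (m<n⇒m%n≡m (Fin.toℕ<n a))))

  -- Otherwise j + 2 ≡ j modulo n, so that n divides 2.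
  next≢prev : 3 ℕ.≤ n → ∀ j → ¬ (next j ≡ prev j)
  next≢prev 3≤n j eq = ℕ.<⇒≱ 3≤n (∣⇒≤ (divides ((2 ℕ.+ toℕ j) / n) 2≡))
    where
    x = toℕ j
    x≡ : (2 ℕ.+ x) % n ≡ x
    x≡ = trans (sym (toℕ-next^ 2 j)) (cong toℕ (trans (cong next eq) (next-prev j)))
    2≡ : 2 ≡ (2 ℕ.+ x) / n ℕ.* n
    2≡ = ℕ.+-cancelˡ-≡ x 2 _ (trans (ℕ.+-comm x 2) (trans (m≡m%n+[m/n]*n (2 ℕ.+ x) n)
      (cong (ℕ._+ (2 ℕ.+ x) / n ℕ.* n) x≡)))

  module _ {c ℓ : Level} (M : CommutativeMonoid c ℓ) where
    open CommutativeMonoid M using (Carrier; _≈_)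
    open Sum M using (sum-permute) renaming (sum to ∑)

    sum-prev : ∀ (f : Fin n → Carrier) → ∑ f ≈ ∑ (f ∘ prev)
    sum-prev f = sum-permute f (permutation prev next prev-next next-prev)

module _ {c ℓ : Level} (M : CommutativeMonoid c ℓ) where
  open CommutativeMonoid M using (Carrier; _≈_; ε; identityˡ; identityʳ; ∙-congˡ) renaming
    (trans to ≈-trans)
  open Sum M using (sum-replicate-zero) renaming (sum to ∑)

  sum-δ : ∀ {n} (k : Fin n) (x : Fin n → Carrier) →
      ∑ (λ j → if does (j Fin.≟ k) then x j else ε) ≈ x k
  sum-δ {suc n} zero    x = ≈-trans (∙-congˡ (sum-replicate-zero n)) (identityʳ (x zero))
  sum-δ {suc n} (suc k) x = ≈-trans (identityˡ _) (sum-δ k (x ∘ suc))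

-- Stated for arbitrary types, so that no rational arithmetic is unfolded.
foldr-related : ∀ {A B : Set} {f : A → A → A} {x} {g : B → B → B} {y} (T : A → B → Set) → T x y →
  (∀ {a a′ b b′} → T a b → T a′ b′ → T (f a a′) (g b b′)) →
  ∀ {n} (as : Fin n → A) (bs : Fin n → B) → (∀ k → T (as k) (bs k)) → T (foldr f x as)
    (foldr g y bs)
foldr-related T base step {zero}  as bs h = base
foldr-related T base step {suc n} as bs h = step (h zero)
    (foldr-related T base step (as ∘ suc) (bs ∘ suc) (h ∘ suc))

-- Complex arithmetic on a single rational approximation

module PointwiseComplex (i : ℕ) where
  open R using (ℂ; re; im; _*ᶜ_; -ᶜ_; 𝐢; fromℝ; sumᶜ)
  open Sum ℚ.+-0-commutativeMonoid using () renaming (sum to sumℚ)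
  private module S = +-*-Solver

  -- The i-th approximation of the complex number z is p + q 𝐢.
  record At (z : ℂ) (p q : ℚ) : Set where
    constructor at
    field
      re-at : seq (re z) i ≡ p
      im-at : seq (im z) i ≡ q

  At-* : ∀ {z w p q r s} → At z p q → At w r s →
      At (z *ᶜ w) (p ℚ.* r ℚ.- q ℚ.* s) (p ℚ.* s ℚ.+ q ℚ.* r)
  At-* (at refl refl) (at refl refl) = at refl refl

  At-neg : ∀ {z p q} → At z p q → At (-ᶜ z) (ℚ.- p) (ℚ.- q)
  At-neg (at refl refl) = at refl refl

  At-resp : ∀ {z p q r s} → p ≡ r → q ≡ s → At z p q → At z r s
  At-resp refl refl a = a

  At-𝐢 : At 𝐢 0ℚ 1ℚ
  At-𝐢 = at refl refl

  At-fromℝ : ∀ x → At (fromℝ x) (seq x i) 0ℚ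
  At-fromℝ x = at refl refl

  At-if : ∀ b {z w p p′ q q′} → At z p q → At w p′ q′ →
    At (if b then z else w) (if b then p else p′) (if b then q else q′)
  At-if true  a _ = a
  At-if false _ a = a

  At-+ : ∀ {z w p q r s} → At z p q → At w r s → At (z R.+ᶜ w) (p ℚ.+ r) (q ℚ.+ s)
  At-+ (at refl refl) (at refl refl) = at refl refl

  At-real-+ : ∀ {z w p r} → At z p 0ℚ → At w r 0ℚ → At (z R.+ᶜ w) (p ℚ.+ r) 0ℚ
  At-real-+ {z} {w} {p} {r} a b = At-resp {z R.+ᶜ w} {p ℚ.+ r} {0ℚ ℚ.+ 0ℚ} {p ℚ.+ r} {0ℚ}
    refl (ℚ.+-identityˡ 0ℚ) (At-+ {z} {w} a b)

  At-real-* : ∀ {z w p r} → At z p 0ℚ → At w r 0ℚ → At (z *ᶜ w) (p ℚ.* r) 0ℚ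
  At-real-* {z} {w} {p} {r} a b = At-resp {z *ᶜ w}
    {p ℚ.* r ℚ.- 0ℚ ℚ.* 0ℚ} {p ℚ.* 0ℚ ℚ.+ 0ℚ ℚ.* r} {p ℚ.* r} {0ℚ}
    (S.solve 2 (λ p r → p S.:* r S.:- S.con 0ℚ S.:* S.con 0ℚ S.:= p S.:* r) refl p r)
    (S.solve 2 (λ p r → p S.:* S.con 0ℚ S.:+ S.con 0ℚ S.:* r S.:= S.con 0ℚ) refl p r)
    (At-* {z} {w} {p} {0ℚ} {r} {0ℚ} a b)

  At-real-sum : ∀ {n} {z : Fin n → ℂ} {p : Fin n → ℚ} → (∀ k → At (z k) (p k) 0ℚ) →
    At (sumᶜ z) (sumℚ p) 0ℚ
  At-real-sum {n} {z} {p} = foldr-related {f = R._+ᶜ_} {g = ℚ._+_} (λ w r → At w r 0ℚ)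
      (at refl refl)
    (λ {w} {w′} {r} {r′} → At-real-+ {w} {w′} {r} {r′}) z p

module _ {c ℓ : Level} (M : CommutativeMonoid c ℓ) where
  open CommutativeMonoid M using (Carrier; _≈_; _∙_; ε; ∙-cong) renaming
    (refl to ≈-refl; trans to ≈-trans; reflexive to ≈-reflexive)
  open Sum M using (sum-init-last) renaming (sum to ∑; sum-cong-≋ to ∑-cong)

  partialSum : (ℕ → Carrier) → ℕ → Carrier
  partialSum f zero    = ε
  partialSum f (suc N) = partialSum f N ∙ f N

  -- `sum` splits off its first index, whereas the series `P` grows at the end.
  sum-toℕ : ∀ f N → ∑ {N} (λ k → f (toℕ k)) ≈ partialSum f N
  sum-toℕ f zero    = ≈-refl
  sum-toℕ f (suc N) = ≈-trans (sum-init-last (λ k → f (toℕ k))) (∙-cong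
    (≈-trans (∑-cong {N} {λ k → f (toℕ (inject₁ k))} {λ k → f (toℕ k)}
      (λ k → ≈-reflexive (cong f (Fin.toℕ-inject₁ k)))) (sum-toℕ f N))
    (≈-reflexive (cong f (Fin.toℕ-fromℕ N))))

-- The matrix exponential of the oriented cycle is the flow

module CycleExponential {n : ℕ} (prev : Fin n → Fin n)
  (next-prev : ∀ j → R.next (prev j) ≡ j) (prev-next : ∀ j → prev (R.next j) ≡ j)
  (next≢prev : ∀ j → ¬ (R.next j ≡ prev j)) where
  open R using (re; im; _*ᶜ_; -ᶜ_; 𝐢; fromℝ; 0ᶜ; 1ᶜ; sumᶜ; _^ᴹ_; _•_; orientedCycle; next)
  open SemiringSum (CommutativeRing.semiring ℚ.+-*-commutativeRing) using () renaming
    (sum to sumℚ; sum-cong-≗ to sumℚ-cong; ∑-distrib-+ to sumℚ-distrib-+; *-distribˡ-sum to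
      sumℚ-*ˡ)
  private module S = +-*-Solver

  initial : Fin n → Fin n → ℚ
  initial k j = if does (j Fin.≟ k) then 1ℚ else 0ℚ

  ∣initial∣≤1 : ∀ k j → ℚ.∣ initial k j ∣ ℚ.≤ 1ℚ
  ∣initial∣≤1 k j = bound (does (j Fin.≟ k))
    where
    bound : ∀ b → ℚ.∣ if b then 1ℚ else 0ℚ ∣ ℚ.≤ 1ℚ
    bound true  = ℚ.≤-refl
    bound false = 0≤1

  module Column (k : Fin n) where
    open PartialSums next prev (initial k) (∣initial∣≤1 k) public using (coeff; P)
    open Flow next prev (initial k) (∣initial∣≤1 k) public

  -- The entries of - 𝐢 times the adjacency matrix, which are real.
  entry : Fin n → Fin n → ℚ
  entry j l = if does (l Fin.≟ next j) then ℚ.- 1ℚ else if does (j Fin.≟ next l) then 1ℚ else 0ℚ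

  -- Turns the nested conditional into two separate Kronecker deltas, which `sum-δ` evaluates. That
  -- they do not overlap is `next≢prev`.
  entry-* : ∀ j l q → entry j l ℚ.* q ≡
    (if does (l Fin.≟ prev j) then q else 0ℚ) ℚ.+ (if does (l Fin.≟ next j) then ℚ.- q else 0ℚ)
  entry-* j l q with l Fin.≟ next j
  ... | yes refl rewrite dec-false (next j Fin.≟ prev j) (next≢prev j) =
    S.solve 1 (λ q → S.con (ℚ.- 1ℚ) S.:* q S.:= S.con 0ℚ S.:+ S.:- q) refl q
  ... | no  _ with j Fin.≟ next l | l Fin.≟ prev j
  ...   | yes _    | yes _  = S.solve 1 (λ q → S.con 1ℚ S.:* q S.:= q S.:+ S.con 0ℚ) refl q
  ...   | no  _    | no  _  = S.solve 1 (λ q → S.con 0ℚ S.:* q S.:= S.con 0ℚ S.:+ S.con 0ℚ) refl q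
  ...   | yes refl | no ≢   = contradiction (sym (prev-next l)) ≢
  ...   | no ≢     | yes refl = contradiction (sym (next-prev j)) ≢

  sum-entry : ∀ j (f : Fin n → ℚ) → sumℚ (λ l → entry j l ℚ.* f l) ≡ f (prev j) ℚ.- f (next j)
  sum-entry j f = trans (sumℚ-cong (λ l → entry-* j l (f l)))
      (trans (sumℚ-distrib-+ at-prev at-next)
    (cong₂ ℚ._+_ (sum-δ ℚ.+-0-commutativeMonoid (prev j) f)
      (sum-δ ℚ.+-0-commutativeMonoid (next j) (λ l → ℚ.- f l))))
    where
    at-prev at-next : Fin n → ℚ
    at-prev l = if does (l Fin.≟ prev j) then f l else 0ℚ
    at-next l = if does (l Fin.≟ next j) then ℚ.- f l else 0ℚ

  module _ (t : ℝ) (i : ℕ) where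
    open PointwiseComplex i

    private
      τ : ℚ
      τ = seq t i

    scalar-at : At (-ᶜ (𝐢 *ᶜ fromℝ t)) 0ℚ (ℚ.- τ)
    scalar-at = At-resp { -ᶜ (𝐢 *ᶜ fromℝ t)}
      {ℚ.- (0ℚ ℚ.* τ ℚ.- 1ℚ ℚ.* 0ℚ)} {ℚ.- (0ℚ ℚ.* 0ℚ ℚ.+ 1ℚ ℚ.* τ)} {0ℚ} {ℚ.- τ}
      (S.solve 1 (λ τ → S.:- (S.con 0ℚ S.:* τ S.:- S.con 1ℚ S.:* S.con 0ℚ) S.:= S.con 0ℚ) refl τ)
      (S.solve 1 (λ τ → S.:- (S.con 0ℚ S.:* S.con 0ℚ S.:+ S.con 1ℚ S.:* τ) S.:= S.:- τ) refl τ)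
      (At-neg {𝐢 *ᶜ fromℝ t} (At-* {𝐢} {fromℝ t} At-𝐢 (At-fromℝ t)))

    adjacency-at : ∀ j l → At (orientedCycle n j l) 0ℚ (entry j l)
    adjacency-at j l = At-resp {orientedCycle n j l} {if b then ℚ.- 0ℚ else if b′ then 0ℚ else 0ℚ}
        {entry j l}
        {0ℚ} {entry j l} (all-zero b b′) refl
      (At-if b { -ᶜ 𝐢} {if b′ then 𝐢 else 0ᶜ} (At-neg {𝐢} At-𝐢)
        (At-if b′ {𝐢} {0ᶜ} At-𝐢 (At-fromℝ 0ℝ)))
      where
      b = does (l Fin.≟ next j)
      b′ = does (j Fin.≟ next l)
      all-zero : ∀ b b′ → (if b then ℚ.- 0ℚ else if b′ then 0ℚ else 0ℚ) ≡ 0ℚ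
      all-zero true  _     = refl
      all-zero false true  = refl
      all-zero false false = refl

    generator-at : ∀ j l → At (((-ᶜ (𝐢 *ᶜ fromℝ t)) • orientedCycle n) j l) (τ ℚ.* entry j l) 0ℚ
    generator-at j l = At-resp {(-ᶜ (𝐢 *ᶜ fromℝ t)) *ᶜ orientedCycle n j l}
      {0ℚ ℚ.* 0ℚ ℚ.- (ℚ.- τ) ℚ.* entry j l} {0ℚ ℚ.* entry j l ℚ.+ (ℚ.- τ) ℚ.* 0ℚ}
        {τ ℚ.* entry j l} {0ℚ}
      (S.solve 2 (λ τ s → S.con 0ℚ S.:* S.con 0ℚ S.:- (S.:- τ) S.:* s S.:= τ S.:* s) refl τ
          (entry j l))
      (S.solve 2 (λ τ s → S.con 0ℚ S.:* s S.:+ (S.:- τ) S.:* S.con 0ℚ S.:= S.con 0ℚ) refl τ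
          (entry j l))
      (At-* { -ᶜ (𝐢 *ᶜ fromℝ t)} {orientedCycle n j l} scalar-at (adjacency-at j l))

  module _ (k : Fin n) (i : ℕ) (τ : ℚ) (X : R.Matrix n)
    (X-at : ∀ j l → PointwiseComplex.At i (X j l) (τ ℚ.* entry j l) 0ℚ) where
    open Column k
    open PointwiseComplex i

    -- Column `k` of the m-th power is τ^m times the generator applied m times to the k-th unit
    -- vector, which is the origin of `coeff`.
    power-at : ∀ m j → At ((X ^ᴹ m) j k) (τ ^ m ℚ.* coeff m j) 0ℚ
    power-at zero j = At-resp {if b then 1ᶜ else 0ᶜ} {initial k j} {if b then 0ℚ else 0ℚ}
        {1ℚ ℚ.* initial k j} {0ℚ} (sym (ℚ.*-identityˡ (initial k j))) (all-zero b)
      (At-if b {1ᶜ} {0ᶜ} (At-fromℝ 1ℝ) (At-fromℝ 0ℝ))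
      where
      b = does (j Fin.≟ k)
      all-zero : ∀ b → (if b then 0ℚ else 0ℚ) ≡ 0ℚ
      all-zero true  = refl
      all-zero false = refl
    power-at (suc m) j = At-resp {sumᶜ λ l → X j l *ᶜ (X ^ᴹ m) l k} {sumℚ products} {0ℚ}
        {τ ^ suc m ℚ.* coeff (suc m) j} {0ℚ} sum-products refl
      (At-real-sum {n} {λ l → X j l *ᶜ (X ^ᴹ m) l k} {products}
        (λ l → At-real-* {X j l} {(X ^ᴹ m) l k} (X-at j l) (power-at m l)))
      where
      products : Fin n → ℚ
      products l = τ ℚ.* entry j l ℚ.* (τ ^ m ℚ.* coeff m l)
      sum-products : sumℚ products ≡ τ ^ suc m ℚ.* (coeff m (prev j) ℚ.- coeff m (next j))
      sum-products = trans
        (sumℚ-cong (λ l → S.solve 4 (λ τ s p a → τ S.:* s S.:* (p S.:* a) S.:= τ S.:* p S.:*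
            (s S.:* a)) refl
          τ (entry j l) (τ ^ m) (coeff m l)))
        (trans (sym (sumℚ-*ˡ (τ ^ suc m) (λ l → entry j l ℚ.* coeff m l)))
          (cong (τ ^ suc m ℚ.*_) (sum-entry j (coeff m))))

    term : Fin n → ℕ → ℚ
    term j m = 1/ m ! ℚ.* (τ ^ m ℚ.* coeff m j)

    partialSum-term : ∀ j N → partialSum ℚ.+-0-commutativeMonoid (term j) N ≡ P N j τ
    partialSum-term j zero    = refl
    partialSum-term j (suc N) = cong₂ ℚ._+_ (partialSum-term j N) (trans
      (S.solve 3 (λ f p a → f S.:* (p S.:* a) S.:= a S.:* (f S.:* p)) refl (1/ N !) (τ ^ N)
          (coeff N j))
      (cong (coeff N j ℚ.*_) (sym (e-def N τ))))

    exp-at : ∀ j N → At (R.expPartialSum X N j k) (P N j τ) 0ℚ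
    exp-at j N = At-resp {R.expPartialSum X N j k} {sumℚ {N} (λ m → term j (toℕ m))} {0ℚ}
        {P N j τ} {0ℚ}
      (trans (sum-toℕ ℚ.+-0-commutativeMonoid (term j) N) (partialSum-term j N)) refl
      (At-real-sum {N} {λ m → fromℝ (R.1/ toℕ m !) *ᶜ (X ^ᴹ toℕ m) j k} {λ m → term j (toℕ m)}
        (λ m → At-real-* {fromℝ (R.1/ toℕ m !)} {(X ^ᴹ toℕ m) j k}
          (At-fromℝ (R.1/ toℕ m !)) (power-at (toℕ m) j)))

  U : ℝ → R.Matrix n
  U t j k = fromℝ (Column.u k j t)

  isTransition : R.IsTransition (orientedCycle n) U
  isTransition t j k =
    Column.partialSums-converge k j t {re (U t j k)} refl
      (λ N → re (R.expPartialSum ((-ᶜ (𝐢 *ᶜ fromℝ t)) • orientedCycle n) N j k))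
      (λ N i → PointwiseComplex.At.re-at
        (exp-at k i (seq t i) ((-ᶜ (𝐢 *ᶜ fromℝ t)) • orientedCycle n) (generator-at t i) j N)) ,
    -- The imaginary parts vanish in every approximation, not merely in the limit.
    zero-limit (λ N → im (R.expPartialSum ((-ᶜ (𝐢 *ᶜ fromℝ t)) • orientedCycle n) N j k))
      (λ N i → PointwiseComplex.At.im-at
        (exp-at k i (seq t i) ((-ᶜ (𝐢 *ᶜ fromℝ t)) • orientedCycle n) (generator-at t i) j N))

-- Finite sums of reals and a bound for products

module RealSums where
  open Solver

  sum-- : ∀ {n} (f g : Fin n → ℝ) → sum (λ j → f j - g j) ≃ sum f - sum g
  sum-- {zero}  f g = solve 0 (con 0ℚ := con 0ℚ :- con 0ℚ) ≃-refl
  sum-- {suc n} f g = ≃-trans (+-cong ≃-refl (sum-- (f ∘ suc) (g ∘ suc)))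
    (solve 4 (λ a b c d → (a :- b) :+ (c :- d) := (a :+ c) :- (b :+ d)) ≃-refl
      (f zero) (g zero) (sum (f ∘ suc)) (sum (g ∘ suc)))

  sum-constant : ∀ n x → sum {n} (λ _ → x) ≃ fromℚ (ι n) * x
  sum-constant zero    x = solve 1 (λ x → con 0ℚ := con 0ℚ :* x) ≃-refl x
  sum-constant (suc n) x = ≃-trans (+-cong ≃-refl (sum-constant n x))
    (≃-trans (solve 2 (λ i x → x :+ i :* x := (con 1ℚ :+ i) :* x) ≃-refl (fromℚ (ι n)) x)
      (*-cong (≃-trans (≃-sym (fromℚ-+ 1ℚ (ι n))) (pointwise λ _ → sym (ι-suc n))) ≃-refl))

  sum-nonNeg : ∀ {n} {f : Fin n → ℝ} → (∀ j → 0ℝ ≼ f j) → 0ℝ ≼ sum f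
  sum-nonNeg {zero}  h = ≼-refl
  sum-nonNeg {suc n} h = +-nonNeg (h zero) (sum-nonNeg (h ∘ suc))

  term≼sum : ∀ {n} {f : Fin n → ℝ} → (∀ j → 0ℝ ≼ f j) → ∀ i → f i ≼ sum f
  term≼sum {suc n} {f} h zero    = ≼-resp (solve 1 (λ a → a :+ con 0ℚ := a) ≃-refl (f zero))
      ≃-refl
    (+-mono ≼-refl (sum-nonNeg (h ∘ suc)))
  term≼sum {suc n} {f} h (suc i) = ≼-resp (+-identityˡ (f (suc i))) ≃-refl
    (+-mono (h zero) (term≼sum (h ∘ suc) i))

  Deriv-sum : ∀ {n} {G g : Fin n → ℝ → ℝ} → (∀ k → Deriv (G k) (g k)) →
    Deriv (λ t → sum (λ k → G k t)) (λ t → sum (λ k → g k t))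
  Deriv-sum {zero}  D = Deriv-0
  Deriv-sum {suc n} D = Deriv-+ (D zero) (Deriv-sum (D ∘ suc))

  -- Each of x² + y² ∓ xy is half of (x ∓ y)² + x² + y², a sum of squares.
  ∣x*y∣≼x²+y² : ∀ x y → ∣ x * y ∣ ≼ x * x + y * y
  ∣x*y∣≼x²+y² x y = ∣x∣≼y
    (0≼y-x⇒x≼y (≼-resp ≃-refl
      (solve 2 (λ x y → con ½ :* ((x :- y) :* (x :- y) :+ (x :* x :+ y :* y)) := x :* x :+ y :* y
          :- x :* y) ≃-refl x y)
      (half-nonNeg (x*x-nonNeg (x - y)))))
    (0≼y-x⇒x≼y (≼-resp ≃-refl
      (solve 2 (λ x y → con ½ :* ((x :+ y) :* (x :+ y) :+ (x :* x :+ y :* y)) := x :* x :+ y :* y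
          :- :- (x :* y)) ≃-refl x y)
      (half-nonNeg (x*x-nonNeg (x + y)))))
    where
    half-nonNeg : ∀ {z} → 0ℝ ≼ z → 0ℝ ≼ fromℚ ½ * (z + (x * x + y * y))
    half-nonNeg 0≼z = *-nonNeg′ (fromℚ-mono (ℚ.nonNegative⁻¹ ½))
      (+-nonNeg 0≼z (+-nonNeg (x*x-nonNeg x) (x*x-nonNeg y)))

open RealSums

-- Conservation of energy and the descent on the odd cycle

module OddCycle (n h : ℕ) .{{_ : ℕ.NonZero n}} (n≡1+2h : n ≡ suc (h ℕ.+ h)) (3≤n : 3 ℕ.≤ n) where
  open CyclicIndices n
  open CycleExponential prev next-prev prev-next (next≢prev 3≤n)
  open Solver using (solve; _:+_; _:*_; _:-_; :-_; _:=_; con)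

  1/n : ℚ
  1/n = ℤ.+ 1 ℚ./ n

  module _ (k : Fin n) where
    open Column k

    product-velocity : Fin n → Fin n → ℝ → ℝ
    product-velocity i j t = velocity i t * u j t + u i t * velocity j t

    product-deriv : ∀ i j → Deriv (λ t → u i t * u j t) (product-velocity i j)
    product-deriv i j = Deriv-* (u-locallyBounded i) (velocity-locallyBounded i)
      (u-locallyBounded j) (velocity-locallyBounded j) (u-deriv i) (u-deriv j)

    energy : ℝ → ℝ
    energy t = sum (λ j → u j t * u j t)

    u-cong : ∀ {i j} t → i ≡ j → u i t ≃ u j t
    u-cong t refl = ≃-refl

    -- The derivative of u_j² is the flux 2 u_j u_{j+1} taken at j - 1 minus that at j, and these
    -- differences cancel around the cycle.
    energy-deriv : Deriv energy (λ _ → 0ℝ)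
    energy-deriv = Deriv-resp vanishes (Deriv-sum (λ j → product-deriv j j))
      where
      vanishes : ∀ t → sum (λ j → product-velocity j j t) ≃ 0ℝ
      vanishes t = ≃-trans (sum-cong-≋ {x = λ j → product-velocity j j t}
          {λ j → flux (prev j) - flux j} (λ j →
          ≃-trans (solve 3 (λ p q x → (p :- q) :* x :+ x :* (p :- q)
            := (p :* x :+ p :* x) :- (x :* q :+ x :* q)) ≃-refl (u (prev j) t) (u (next j) t)
              (u j t))
          (+-cong (+-cong (*-cong ≃-refl (u-cong t (sym (next-prev j))))
            (*-cong ≃-refl (u-cong t (sym (next-prev j))))) ≃-refl)))
        (≃-trans (sum-- (flux ∘ prev) flux)
        (≃-trans (+-cong (≃-sym (sum-prev (CommutativeRing.+-commutativeMonoid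
          +-*-commutativeRing) flux)) ≃-refl)
          (solve 1 (λ s → s :- s := con 0ℚ) ≃-refl (sum flux))))
        where
        flux : Fin n → ℝ
        flux j = u j t * u (next j) t + u j t * u (next j) t

    energy≃1 : ∀ t → energy t ≃ 1ℝ
    energy≃1 t = ≃-trans (Deriv-0⇒constant energy-deriv 0ℝ t)
      (≃-trans (sum-cong-≋ {x = λ j → u j 0ℝ * u j 0ℝ} {λ j → if does (j Fin.≟ k) then 1ℝ else 0ℝ}
          (λ j →
          ≃-trans (*-cong (u-initial j) (u-initial j)) (square (does (j Fin.≟ k)))))
        (sum-δ (CommutativeRing.+-commutativeMonoid +-*-commutativeRing) k (λ _ → 1ℝ)))
      where
      square : ∀ b → fromℚ (if b then 1ℚ else 0ℚ) * fromℚ (if b then 1ℚ else 0ℚ) ≃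
          (if b then 1ℝ else 0ℝ)
      square true  = *-identityˡ 1ℝ
      square false = solve 0 (con 0ℚ :* con 0ℚ := con 0ℚ) ≃-refl

    -- Each square is a term of the energy 1, which bounds every product by 2 at all times. All
    -- nontrivial bounded primitives of the proof are built from these.
    BP-product : ∀ i j → BoundedPrimitive (product-velocity i j)
    BP-product i j = boundedPrimitive (λ t → u i t * u j t)
      (1ℝ + 1ℝ , λ t → ≼-trans (∣x*y∣≼x²+y² (u i t) (u j t))
        (+-mono (square≼1 i t) (square≼1 j t)))
      (product-deriv i j)
      where
      square≼1 : ∀ i t → u i t * u i t ≼ 1ℝ
      square≼1 i t = ≼-trans (term≼sum {f = λ j → u j t * u j t} (λ j → x*x-nonNeg (u j t)) i)
          (≃⇒≼ (energy≃1 t))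

    -- u_{a+i} u_{a-i} - u_{a+i+1} u_{a-i+1}
    difference : Fin n → ℕ → ℝ → ℝ
    difference a i t = u (next^ i a) t * u (prev^ i a) t - u (next^ (suc i) a) t * u
        (next (prev^ i a)) t

    -- (u_{a+i+1} u_{a-i})′ is the sum of two consecutive differences.
    BP-consecutive : ∀ a i → BoundedPrimitive (λ t → difference a i t + difference a (suc i) t)
    BP-consecutive a i = BP-resp (λ t → ≃-trans
      (+-cong (*-cong (+-cong (u-cong t (prev-next (next^ i a))) ≃-refl) ≃-refl) ≃-refl)
      (≃-trans
        (solve 6 (λ v v₁ v₂ w w₁ w′ → (v :- v₂) :* w :+ v₁ :* (w₁ :- w′)
          := (v :* w :- v₁ :* w′) :+ (v₁ :* w₁ :- v₂ :* w)) ≃-refl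
          (u (next^ i a) t) (u (next^ (suc i) a) t) (u (next^ (suc (suc i)) a) t)
          (u (prev^ i a) t) (u (prev^ (suc i) a) t) (u (next (prev^ i a)) t))
        (+-cong ≃-refl (+-cong ≃-refl (-‿cong
          (*-cong ≃-refl (u-cong t (sym (next-prev (prev^ i a))))))))))
      (BP-product (next^ (suc i) a) (prev^ i a))

    -- As n = 2h + 1, the indices a + h + 1 and a - h agree, and the difference
    -- is half the derivative of u_{a-h}².
    BP-last : ∀ a → BoundedPrimitive (difference a h)
    BP-last a = BP-resp (λ t → ≃-trans
      (solve 3 (λ p q x → con ½ :* ((p :- q) :* x :+ x :* (p :- q)) := p :* x :- x :* q) ≃-refl
        (u (prev w) t) (u (next w) t) (u w t))
      (+-cong (*-cong (u-cong t prev-w) ≃-refl) (-‿cong (*-cong (u-cong t (sym meet)) ≃-refl))))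
      (BP-scale (fromℚ ½) (BP-product w w))
      where
      w = prev^ h a
      meet : next^ (suc h) a ≡ w
      meet = opposite {h} n≡1+2h a
      prev-w : prev w ≡ next^ h a
      prev-w = trans (cong prev (sym meet)) (prev-next (next^ h a))

    BP-descent : ∀ a i → BoundedPrimitive (difference a i) → BoundedPrimitive (difference a 0)
    BP-descent a zero    p = p
    BP-descent a (suc i) p = BP-descent a i (BP-resp
      (λ t → solve 2 (λ x y → (x :+ y) :- y := x) ≃-refl (difference a i t)
          (difference a (suc i) t))
      (BP-+ (BP-consecutive a i) (BP-neg p)))

    BP-squares : ∀ b a → BoundedPrimitive (λ t → u b t * u b t - u a t * u a t)
    BP-squares b = cyclic-induction (λ a → BoundedPrimitive (λ t → u b t * u b t - u a t * u a t))
        b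
      (BP-resp (λ t → solve 1 (λ x → con 0ℚ := x :- x) ≃-refl (u b t * u b t)) BP-0)
      (λ a p → BP-resp
        (λ t → solve 3 (λ x y z → (x :- y) :+ (y :- z) := x :- z) ≃-refl
          (u b t * u b t) (u a t * u a t) (u (next a) t * u (next a) t))
        -- `difference a 0` is u_a² - u_{a+1}² by computation.
        (BP-+ p (BP-descent a h (BP-last a))))

    -- The sum of u_b² - u_a² over a is n u_b² minus the energy, which is 1.
    BP-deviation : ∀ b → BoundedPrimitive (λ t → u b t * u b t - fromℚ 1/n)
    BP-deviation b = BP-resp deviation (BP-scale (fromℚ 1/n) (BP-sum (BP-squares b)))
      where
      deviation : ∀ t → fromℚ 1/n * sum (λ a → u b t * u b t - u a t * u a t) ≃ u b t * u b t -
          fromℚ 1/n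
      deviation t = let x = u b t * u b t in
        ≃-trans (*-cong ≃-refl (≃-trans (sum-- (λ _ → x) (λ a → u a t * u a t))
          (+-cong (sum-constant n x) (-‿cong (energy≃1 t)))))
        (≃-trans (solve 3 (λ i j x → i :* (j :* x :- con 1ℚ) := (i :* j) :* x :- i) ≃-refl
          (fromℚ 1/n) (fromℚ (ι n)) x)
          (+-cong (≃-trans (*-cong (≃-trans (≃-sym (fromℚ-* 1/n (ι n)))
            (pointwise λ _ → 1/-*-ι n)) ≃-refl)
            (*-identityˡ x)) ≃-refl))

-- Entries of the mixing matrix and of J/n

module ComplexProducts where
  open R using (re; im; _*ᶜ_; fromℝ; 1ᶜ; conj)
  open Solver using (solve; _:+_; _:*_; _:-_; :-_; _:=_; con)

  -- This and similar equations are proved once by `refl` and then applied with `subst`, which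
  -- limits how far the definitions unfold.
  re-* : ∀ z w → re (z *ᶜ w) ≡ re z R.* re w R.- im z R.* im w
  re-* z w = refl

  im-* : ∀ z w → im (z *ᶜ w) ≡ re z R.* im w R.+ im z R.* re w
  im-* z w = refl

  re-real-* : ∀ z w {x y} → re z ≃ x → im z ≃ 0ℝ → re w ≃ y → im w ≃ 0ℝ → re (z *ᶜ w) ≃ x * y
  re-real-* z w {x} {y} p p′ q q′ = subst (_≃ x * y) (sym (re-* z w))
    (unseal (λ _ mul sub _ _ → sub (mul (re z) (re w)) (mul (im z) (im w)) ≃ x * y)
      (≃-trans (+-cong (*-cong p q) (-‿cong (*-cong p′ q′)))
        (solve 2 (λ x y → x :* y :- con 0ℚ :* con 0ℚ := x :* y) ≃-refl x y)))

  im-real-* : ∀ z w {x y} → re z ≃ x → im z ≃ 0ℝ → re w ≃ y → im w ≃ 0ℝ → im (z *ᶜ w) ≃ 0ℝ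
  im-real-* z w {x} {y} p p′ q q′ = subst (_≃ 0ℝ) (sym (im-* z w))
    (unseal (λ add mul _ _ _ → add (mul (re z) (im w)) (mul (im z) (re w)) ≃ 0ℝ)
      (≃-trans (+-cong (*-cong p q′) (*-cong p′ q))
        (solve 2 (λ x y → x :* con 0ℚ :+ con 0ℚ :* y := con 0ℚ) ≃-refl x y)))

  im-conj : ∀ x → im (conj (fromℝ x)) ≃ 0ℝ
  im-conj x = pointwise λ _ → refl

  mixing≡ : ∀ {n} (U : ℝ → R.Matrix n) t j k → R.mixing U t j k ≡ U t j k *ᶜ R.conjᴹ (U t) j k
  mixing≡ U t j k = refl

  uniform≡ : ∀ {n} (j k : Fin n) {q} → q ≡ (ℤ.+ 1 ℚ./ n) {{Fin.nonZeroIndex j}} →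
    R.1/n•J j k ≡ fromℝ (fromℚ q) *ᶜ R.J {n} j k
  uniform≡ j k refl = refl

  ≡⇒≃ : ∀ {x y} → x ≡ y → x ≃ y
  ≡⇒≃ refl = ≃-refl

  conjᴹ≡ : ∀ {n} (A : R.Matrix n) j k → R.conjᴹ A j k ≡ conj (A j k)
  conjᴹ≡ A j k = refl

  module _ {n : ℕ} (U : ℝ → R.Matrix n) (t : ℝ) (j k : Fin n) {x : ℝ} (real : U t j k ≡ fromℝ x)
    where
    private
      conj-real : R.conjᴹ (U t) j k ≡ conj (fromℝ x)
      conj-real = trans (conjᴹ≡ (U t) j k) (cong conj real)

    re-mixing : re (R.mixing U t j k) ≃ x * x
    re-mixing = subst (λ z → re z ≃ x * x) (sym (mixing≡ U t j k))
      (re-real-* (U t j k) (R.conjᴹ (U t) j k) {x} {x} (≡⇒≃ (cong re real)) (≡⇒≃ (cong im real))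
        (≡⇒≃ (cong re conj-real)) (≃-trans (≡⇒≃ (cong im conj-real)) (im-conj x)))

    im-mixing : im (R.mixing U t j k) ≃ 0ℝ
    im-mixing = subst (λ z → im z ≃ 0ℝ) (sym (mixing≡ U t j k))
      (im-real-* (U t j k) (R.conjᴹ (U t) j k) {x} {x} (≡⇒≃ (cong re real)) (≡⇒≃ (cong im real))
        (≡⇒≃ (cong re conj-real)) (≃-trans (≡⇒≃ (cong im conj-real)) (im-conj x)))

  re-fromℚ-*-1 : ∀ q → re (fromℝ (fromℚ q) *ᶜ 1ᶜ) ≃ fromℚ q
  re-fromℚ-*-1 q = ≃-trans (re-real-* (fromℝ (fromℚ q)) 1ᶜ {fromℚ q} {1ℝ} ≃-refl ≃-refl ≃-refl
      ≃-refl)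
    (≃-trans (*-comm (fromℚ q) 1ℝ) (*-identityˡ (fromℚ q)))

  im-fromℚ-*-1 : ∀ q → im (fromℝ (fromℚ q) *ᶜ 1ᶜ) ≃ 0ℝ
  im-fromℚ-*-1 q = im-real-* (fromℝ (fromℚ q)) 1ᶜ {fromℚ q} {1ℝ} ≃-refl ≃-refl ≃-refl ≃-refl

  J≡ : ∀ {n} (j k : Fin n) → R.J j k ≡ 1ᶜ
  J≡ j k = refl

  module _ {n : ℕ} (j k : Fin n) {q : ℚ} (q≡ : q ≡ (ℤ.+ 1 ℚ./ n) {{Fin.nonZeroIndex j}}) where
    private
      uniform : R.1/n•J j k ≡ fromℝ (fromℚ q) *ᶜ 1ᶜ
      uniform = trans (uniform≡ j k q≡) (cong (fromℝ (fromℚ q) *ᶜ_) {R.J {n} j k} {1ᶜ} (J≡ j k))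

    re-uniform : re (R.1/n•J j k) ≃ fromℚ q
    re-uniform = subst (λ z → re z ≃ fromℚ q) (sym uniform) (re-fromℚ-*-1 q)

    im-uniform : im (R.1/n•J j k) ≃ 0ℝ
    im-uniform = subst (λ z → im z ≃ 0ℝ) (sym uniform) (im-fromℚ-*-1 q)

open ComplexProducts

-- From bounded primitives of the deviations to uniform mixing

module UniformMixing {n : ℕ} {A : R.Matrix n} (U : ℝ → R.Matrix n)
  (transition : R.IsTransition A U)
  (u : Fin n → Fin n → ℝ → ℝ) (real : ∀ t j k → U t j k ≡ R.fromℝ (u k j t))
  (q : ℚ) (q≡ : ∀ j → q ≡ (ℤ.+ 1 ℚ./ n) {{Fin.nonZeroIndex j}})
  (deviation : ∀ j k → BoundedPrimitive (λ t → u k j t * u k j t - fromℚ q)) where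
  open R using (re; im; mixing)

  module _ (j k : Fin n) where

    re-deviation : ∀ t → u k j t * u k j t - fromℚ q ≃ re (mixing U t j k) - re (R.1/n•J j k)
    re-deviation t = +-cong {u k j t * u k j t} {re (mixing U t j k)} { - fromℚ q}
        { - re (R.1/n•J j k)}
      (≃-sym (re-mixing U t j k (real t j k))) (-‿cong (≃-sym (re-uniform j k (q≡ j))))

    im-deviation : ∀ t → 0ℝ ≃ im (mixing U t j k) - im (R.1/n•J j k)
    im-deviation t = ≃-trans (Solver.solve 0
        (Solver.con 0ℚ Solver.:= Solver.con 0ℚ Solver.:- Solver.con 0ℚ) ≃-refl)
      (+-cong {0ℝ} {im (mixing U t j k)} { - 0ℝ} { - im (R.1/n•J j k)}
        (≃-sym (im-mixing U t j k (real t j k))) (-‿cong (≃-sym (im-uniform j k (q≡ j)))))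

    re-average : R.IsTimeAverage (λ t → re (mixing U t j k)) (re (R.1/n•J j k))
    re-average = BP⇒timeAverage {λ t → re (mixing U t j k)} {re (R.1/n•J j k)}
      (BP-resp {λ t → u k j t * u k j t - fromℚ q} {λ t → re (mixing U t j k) - re (R.1/n•J j k)}
        re-deviation (deviation j k))

    im-average : R.IsTimeAverage (λ t → im (mixing U t j k)) (im (R.1/n•J j k))
    im-average = BP⇒timeAverage {λ t → im (mixing U t j k)} {im (R.1/n•J j k)}
      (BP-resp {λ _ → 0ℝ} {λ t → im (mixing U t j k) - im (R.1/n•J j k)} im-deviation BP-0)

  averageUniformMixing : AverageUniformMixing A
  averageUniformMixing = U , transition , λ j k → re-average j k , im-average j k

open import Data.Nat using (_≤_)

corollary5 : (n : ℕ) → 3 ≤ n → ¬ (2 ∣ n) → AverageUniformMixing (orientedCycle n)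
corollary5 n 3≤n 2∤n = UniformMixing.averageUniformMixing {n} {orientedCycle n}
  -- Rational division takes the proof that `n` is nonzero as an irrelevant argument, so `1/n`
  -- agrees by `refl` with the value formed from the index `j`.
  U isTransition (λ k → Column.u k) (λ t j k → refl) 1/n (λ j → refl) (λ j k → BP-deviation k j)
  where
  instance
    n≢0 : ℕ.NonZero n
    n≢0 = ℕ.>-nonZero (ℕ.≤-trans (ℕ.s≤s ℕ.z≤n) 3≤n)
  open CyclicIndices n
  open CycleExponential prev next-prev prev-next (next≢prev 3≤n)
  open OddCycle n (proj₁ (odd⇒1+h+h n 2∤n)) (proj₂ (odd⇒1+h+h n 2∤n)) 3≤n
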